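{- Let $n\ge 21$ and $2\le s\le 2^{n-1}$. Then: (a) Up to reordering the coordinates, $[n]^{(\ge 3)}\cup \{A\in [n]^{(2)}:1\in A\}$ is the unique family $\mathcal{A}\subset\mathcal{P}([n])$ of size $\sum_{k=3}^n \binom{n}{k}+n-1$ that maximises the number of intersecting subfamilies of size $s$ (over all families in $\mathcal{P}([n])$ of that size). (b) Up to reordering the coordinates, $[n]^{(\ge 3)}\cup \{A\in [n]^{(2)}:n\notin A\}$ is the unique family $\mathcal{A}\subset\mathcal{P}([n])$ of size $\sum_{k=3}^n \binom{n}{k}+\binom{n-1}{2}$ that maximises the number of intersecting subfamilies of size $s$ (over all families in $\mathcal{P}([n])$ of that size).
   Context: $[n]=\{1,\dots,n\}$, $\mathcal{P}([n])$ is its power set, $[n]^{(r)}$ is the set of $r$-element subsets of $[n]$ and $[n]^{(\ge r)}$ the set of subsets of size at least $r$. A family $\mathcal{F}$ of sets is intersecting if $F\cap F'\neq\emptyset$ for all $F,F'\in\mathcal{F}$. A subfamily of size $s$ of $\mathcal{A}$ is a subset of $\mathcal{A}$ with exactly $s$ members. -}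

module Defs where

open import Data.Bool using (Bool; true; false; _∧_; _∨_; not)
open import Data.Nat using (ℕ; zero; suc; _+_; _≤ᵇ_; _≡ᵇ_; _≤_; _∸_)
open import Data.Nat.Combinatorics using (_C_)
open import Data.List using (List; []; _∷_; _++_; map; length; upTo; drop; filterᵇ)
open import Data.Nat.ListAction using (sum)
open import Data.Bool.ListAction using (all)
open import Data.Vec using (Vec; []; _∷_; tabulate; lookup)
open import Data.Fin using (Fin)
open import Data.Fin.Subset using (Subset; _∩_; ∣_∣)
open import Function.Bundles using (_↔_; Inverse)
open import Relation.Binary.PropositionalEquality using (_≡_)
open import Data.Product using (Σ; _×_)

-- All subsets of [n] (each listed exactly once). A subset is a Vec Bool n,
-- coordinate i (0-based) being true iff element i+1 belongs to it.
allSubsets : (n : ℕ) → List (Subset n)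
allSubsets zero = [] ∷ []
allSubsets (suc n) = map (false ∷_) (allSubsets n) ++ map (true ∷_) (allSubsets n)

Family : ℕ → Set
Family n = Subset n → Bool

members : {n : ℕ} → Family n → List (Subset n)
members {n} F = filterᵇ F (allSubsets n)

size : {n : ℕ} → Family n → ℕ
size F = length (members F)

sublists : {A : Set} → List A → List (List A)
sublists [] = [] ∷ []
sublists (x ∷ xs) = sublists xs ++ map (x ∷_) (sublists xs)

meets : {n : ℕ} → Subset n → Subset n → Bool
meets p q = 1 ≤ᵇ ∣ p ∩ q ∣

-- F ∩ F' ≠ ∅ for all F, F' in the list (including F = F')
intersecting : {n : ℕ} → List (Subset n) → Bool
intersecting L = all (λ x → all (meets x) L) L

numIntersecting : {n : ℕ} → ℕ → Family n → ℕ
numIntersecting s F =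
  length (filterᵇ (λ L → (length L ≡ᵇ s) ∧ intersecting L) (sublists (members F)))

Maximiser : {n : ℕ} → ℕ → ℕ → Family n → Set
Maximiser {n} m s A = size A ≡ m × ((B : Family n) → size B ≡ m → numIntersecting s B ≤ numIntersecting s A)

permute : {n : ℕ} → (Fin n ↔ Fin n) → Subset n → Subset n
permute σ X = tabulate (λ i → lookup X (Inverse.to σ i))

Isomorphic : {n : ℕ} → Family n → Family n → Set
Isomorphic {n} A C = Σ (Fin n ↔ Fin n) (λ σ → (X : Subset n) → A X ≡ C (permute σ X))

firstIn : {n : ℕ} → Subset n → Bool
firstIn [] = false
firstIn (b ∷ _) = b

lastIn : {n : ℕ} → Subset n → Bool
lastIn [] = false
lastIn (b ∷ []) = b
lastIn (_ ∷ c ∷ xs) = lastIn (c ∷ xs)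

familyA : (n : ℕ) → Family n
familyA n X = (3 ≤ᵇ ∣ X ∣) ∨ ((∣ X ∣ ≡ᵇ 2) ∧ firstIn X)

familyB : (n : ℕ) → Family n
familyB n X = (3 ≤ᵇ ∣ X ∣) ∨ ((∣ X ∣ ≡ᵇ 2) ∧ not (lastIn X))

sumChoose≥3 : ℕ → ℕ
sumChoose≥3 n = sum (map (λ k → n C k) (drop 3 (upTo (suc n))))

{-# OPTIONS --safe #-}

-- Let h be an involution on the subsets of [n] that pairs each X not containing v with p(X) ∪ {v},
-- for an involution p of [n] fixing v. Replacing X by h(X) in a family whenever h(X) is missing
-- never decreases the number of intersecting subfamilies of size s: in a subfamily, the sets that
-- have to be moved and everything linked to them by X ∩ h(Y) = ∅ are moved up together. A family
-- which no such compression changes contains all sets that are larger than one of its members, so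
-- for the sizes in question it consists of all sets of size at least 3 and the edges of a graph on
-- [n]; the last compression leading to such a family is strict.
--
-- The 2-sets of an intersecting family form a star or a triangle. The number g(k) of intersecting
-- families of size s whose 2-sets are the k edges of a given star only depends on k, and triangles
-- do no better than stars with 3 edges. Hence for n − 1 edges the star is optimal. For the other
-- size, the graph is the complement of one with n − 1 edges. There the numbers of 2-edge stars and
-- of triangles are largest for the complement of a star. Larger stars may gain from vertices
-- of full degree, but 2(n − 2 − k) g(k + 1) ≤ g(k), and each vertex isolated in the complement
-- costs at least (n − 1)/4 2-edge stars, which outweighs this gain for n ≥ 21.

module Submission where

open import Defs
open import Data.Bool using (Bool; true; false; _∧_; _∨_; not; T; if_then_else_)
open import Data.Bool.ListAction using (all)
open import Data.Empty using (⊥; ⊥-elim)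
open import Data.List using (List; []; _∷_; _++_; map; length; filterᵇ; allFin; applyUpTo)
import Data.List as List
open import Data.List.Properties using (map-tabulate; length-tabulate; length-take; length-++; length-map; map-++; map-∘; ++-identityʳ)
open import Data.List.Membership.Propositional using (_∈_; _∉_)
open import Data.List.Membership.Propositional.Properties
open import Data.List.Relation.Unary.Any using (here; there)
open import Data.List.Relation.Unary.All using ([]; _∷_)
import Data.List.Relation.Unary.All.Properties as AllP
open import Data.List.Relation.Unary.AllPairs using ([]; _∷_)
open import Data.List.Relation.Unary.Unique.Propositional using (Unique)
import Data.List.Relation.Unary.Unique.Propositional.Properties as Uniq
open import Data.List.Relation.Binary.Permutation.Propositional renaming (refl to prefl; trans to ptrans)
open import Data.List.Relation.Binary.Permutation.Propositional.Properties using (∈-resp-↭; ↭-length; shift; ++⁺ˡ; ++⁺ʳ; map⁺)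
import Data.List.Relation.Binary.Permutation.Setoid.Properties as PermS
open import Data.Nat
open import Data.Nat.Properties
open import Data.Nat.Tactic.RingSolver using (solve-∀)
open import Data.Product using (Σ; _×_; _,_; proj₁; proj₂; ∃-syntax)
open import Data.Sum using (_⊎_; inj₁; inj₂)
open import Data.Unit using (tt)
open import Function using (_∘_; id)
open import Relation.Binary.PropositionalEquality hiding ([_]; J)
open import Relation.Nullary using (¬_; Dec; yes; no; does)
open import Data.Bool.Properties using (not-involutive) renaming (_≟_ to _≟B_)
open import Data.Fin using (Fin; zero; suc; fromℕ)
open import Data.Fin.Properties using () renaming (_≟_ to _≟F_)
open import Data.Fin.Subset using (Subset; ∣_∣; ∁)
open import Data.Vec using (Vec; []; _∷_; lookup; tabulate)
import Data.Vec.Properties as Vec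
open import Relation.Nullary.Decidable using (⌊_⌋; dec-true; dec-false)
import Data.List.Membership.DecPropositional as DecMem
open import Data.Nat.Combinatorics using (_C_; nCk+nC[k+1]≡[n+1]C[k+1]; nC1≡n; nCn≡1; nCk≡nC[n∸k])
open import Data.Nat.ListAction using (sum)
open import Function.Bundles using (mk↔ₛ′)

-- The strictness of the last compression yields uniqueness: a family that is not layered is
-- strictly beaten by a layered one, so every maximiser is layered. The bound s ≤ 2^(n - 1) enters
-- because one set from each complementary pair can be chosen to form an intersecting family of size
-- 2^(n - 1) around a given star; in particular g(2) > 0, which makes the comparisons strict. In
-- part (b) write L = n - 2. The degree sum is fixed at (L + 1) L, and the complement of a star has
-- only the degrees 0 and L. A count that is convex in the degree and vanishes at 0 stays on or
-- below the chord through 0 and L for all degrees up to L. So only degree L + 1, an isolated vertex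
-- of the complement, can exceed it. The sum of the squared degrees falls short of its maximum (L +
-- 1) L² by exactly the number D of ordered disjoint pairs of edges in the complement. D pays for
-- the isolated vertices, and D = 0 forces the complement to be a star.

private variable
  A B : Set
  n : ℕ

-- Booleans and finite sums

𝟙 : Bool → ℕ
𝟙 true = 1
𝟙 false = 0

true≢false : ∀ {b} → b ≡ true → b ≡ false → ⊥
true≢false refl ()

not-true : ∀ {b} → ¬ b ≡ true → b ≡ false
not-true {true} p = ⊥-elim (p refl)
not-true {false} p = refl

∧-true : ∀ {a b} → a ∧ b ≡ true → a ≡ true × b ≡ true
∧-true {true} {true} p = refl , refl

∧-intro : ∀ {a b} → a ≡ true → b ≡ true → a ∧ b ≡ true
∧-intro refl refl = refl

∨-true : ∀ {a b} → a ∨ b ≡ true → a ≡ true ⊎ b ≡ true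
∨-true {true} p = inj₁ refl
∨-true {false} p = inj₂ p

not-true⁻ : ∀ {b} → not b ≡ true → b ≡ false
not-true⁻ {false} p = refl

bool-ext : ∀ {a b} → (a ≡ true → b ≡ true) → (b ≡ true → a ≡ true) → a ≡ b
bool-ext {true} p q = sym (p refl)
bool-ext {false} {false} p q = refl
bool-ext {false} {true} p q = q refl

𝟙≤1 : ∀ b → 𝟙 b ≤ 1
𝟙≤1 true = ≤-refl
𝟙≤1 false = z≤n

𝟙-mono : ∀ {a b} → (a ≡ true → b ≡ true) → 𝟙 a ≤ 𝟙 b
𝟙-mono {false} p = z≤n
𝟙-mono {true} p rewrite p refl = ≤-refl

𝟙-∧ : ∀ a b → 𝟙 (a ∧ b) ≡ 𝟙 a * 𝟙 b
𝟙-∧ true b = sym (+-identityʳ _)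
𝟙-∧ false b = refl

≤ᵇ-true : ∀ {m n} → m ≤ n → (m ≤ᵇ n) ≡ true
≤ᵇ-true {m} {n} p with m ≤ᵇ n | ≤⇒≤ᵇ p
... | true | _ = refl

≤ᵇ-true⁻ : ∀ {m n} → (m ≤ᵇ n) ≡ true → m ≤ n
≤ᵇ-true⁻ {m} {n} p = ≤ᵇ⇒≤ m n (subst T (sym p) tt)

≡ᵇ-true : ∀ {m n} → m ≡ n → (m ≡ᵇ n) ≡ true
≡ᵇ-true {m} {n} p with m ≡ᵇ n | ≡⇒≡ᵇ m n p
... | true | _ = refl

≡ᵇ-true⁻ : ∀ {m n} → (m ≡ᵇ n) ≡ true → m ≡ n
≡ᵇ-true⁻ {m} {n} p = ≡ᵇ⇒≡ m n (subst T (sym p) tt)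

∑ : List A → (A → ℕ) → ℕ
∑ [] f = 0
∑ (x ∷ xs) f = f x + ∑ xs f

∑-cong : ∀ (xs : List A) {f g : A → ℕ} → (∀ x → x ∈ xs → f x ≡ g x) → ∑ xs f ≡ ∑ xs g
∑-cong [] p = refl
∑-cong (x ∷ xs) p = cong₂ _+_ (p x (here refl)) (∑-cong xs λ y q → p y (there q))

∑-mono : ∀ (xs : List A) {f g : A → ℕ} → (∀ x → x ∈ xs → f x ≤ g x) → ∑ xs f ≤ ∑ xs g
∑-mono [] p = z≤n
∑-mono (x ∷ xs) p = +-mono-≤ (p x (here refl)) (∑-mono xs λ y q → p y (there q))

∑-mono-< : ∀ (xs : List A) {f g : A → ℕ} → (∀ x → x ∈ xs → f x ≤ g x) →
  ∀ {y} → y ∈ xs → f y < g y → ∑ xs f < ∑ xs g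
∑-mono-< (x ∷ xs) p (here refl) q = +-mono-<-≤ q (∑-mono xs λ y r → p y (there r))
∑-mono-< (x ∷ xs) p (there y∈) q = +-mono-≤-< (p x (here refl)) (∑-mono-< xs (λ y r → p y (there r)) y∈ q)

∑-+ : ∀ (xs : List A) (f g : A → ℕ) → ∑ xs (λ x → f x + g x) ≡ ∑ xs f + ∑ xs g
∑-+ [] f g = refl
∑-+ (x ∷ xs) f g rewrite ∑-+ xs f g = lemma (f x) (g x) (∑ xs f) (∑ xs g)
  where
  lemma : ∀ a b c d → a + b + (c + d) ≡ a + c + (b + d)
  lemma = solve-∀

∑-* : ∀ (xs : List A) c (f : A → ℕ) → ∑ xs (λ x → c * f x) ≡ c * ∑ xs f
∑-* [] c f = sym (*-zeroʳ c)
∑-* (x ∷ xs) c f rewrite ∑-* xs c f = sym (*-distribˡ-+ c (f x) (∑ xs f))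

∑-zero : ∀ (xs : List A) {f : A → ℕ} → (∀ x → x ∈ xs → f x ≡ 0) → ∑ xs f ≡ 0
∑-zero [] p = refl
∑-zero (x ∷ xs) p rewrite p x (here refl) = ∑-zero xs λ y q → p y (there q)

∑-const : ∀ (xs : List A) c → ∑ xs (λ _ → c) ≡ length xs * c
∑-const [] c = refl
∑-const (x ∷ xs) c = cong (c +_) (∑-const xs c)

∑-++ : ∀ (xs ys : List A) f → ∑ (xs ++ ys) f ≡ ∑ xs f + ∑ ys f
∑-++ [] ys f = refl
∑-++ (x ∷ xs) ys f rewrite ∑-++ xs ys f = sym (+-assoc (f x) _ _)

∑-map : ∀ (h : A → B) (xs : List A) f → ∑ (map h xs) f ≡ ∑ xs (f ∘ h)
∑-map h [] f = refl
∑-map h (x ∷ xs) f = cong (f (h x) +_) (∑-map h xs f)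

∑-swap : ∀ (xs : List A) (ys : List B) (f : A → B → ℕ) →
  ∑ xs (λ x → ∑ ys (f x)) ≡ ∑ ys (λ y → ∑ xs (λ x → f x y))
∑-swap [] ys f = sym (∑-zero ys λ _ _ → refl)
∑-swap (x ∷ xs) ys f rewrite ∑-swap xs ys f = sym (∑-+ ys (f x) (λ y → ∑ xs (λ z → f z y)))

∑-↭ : ∀ {xs ys : List A} f → xs ↭ ys → ∑ xs f ≡ ∑ ys f
∑-↭ f prefl = refl
∑-↭ f (prep x p) = cong (f x +_) (∑-↭ f p)
∑-↭ f (swap x y p) rewrite ∑-↭ f p = lemma (f x) (f y) _
  where
  lemma : ∀ a b c → a + (b + c) ≡ b + (a + c)
  lemma = solve-∀
∑-↭ f (ptrans p q) = trans (∑-↭ f p) (∑-↭ f q)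

∑-∈ : ∀ (xs : List A) (f : A → ℕ) {x} → x ∈ xs → f x ≤ ∑ xs f
∑-∈ (x ∷ xs) f (here refl) = m≤m+n _ _
∑-∈ (y ∷ xs) f (there p) = ≤-trans (∑-∈ xs f p) (m≤n+m _ _)

filterᵇ-∷ : ∀ (p : A → Bool) x xs → filterᵇ p (x ∷ xs) ≡ (if p x then x ∷ filterᵇ p xs else filterᵇ p xs)
filterᵇ-∷ p x xs with p x
... | true = refl
... | false = refl

length-∑ : ∀ (xs : List A) → length xs ≡ ∑ xs (λ _ → 1)
length-∑ [] = refl
length-∑ (x ∷ xs) = cong suc (length-∑ xs)

length-filter-∑ : ∀ (p : A → Bool) xs → length (filterᵇ p xs) ≡ ∑ xs (𝟙 ∘ p)
length-filter-∑ p [] = refl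
length-filter-∑ p (x ∷ xs) with p x
... | true = cong suc (length-filter-∑ p xs)
... | false = length-filter-∑ p xs

∈-filterᵇ⁺ : ∀ (p : A → Bool) {x xs} → x ∈ xs → p x ≡ true → x ∈ filterᵇ p xs
∈-filterᵇ⁺ p {x} {y ∷ xs} (here refl) q rewrite q = here refl
∈-filterᵇ⁺ p {x} {y ∷ xs} (there r) q with p y
... | true = there (∈-filterᵇ⁺ p r q)
... | false = ∈-filterᵇ⁺ p r q

∈-filterᵇ⁻ : ∀ (p : A → Bool) {x} xs → x ∈ filterᵇ p xs → x ∈ xs × p x ≡ true
∈-filterᵇ⁻ p (y ∷ xs) r with p y in eq
∈-filterᵇ⁻ p (y ∷ xs) (here refl) | true = here refl , eq
∈-filterᵇ⁻ p (y ∷ xs) (there r) | true = let a , b = ∈-filterᵇ⁻ p xs r in there a , b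
... | false = let a , b = ∈-filterᵇ⁻ p xs r in there a , b

filterᵇ-unique : ∀ (p : A → Bool) {xs} → Unique xs → Unique (filterᵇ p xs)
filterᵇ-unique p u = Uniq.filter⁺ _ u

filterᵇ-split : ∀ (p : A → Bool) xs → xs ↭ filterᵇ p xs ++ filterᵇ (not ∘ p) xs
filterᵇ-split p [] = prefl
filterᵇ-split p (x ∷ xs) with p x
... | true = prep x (filterᵇ-split p xs)
... | false = ptrans (prep x (filterᵇ-split p xs)) (↭-sym (shift x (filterᵇ p xs) _))

filterᵇ-cong : ∀ {p q : A → Bool} xs → (∀ x → x ∈ xs → p x ≡ q x) → filterᵇ p xs ≡ filterᵇ q xs
filterᵇ-cong [] h = refl
filterᵇ-cong {p = p} {q} (x ∷ xs) h with p x | q x | h x (here refl)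
... | true | .true | refl = cong (x ∷_) (filterᵇ-cong xs λ y r → h y (there r))
... | false | .false | refl = filterᵇ-cong xs λ y r → h y (there r)

all-true : ∀ (p : A → Bool) xs → (∀ x → x ∈ xs → p x ≡ true) → all p xs ≡ true
all-true p [] h = refl
all-true p (x ∷ xs) h rewrite h x (here refl) = all-true p xs λ y r → h y (there r)

all-true⁻ : ∀ (p : A → Bool) xs → all p xs ≡ true → ∀ {x} → x ∈ xs → p x ≡ true
all-true⁻ p (x ∷ xs) h (here refl) = proj₁ (∧-true h)
all-true⁻ p (x ∷ xs) h (there r) = all-true⁻ p xs (proj₂ (∧-true {p x} h)) r

-- Duplicate-free lists

Unique-∷ : ∀ {x : A} {xs} → Unique xs → x ∉ xs → Unique (x ∷ xs)
Unique-∷ u x∉ = AllP.¬Any⇒All¬ _ x∉ ∷ u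

Unique-head : ∀ {x : A} {xs} → Unique (x ∷ xs) → x ∉ xs
Unique-head (p ∷ _) = AllP.All¬⇒¬Any p

Unique-tail : ∀ {x : A} {xs} → Unique (x ∷ xs) → Unique xs
Unique-tail (_ ∷ u) = u

Unique-↭ : ∀ {xs ys : List A} → xs ↭ ys → Unique xs → Unique ys
Unique-↭ {A = A} p = PermS.Unique-resp-↭ (setoid A) (↭⇒↭ₛ p)

Unique-++-disjoint : ∀ (xs : List A) {ys x} → Unique (xs ++ ys) → x ∈ xs → x ∉ ys
Unique-++-disjoint (x ∷ xs) u (here refl) r = Unique-head u (∈-++⁺ʳ xs r)
Unique-++-disjoint (x ∷ xs) u (there q) r = Unique-++-disjoint xs (Unique-tail u) q r

Unique-map : ∀ (f : A → B) {xs} → (∀ {x y} → x ∈ xs → y ∈ xs → f x ≡ f y → x ≡ y) →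
  Unique xs → Unique (map f xs)
Unique-map f {[]} inj u = []
Unique-map f {x ∷ xs} inj u = Unique-∷ (Unique-map f (λ p q → inj (there p) (there q)) (Unique-tail u)) λ r →
  let y , y∈ , eq = ∈-map⁻ f r in
  Unique-head u (subst (_∈ xs) (sym (inj (here refl) (there y∈) eq)) y∈)

∈-extract : ∀ {x : A} {ys} → x ∈ ys → ∃[ zs ] ys ↭ x ∷ zs
∈-extract {x = x} x∈ with ∈-∃++ x∈
... | as , bs , refl = as ++ bs , shift x as bs

∈-∷-≢ : ∀ {x z : A} {ys} → z ∈ x ∷ ys → z ≢ x → z ∈ ys
∈-∷-≢ (here p) q = ⊥-elim (q p)
∈-∷-≢ (there p) q = p

Unique-extract : ∀ {xs ys : List A} → Unique xs → (∀ {x} → x ∈ xs → x ∈ ys) → ∃[ zs ] ys ↭ xs ++ zs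
Unique-extract {xs = []} {ys} u s = ys , prefl
Unique-extract {xs = x ∷ xs} u s with ∈-extract (s (here refl))
... | ys' , p with Unique-extract {xs = xs} {ys'} (Unique-tail u)
    (λ {z} z∈ → ∈-∷-≢ (∈-resp-↭ p (s (there z∈))) λ { refl → Unique-head u z∈ })
... | zs , q = zs , ptrans p (prep x q)

Unique-length : ∀ {xs ys : List A} → Unique xs → (∀ {x} → x ∈ xs → x ∈ ys) → length xs ≤ length ys
Unique-length {xs = xs} u s with Unique-extract u s
... | zs , p rewrite ↭-length p | length-++ xs {zs} = m≤m+n _ _

Unique-⊆⊇ : ∀ {xs ys : List A} → Unique xs → Unique ys → (∀ {x} → x ∈ xs → x ∈ ys) →
  (∀ {x} → x ∈ ys → x ∈ xs) → xs ↭ ys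
Unique-⊆⊇ {xs = xs} u v s t with Unique-extract u s
... | [] , p = ↭-sym (subst (_ ↭_) (++-identityʳ xs) p)
... | z ∷ zs , p = ⊥-elim (Unique-++-disjoint xs (Unique-↭ p v)
      (t (∈-resp-↭ (↭-sym p) (∈-++⁺ʳ xs (here refl)))) (here refl))

inj-length : ∀ (f : A → B) {xs ys} → Unique xs → (∀ {x} → x ∈ xs → f x ∈ ys) →
  (∀ {x y} → x ∈ xs → y ∈ xs → f x ≡ f y → x ≡ y) → length xs ≤ length ys
inj-length f {xs} {ys} u s inj = subst (_≤ length ys) (length-map f xs)
  (Unique-length (Unique-map f inj u) λ r → let y , y∈ , eq = ∈-map⁻ f r in subst (_∈ ys) (sym eq) (s y∈))

inj-length-< : ∀ (f : A → B) {xs ys} → Unique xs → (∀ {x} → x ∈ xs → f x ∈ ys) →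
  (∀ {x y} → x ∈ xs → y ∈ xs → f x ≡ f y → x ≡ y) →
  ∀ {z} → z ∈ ys → (∀ {x} → x ∈ xs → f x ≢ z) → length xs < length ys
inj-length-< f {xs} {ys} u s inj {z} z∈ nz = subst (λ k → suc k ≤ length ys) (length-map f xs)
  (Unique-length (Unique-∷ (Unique-map f inj u) λ r → let y , y∈ , eq = ∈-map⁻ f r in nz y∈ (sym eq))
    λ { (here refl) → z∈ ; (there r) → let y , y∈ , eq = ∈-map⁻ f r in subst (_∈ ys) (sym eq) (s y∈) })

∑-bij : ∀ (f : A → A) {xs} → Unique xs → (∀ {x} → x ∈ xs → f x ∈ xs) → (∀ x → f (f x) ≡ x) →
  ∀ g → ∑ xs (g ∘ f) ≡ ∑ xs g
∑-bij f {xs} u s inv g = trans (sym (∑-map f xs g)) (∑-↭ g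
  (Unique-⊆⊇ (Unique-map f (λ {x} {y} _ _ e → trans (sym (inv x)) (trans (cong f e) (inv y))) u) u
    (λ r → let y , y∈ , eq = ∈-map⁻ f r in subst (_∈ xs) (sym eq) (s y∈))
    (λ {x} x∈ → subst (_∈ map f xs) (inv x) (∈-map⁺ f (s x∈)))))

∑-𝟙≤1 : ∀ {xs : List A} → Unique xs → (p : A → Bool) →
  (∀ {x y} → x ∈ xs → y ∈ xs → p x ≡ true → p y ≡ true → x ≡ y) → ∑ xs (𝟙 ∘ p) ≤ 1
∑-𝟙≤1 {xs = []} u p h = z≤n
∑-𝟙≤1 {xs = x ∷ xs} u p h with p x in eq
... | false = ∑-𝟙≤1 (Unique-tail u) p λ a b → h (there a) (there b)
... | true = ≤-reflexive (cong suc (∑-zero xs λ y y∈ → cong 𝟙 (not-true λ q →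
      Unique-head u (subst (_∈ xs) (sym (h (here refl) (there y∈) eq q)) y∈))))

∑-𝟙≡1 : ∀ {xs : List A} → Unique xs → (p : A → Bool) →
  (∀ {x y} → x ∈ xs → y ∈ xs → p x ≡ true → p y ≡ true → x ≡ y) →
  ∀ {x} → x ∈ xs → p x ≡ true → ∑ xs (𝟙 ∘ p) ≡ 1
∑-𝟙≡1 {xs = xs} u p h {x} x∈ px = ≤-antisym (∑-𝟙≤1 u p h)
  (≤-trans (≤-reflexive (cong 𝟙 (sym px))) (∑-∈ xs (𝟙 ∘ p) x∈))

-- Sums over sublists

sub-∈ : ∀ {xs H : List A} {z} → H ∈ sublists xs → z ∈ H → z ∈ xs
sub-∈ {xs = []} (here refl) ()
sub-∈ {xs = x ∷ xs} r z∈ with ∈-++⁻ (sublists xs) r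
... | inj₁ q = there (sub-∈ q z∈)
... | inj₂ q with ∈-map⁻ (x ∷_) q
sub-∈ {xs = x ∷ xs} r (here refl) | inj₂ q | H' , H'∈ , refl = here refl
sub-∈ {xs = x ∷ xs} r (there z∈) | inj₂ q | H' , H'∈ , refl = there (sub-∈ H'∈ z∈)

sub-Unique : ∀ {xs H : List A} → Unique xs → H ∈ sublists xs → Unique H
sub-Unique {xs = []} u (here refl) = []
sub-Unique {xs = x ∷ xs} u r with ∈-++⁻ (sublists xs) r
... | inj₁ q = sub-Unique (Unique-tail u) q
... | inj₂ q with ∈-map⁻ (x ∷_) q
... | H' , H'∈ , refl = Unique-∷ (sub-Unique (Unique-tail u) H'∈) λ x∈ → Unique-head u (sub-∈ H'∈ x∈)

sublists-Unique : ∀ {xs : List A} → Unique xs → Unique (sublists xs)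
sublists-Unique {xs = []} u = [] ∷ []
sublists-Unique {xs = x ∷ xs} u = Uniq.++⁺ (sublists-Unique (Unique-tail u))
  (Unique-map (x ∷_) (λ { _ _ refl → refl }) (sublists-Unique (Unique-tail u)))
  λ { {H} (a , b) → let H' , H'∈ , eq = ∈-map⁻ (x ∷_) b in
        Unique-head u (sub-∈ a (subst (x ∈_) (sym eq) (here refl))) }

filterᵇ-∈-sublists : ∀ (p : A → Bool) xs → filterᵇ p xs ∈ sublists xs
filterᵇ-∈-sublists p [] = here refl
filterᵇ-∈-sublists p (x ∷ xs) with p x
... | true = ∈-++⁺ʳ (sublists xs) (∈-map⁺ (x ∷_) (filterᵇ-∈-sublists p xs))
... | false = ∈-++⁺ˡ (filterᵇ-∈-sublists p xs)

SS : List A → (List A → ℕ) → ℕ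
SS xs F = ∑ (sublists xs) F

SS-∷ : ∀ (x : A) xs F → SS (x ∷ xs) F ≡ SS xs F + SS xs (F ∘ (x ∷_))
SS-∷ x xs F = trans (∑-++ (sublists xs) _ F) (cong (SS xs F +_) (∑-map (x ∷_) (sublists xs) F))

Resp↭ : (List A → ℕ) → Set
Resp↭ F = ∀ {xs ys} → xs ↭ ys → F xs ≡ F ys

SS-cong′ : ∀ (xs : List A) {F G} → (∀ H → F H ≡ G H) → SS xs F ≡ SS xs G
SS-cong′ xs h = ∑-cong (sublists xs) λ H _ → h H

-- In the `swap` case the two middle sums trade places, and the last one runs over lists headed by x
-- and y in opposite orders; this is where the invariance of `F` enters.
SS-↭ : ∀ {xs ys : List A} F → Resp↭ F → xs ↭ ys → SS xs F ≡ SS ys F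
SS-↭ F r prefl = refl
SS-↭ F r (prep {xs} {ys} x p) rewrite SS-∷ x xs F | SS-∷ x ys F =
  cong₂ _+_ (SS-↭ F r p) (SS-↭ (F ∘ (x ∷_)) (λ q → r (prep x q)) p)
SS-↭ F r (swap {xs} {ys} x y p)
  rewrite SS-∷ x (y ∷ xs) F | SS-∷ y (x ∷ ys) F | SS-∷ y xs F | SS-∷ x ys F
        | SS-∷ y xs (F ∘ (x ∷_)) | SS-∷ x ys (F ∘ (y ∷_))
        | SS-↭ F r p | SS-↭ (F ∘ (x ∷_)) (λ q → r (prep x q)) p | SS-↭ (F ∘ (y ∷_)) (λ q → r (prep y q)) p
        | SS-↭ (F ∘ (x ∷_) ∘ (y ∷_)) (λ q → r (prep x (prep y q))) p
  = trans (lemma (SS ys F) (SS ys (F ∘ (y ∷_))) (SS ys (F ∘ (x ∷_))) _)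
      (cong (λ z → SS ys F + SS ys (F ∘ (x ∷_)) + (SS ys (F ∘ (y ∷_)) + z))
        (SS-cong′ ys λ H → r (swap x y prefl)))
  where
  lemma : ∀ a b c d → a + b + (c + d) ≡ a + c + (b + d)
  lemma = solve-∀
SS-↭ F r (ptrans p q) = trans (SS-↭ F r p) (SS-↭ F r q)

SS-++ : ∀ (xs ys : List A) F → SS (xs ++ ys) F ≡ SS xs (λ H → SS ys (λ B → F (H ++ B)))
SS-++ [] ys F = sym (+-identityʳ _)
SS-++ (x ∷ xs) ys F rewrite SS-∷ x (xs ++ ys) F | SS-∷ x xs (λ H → SS ys (λ B → F (H ++ B))) =
  cong₂ _+_ (SS-++ xs ys F) (SS-++ xs ys (F ∘ (x ∷_)))

-- The indicator kills every sublist that leaves `p`, so a condition on all members becomes a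
-- smaller ground list. Stars at v, for instance, turn into sublists of the edges at v.
SS-filter : ∀ (p : A → Bool) xs F → SS xs (λ H → 𝟙 (all p H) * F H) ≡ SS (filterᵇ p xs) F
SS-filter p [] F = cong (_+ 0) (*-identityˡ (F []))
SS-filter p (x ∷ xs) F rewrite SS-∷ x xs (λ H → 𝟙 (all p H) * F H) with p x
... | true rewrite SS-∷ x (filterᵇ p xs) F = cong₂ _+_ (SS-filter p xs F) (SS-filter p xs (F ∘ (x ∷_)))
... | false rewrite ∑-zero (sublists xs) {λ _ → 0} (λ _ _ → refl) = trans (+-identityʳ _) (SS-filter p xs F)

SS-map : ∀ (h : A → B) xs F → SS (map h xs) F ≡ SS xs (F ∘ map h)
SS-map h [] F = refl
SS-map h (x ∷ xs) F rewrite SS-∷ (h x) (map h xs) F | SS-∷ x xs (F ∘ map h) =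
  cong₂ _+_ (SS-map h xs F) (SS-map h xs (F ∘ (h x ∷_)))

-- This is ∑ C(d,k) g(k) over all k. The recursion is Pascal's rule and makes the increment in d
-- visible: it is the same sum for the shifted function.
S : ℕ → (ℕ → ℕ) → ℕ
S zero g = g 0
S (suc d) g = S d g + S d (g ∘ suc)

SS-length : ∀ (xs : List A) g → SS xs (g ∘ length) ≡ S (length xs) g
SS-length [] g = +-identityʳ _
SS-length (x ∷ xs) g rewrite SS-∷ x xs (g ∘ length) = cong₂ _+_ (SS-length xs g) (SS-length xs (g ∘ suc))

S-cong : ∀ d {g h : ℕ → ℕ} → (∀ k → k ≤ d → g k ≡ h k) → S d g ≡ S d h
S-cong zero p = p 0 z≤n
S-cong (suc d) p = cong₂ _+_ (S-cong d λ k q → p k (m≤n⇒m≤1+n q)) (S-cong d λ k q → p (suc k) (s≤s q))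

S-+ : ∀ d g h → S d (λ k → g k + h k) ≡ S d g + S d h
S-+ zero g h = refl
S-+ (suc d) g h rewrite S-+ d g h | S-+ d (g ∘ suc) (h ∘ suc) = lemma (S d g) _ _ _
  where
  lemma : ∀ a b c d → a + b + (c + d) ≡ a + c + (b + d)
  lemma = solve-∀

S-* : ∀ d c g → S d (λ k → c * g k) ≡ c * S d g
S-* zero c g = refl
S-* (suc d) c g rewrite S-* d c g | S-* d c (g ∘ suc) = sym (*-distribˡ-+ c _ _)

S-≤ : ∀ d g → S d g ≤ S (suc d) g
S-≤ d g = m≤m+n _ _

-- Subsets of [n]

_≟S_ : (X Y : Subset n) → Dec (X ≡ Y)
_≟S_ = Vec.≡-dec _≟B_

_==_ : Subset n → Subset n → Bool
X == Y = ⌊ X ≟S Y ⌋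

==-true : ∀ {X Y : Subset n} → X ≡ Y → (X == Y) ≡ true
==-true {X = X} {Y} p with X ≟S Y
... | yes _ = refl
... | no q = ⊥-elim (q p)

==-true⁻ : ∀ {X Y : Subset n} → (X == Y) ≡ true → X ≡ Y
==-true⁻ {X = X} {Y} p with X ≟S Y
... | yes q = q

_∋_ : Subset n → Fin n → Set
X ∋ i = lookup X i ≡ true

≗⇒≡ : ∀ {X Y : Subset n} → (∀ i → lookup X i ≡ lookup Y i) → X ≡ Y
≗⇒≡ {X = X} {Y} h = trans (sym (Vec.tabulate∘lookup X)) (trans (Vec.tabulate-cong h) (Vec.tabulate∘lookup Y))

subset-ext : ∀ {X Y : Subset n} → (∀ i → X ∋ i → Y ∋ i) → (∀ i → Y ∋ i → X ∋ i) → X ≡ Y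
subset-ext p q = ≗⇒≡ λ i → bool-ext (p i) (q i)

∈-Fin : ∀ (i : Fin n) → i ∈ allFin n
∈-Fin = ∈-allFin

allFin-Unique : ∀ n → Unique (allFin n)
allFin-Unique = Uniq.allFin⁺

∑-allFin-suc : ∀ n (f : Fin (suc n) → ℕ) → ∑ (allFin (suc n)) f ≡ f zero + ∑ (allFin n) (f ∘ suc)
∑-allFin-suc n f = cong (f zero +_)
  (trans (cong (λ l → ∑ l f) (sym (map-tabulate id suc))) (∑-map suc (allFin n) f))

length-allFin : ∀ n → length (allFin n) ≡ n
length-allFin n = length-tabulate id

card-∑ : ∀ (X : Subset n) → ∣ X ∣ ≡ ∑ (allFin n) (𝟙 ∘ lookup X)
card-∑ [] = refl
card-∑ {suc n} (true ∷ X) rewrite ∑-allFin-suc n (𝟙 ∘ lookup (true ∷ X)) = cong suc (card-∑ X)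
card-∑ {suc n} (false ∷ X) rewrite ∑-allFin-suc n (𝟙 ∘ lookup (false ∷ X)) = card-∑ X

elems : Subset n → List (Fin n)
elems {n} X = filterᵇ (lookup X) (allFin n)

elems-Unique : ∀ (X : Subset n) → Unique (elems X)
elems-Unique X = filterᵇ-unique (lookup X) (allFin-Unique _)

∈-elems : ∀ (X : Subset n) {i} → X ∋ i → i ∈ elems X
∈-elems X {i} p = ∈-filterᵇ⁺ (lookup X) (∈-Fin i) p

∈-elems⁻ : ∀ (X : Subset n) {i} → i ∈ elems X → X ∋ i
∈-elems⁻ X p = proj₂ (∈-filterᵇ⁻ (lookup X) (allFin _) p)

length-elems : ∀ (X : Subset n) → length (elems X) ≡ ∣ X ∣
length-elems X = trans (length-filter-∑ (lookup X) (allFin _)) (sym (card-∑ X))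

card-≥ : ∀ (X : Subset n) {us} → Unique us → (∀ {i} → i ∈ us → X ∋ i) → length us ≤ ∣ X ∣
card-≥ X u h = subst (_ ≤_) (length-elems X) (Unique-length u λ p → ∈-elems X (h p))

card-≤ : ∀ (X : Subset n) {us} → (∀ {i} → X ∋ i → i ∈ us) → ∣ X ∣ ≤ length us
card-≤ X h = subst (_≤ _) (length-elems X) (Unique-length (elems-Unique X) λ p → h (∈-elems⁻ X p))

card-mono : ∀ (X Y : Subset n) → (∀ i → X ∋ i → Y ∋ i) → ∣ X ∣ ≤ ∣ Y ∣
card-mono X Y h = subst (_ ≤_) (length-elems Y) (card-≤ X λ p → ∈-elems Y (h _ p))

⊆-card-≡ : ∀ (X Y : Subset n) → (∀ i → X ∋ i → Y ∋ i) → ∣ Y ∣ ≤ ∣ X ∣ → X ≡ Y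
⊆-card-≡ X Y h le = subset-ext h λ i yi → bool-lemma i yi
  where
  bool-lemma : ∀ i → Y ∋ i → X ∋ i
  bool-lemma i yi with lookup X i in eq
  ... | true = refl
  ... | false = ⊥-elim (<-irrefl refl (≤-trans (subst (λ k → suc k ≤ ∣ Y ∣) (length-elems X)
        (card-≥ Y (Unique-∷ (elems-Unique X) λ p → true≢false (∈-elems⁻ X p) eq)
          λ { (here refl) → yi ; (there p) → h _ (∈-elems⁻ X p) })) le))

infix 6 ⟦_⟧
abstract
  ⟦_⟧ : List (Fin n) → Subset n
  ⟦ us ⟧ = tabulate λ i → ⌊ DecMem._∈?_ _≟F_ i us ⌋

  ⟦⟧-∋ : ∀ {us : List (Fin n)} {i} → i ∈ us → ⟦ us ⟧ ∋ i
  ⟦⟧-∋ {us = us} {i} p rewrite Vec.lookup∘tabulate (λ i → ⌊ DecMem._∈?_ _≟F_ i us ⌋) i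
    with DecMem._∈?_ _≟F_ i us
  ... | yes _ = refl
  ... | no q = ⊥-elim (q p)

  ⟦⟧-∋⁻ : ∀ {us : List (Fin n)} {i} → ⟦ us ⟧ ∋ i → i ∈ us
  ⟦⟧-∋⁻ {us = us} {i} p rewrite Vec.lookup∘tabulate (λ i → ⌊ DecMem._∈?_ _≟F_ i us ⌋) i
    with DecMem._∈?_ _≟F_ i us
  ... | yes q = q

⟦⟧-∌ : ∀ {us : List (Fin n)} {i} → i ∉ us → lookup ⟦ us ⟧ i ≡ false
⟦⟧-∌ p = not-true (p ∘ ⟦⟧-∋⁻)

card-⟦⟧ : ∀ {us : List (Fin n)} → Unique us → ∣ ⟦ us ⟧ ∣ ≡ length us
card-⟦⟧ {us = us} u = ≤-antisym (card-≤ ⟦ us ⟧ ⟦⟧-∋⁻) (card-≥ ⟦ us ⟧ u ⟦⟧-∋)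

∁-∋ : ∀ (X : Subset n) i → lookup (∁ X) i ≡ not (lookup X i)
∁-∋ X i = Vec.lookup-map i not X

∁-∁ : ∀ (X : Subset n) → ∁ (∁ X) ≡ X
∁-∁ X = ≗⇒≡ λ i → trans (∁-∋ (∁ X) i) (trans (cong not (∁-∋ X i)) (not-involutive _))

card-∁ : ∀ (X : Subset n) → ∣ ∁ X ∣ + ∣ X ∣ ≡ n
card-∁ [] = refl
card-∁ (true ∷ X) = trans (+-suc _ _) (cong suc (card-∁ X))
card-∁ (false ∷ X) = cong suc (card-∁ X)

meets⁺ : ∀ (X Y : Subset n) {i} → X ∋ i → Y ∋ i → meets X Y ≡ true
meets⁺ (true ∷ X) (true ∷ Y) {zero} p q = refl
meets⁺ (x ∷ X) (y ∷ Y) {suc i} p q with x ∧ y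
... | true = refl
... | false = meets⁺ X Y {i} p q

meets⁻ : ∀ (X Y : Subset n) → meets X Y ≡ true → ∃[ i ] X ∋ i × Y ∋ i
meets⁻ [] [] ()
meets⁻ (true ∷ X) (true ∷ Y) p = zero , refl , refl
meets⁻ (true ∷ X) (false ∷ Y) p = let i , a , b = meets⁻ X Y p in suc i , a , b
meets⁻ (false ∷ X) (y ∷ Y) p = let i , a , b = meets⁻ X Y p in suc i , a , b

meets-comm : ∀ (X Y : Subset n) → meets X Y ≡ meets Y X
meets-comm X Y = bool-ext (λ p → let i , a , b = meets⁻ X Y p in meets⁺ Y X b a)
  (λ p → let i , a , b = meets⁻ Y X p in meets⁺ X Y b a)

meets-∁⁻ : ∀ (X Y : Subset n) → meets X (∁ Y) ≡ false → ∀ i → X ∋ i → Y ∋ i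
meets-∁⁻ X Y p i xi with lookup Y i in eq
... | true = refl
... | false = ⊥-elim (true≢false (meets⁺ X (∁ Y) xi (trans (∁-∋ Y i) (cong not eq))) p)

-- A set disjoint from `∁ Y` lies inside `Y`, and a subset of `Y` that is no smaller than `Y` equals
-- it. Hence the complement of a small set meets nearly everything.
meets-∁ : ∀ (X Y : Subset n) → ∣ Y ∣ ≤ ∣ X ∣ → X ≢ Y → meets X (∁ Y) ≡ true
meets-∁ X Y le ne with meets X (∁ Y) in eq
... | true = refl
... | false = ⊥-elim (ne (⊆-card-≡ X Y (meets-∁⁻ X Y eq) le))

meets-∁∁ : ∀ (X Y : Subset n) → ∣ X ∣ + ∣ Y ∣ < n → meets (∁ X) (∁ Y) ≡ true
meets-∁∁ {n} X Y lt with meets (∁ X) (∁ Y) in eq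
... | true = refl
... | false = ⊥-elim (<-irrefl refl (≤-trans lt
      (subst (_≤ ∣ X ∣ + ∣ Y ∣) (trans (+-comm ∣ X ∣ _) (card-∁ X))
        (+-monoʳ-≤ ∣ X ∣ (card-mono (∁ X) Y (meets-∁⁻ (∁ X) Y eq))))))

allSubsets-complete : ∀ (X : Subset n) → X ∈ allSubsets n
allSubsets-complete [] = here refl
allSubsets-complete {suc n} (false ∷ X) = ∈-++⁺ˡ (∈-map⁺ (false ∷_) (allSubsets-complete X))
allSubsets-complete {suc n} (true ∷ X) =
  ∈-++⁺ʳ (map (false ∷_) (allSubsets n)) (∈-map⁺ (true ∷_) (allSubsets-complete X))

allSubsets-Unique : ∀ n → Unique (allSubsets n)
allSubsets-Unique zero = [] ∷ []
allSubsets-Unique (suc n) = Uniq.++⁺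
  (Unique-map (false ∷_) (λ { _ _ refl → refl }) (allSubsets-Unique n))
  (Unique-map (true ∷_) (λ { _ _ refl → refl }) (allSubsets-Unique n))
  λ (a , b) → false∷≢true∷ (∈-map⁻ _ a) (∈-map⁻ _ b)
  where
  false∷≢true∷ : ∀ {X : Subset (suc n)} → ∃[ Y ] (Y ∈ allSubsets n × X ≡ false ∷ Y) →
    ∃[ Y ] (Y ∈ allSubsets n × X ≡ true ∷ Y) → ⊥
  false∷≢true∷ (_ , _ , refl) (_ , _ , ())

length-allSubsets : ∀ n → length (allSubsets n) ≡ 2 ^ n
length-allSubsets zero = refl
length-allSubsets (suc n) = trans (length-++ (map (cons false) (allSubsets n)))
  (cong₂ _+_ (trans (length-map (cons false) (allSubsets n)) (length-allSubsets n))
    (trans (length-map (cons true) (allSubsets n)) (trans (length-allSubsets n) (sym (+-identityʳ _)))))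
  where
  cons : Bool → Subset n → Subset (suc n)
  cons b X = b ∷ X

∈-members : ∀ (F : Family n) {X} → F X ≡ true → X ∈ members F
∈-members F {X} p = ∈-filterᵇ⁺ F (allSubsets-complete X) p

∈-members⁻ : ∀ (F : Family n) {X} → X ∈ members F → F X ≡ true
∈-members⁻ F p = proj₂ (∈-filterᵇ⁻ F (allSubsets _) p)

members-Unique : ∀ (F : Family n) → Unique (members F)
members-Unique F = filterᵇ-unique F (allSubsets-Unique _)

size-∑ : ∀ (F : Family n) → size F ≡ ∑ (allSubsets n) (𝟙 ∘ F)
size-∑ F = length-filter-∑ F (allSubsets _)

abstract
  mem : List (Subset n) → Family n
  mem L X = ⌊ DecMem._∈?_ _≟S_ X L ⌋

  mem⁺ : ∀ {L : List (Subset n)} {X} → X ∈ L → mem L X ≡ true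
  mem⁺ {L = L} {X} p with DecMem._∈?_ _≟S_ X L
  ... | yes _ = refl
  ... | no q = ⊥-elim (q p)

  mem⁻ : ∀ {L : List (Subset n)} {X} → mem L X ≡ true → X ∈ L
  mem⁻ {L = L} {X} p with DecMem._∈?_ _≟S_ X L
  ... | yes q = q

-- In a duplicate-free list a sublist is recovered from its membership predicate. This allows the
-- counted sublists to be treated as Boolean families.
filterᵇ-mem : ∀ {xs L : List (Subset n)} → Unique xs → L ∈ sublists xs → filterᵇ (mem L) xs ≡ L
filterᵇ-mem {xs = []} u (here refl) = refl
filterᵇ-mem {xs = x ∷ xs} {L} u r with ∈-++⁻ (sublists xs) r
... | inj₁ q with mem L x in eq
...   | true = ⊥-elim (Unique-head u (sub-∈ q (mem⁻ eq)))
...   | false = filterᵇ-mem (Unique-tail u) q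
filterᵇ-mem {xs = x ∷ xs} u r | inj₂ q with ∈-map⁻ (x ∷_) q
... | L' , L'∈ , refl with mem (x ∷ L') x in eq
... | false = ⊥-elim (true≢false (mem⁺ {L = x ∷ L'} (here refl)) eq)
... | true = cong (x ∷_) (trans (filterᵇ-cong xs λ y y∈ →
        bool-ext (λ p → mem⁺ (∈-∷-≢ (mem⁻ p) λ { refl → Unique-head u y∈ })) (λ p → mem⁺ (there (mem⁻ {L = L'} p))))
      (filterᵇ-mem (Unique-tail u) L'∈))

abstract
  inter? : List (Subset n) → Bool
  inter? = intersecting

  inter⁺ : ∀ {L : List (Subset n)} → (∀ X Y → X ∈ L → Y ∈ L → meets X Y ≡ true) → inter? L ≡ true
  inter⁺ {L = L} h = all-true _ L λ X X∈ → all-true _ L λ Y Y∈ → h X Y X∈ Y∈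

  inter⁻ : ∀ {L : List (Subset n)} → inter? L ≡ true → ∀ {X Y} → X ∈ L → Y ∈ L → meets X Y ≡ true
  inter⁻ {L = L} h {X} X∈ Y∈ = all-true⁻ _ L (all-true⁻ _ L h X∈) Y∈

inter-⊆ : ∀ {K L : List (Subset n)} → (∀ {X} → X ∈ K → X ∈ L) → inter? L ≡ true → inter? K ≡ true
inter-⊆ s h = inter⁺ λ X Y a b → inter⁻ h (s a) (s b)

abstract
  good : ℕ → List (Subset n) → Bool
  good s L = (length L ≡ᵇ s) ∧ inter? L

  good⁺ : ∀ {s} {L : List (Subset n)} → length L ≡ s → inter? L ≡ true → good s L ≡ true
  good⁺ p q = ∧-intro (≡ᵇ-true p) q

  good⁻ : ∀ {s} {L : List (Subset n)} → good s L ≡ true → length L ≡ s × inter? L ≡ true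
  good⁻ p = let a , b = ∧-true p in ≡ᵇ-true⁻ a , b

  numIntersecting-SS : ∀ s (F : Family n) → numIntersecting s F ≡ SS (members F) (𝟙 ∘ good s)
  numIntersecting-SS s F = length-filter-∑ (good s) (sublists (members F))

  good-filter : ∀ s (F : Family n) → numIntersecting s F ≡ length (filterᵇ (good s) (sublists (members F)))
  good-filter s F = refl

good-↭ : ∀ {s} → Resp↭ {Subset n} (𝟙 ∘ good s)
good-↭ {s = s} {xs} {ys} p = cong 𝟙 (bool-ext (f p) (f (↭-sym p)))
  where
  f : ∀ {xs ys : List (Subset _)} → xs ↭ ys → good s xs ≡ true → good s ys ≡ true
  f p h = let a , b = good⁻ h in good⁺ (trans (sym (↭-length p)) a) (inter-⊆ (∈-resp-↭ (↭-sym p)) b)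

card-2 : ∀ (X : Subset n) → ∣ X ∣ ≡ 2 → ∃[ u ] ∃[ v ] u ≢ v × X ≡ ⟦ u ∷ v ∷ [] ⟧
card-2 X c with elems X in eq | length-elems X | elems-Unique X
... | u ∷ v ∷ [] | _ | (p ∷ []) ∷ _ = u , v , p , subset-ext
      (λ i xi → ⟦⟧-∋ (subst (i ∈_) eq (∈-elems X xi))) (λ i q → ∈-elems⁻ X (subst (i ∈_) (sym eq) (⟦⟧-∋⁻ q)))
... | [] | q | _ with trans q c
...   | ()
card-2 X c | u ∷ [] | q | _ with trans q c
...   | ()
card-2 X c | u ∷ v ∷ w ∷ l | q | _ with trans q c
...   | ()

Unique-2 : ∀ {u v : A} → u ≢ v → Unique (u ∷ v ∷ [])
Unique-2 p = (p ∷ []) ∷ [] ∷ []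

Unique-3 : ∀ {u v w : A} → u ≢ v → u ≢ w → v ≢ w → Unique (u ∷ v ∷ w ∷ [])
Unique-3 p q r = (p ∷ q ∷ []) ∷ (r ∷ []) ∷ [] ∷ []

⟦⟧-comm : ∀ (u v : Fin n) → ⟦ u ∷ v ∷ [] ⟧ ≡ ⟦ v ∷ u ∷ [] ⟧
⟦⟧-comm u v = subset-ext (λ i p → ⟦⟧-∋ (f (⟦⟧-∋⁻ p))) (λ i p → ⟦⟧-∋ (f (⟦⟧-∋⁻ p)))
  where
  f : ∀ {i u v : Fin _} → i ∈ u ∷ v ∷ [] → i ∈ v ∷ u ∷ []
  f (here p) = there (here p)
  f (there (here p)) = here p

card-2-at : ∀ (X : Subset n) → ∣ X ∣ ≡ 2 → ∀ {v} → X ∋ v → ∃[ u ] u ≢ v × X ≡ ⟦ v ∷ u ∷ [] ⟧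
card-2-at X c {v} xv with card-2 X c
... | a , b , a≢b , refl with ⟦⟧-∋⁻ {us = a ∷ b ∷ []} xv
... | here refl = b , a≢b ∘ sym , refl
... | there (here refl) = a , a≢b , ⟦⟧-comm a b

-- Involutions of [n] acting on subsets

-- Involutions replace permutations: they make the map X ↦ p(X) ∪ {v} between down sets and up sets
-- self-inverse, and transpositions already generate all permutations.
record Involution (n : ℕ) : Set where
  field
    fun : Fin n → Fin n
    inv : ∀ i → fun (fun i) ≡ i

act : Involution n → Subset n → Subset n
act p X = tabulate λ i → lookup X (Involution.fun p i)

act-∋ : ∀ (p : Involution n) X i → lookup (act p X) i ≡ lookup X (Involution.fun p i)
act-∋ p X i = Vec.lookup∘tabulate _ i

act-act : ∀ (p : Involution n) X → act p (act p X) ≡ X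
act-act p X = ≗⇒≡ λ i → trans (act-∋ p (act p X) i) (trans (act-∋ p X (Involution.fun p i)) (cong (lookup X) (Involution.inv p i)))

∑-involution : ∀ (p : Involution n) f → ∑ (allFin n) (f ∘ Involution.fun p) ≡ ∑ (allFin n) f
∑-involution p f = ∑-bij (Involution.fun p) (allFin-Unique _) (λ _ → ∈-Fin _) (Involution.inv p) f

card-act : ∀ (p : Involution n) X → ∣ act p X ∣ ≡ ∣ X ∣
card-act p X rewrite card-∑ (act p X) | card-∑ X =
  trans (∑-cong (allFin _) λ i _ → cong 𝟙 (act-∋ p X i)) (∑-involution p (𝟙 ∘ lookup X))

meets-act⁺ : ∀ (p : Involution n) X Y → meets X Y ≡ true → meets (act p X) (act p Y) ≡ true
meets-act⁺ p X Y m = let i , a , b = meets⁻ X Y m in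
  meets⁺ (act p X) (act p Y) {Involution.fun p i} (trans (act-∋ p X _) (trans (cong (lookup X) (Involution.inv p i)) a))
    (trans (act-∋ p Y _) (trans (cong (lookup Y) (Involution.inv p i)) b))

meets-act : ∀ (p : Involution n) X Y → meets (act p X) (act p Y) ≡ meets X Y
meets-act p X Y = bool-ext
  (λ m → subst₂ (λ x y → meets x y ≡ true) (act-act p X) (act-act p Y) (meets-act⁺ p (act p X) (act p Y) m))
  (meets-act⁺ p X Y)

swapF : Fin n → Fin n → Fin n → Fin n
swapF u w i with i ≟F u | i ≟F w
... | yes _ | _ = w
... | no _ | yes _ = u
... | no _ | no _ = i

swapF-left : ∀ (u w : Fin n) → swapF u w u ≡ w
swapF-left u w with u ≟F u
... | yes _ = refl
... | no p = ⊥-elim (p refl)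

swapF-right : ∀ (u w : Fin n) → swapF u w w ≡ u
swapF-right u w with w ≟F u | w ≟F w
... | yes p | _ = p
... | no _ | yes _ = refl
... | no _ | no p = ⊥-elim (p refl)

swapF-other : ∀ (u w i : Fin n) → i ≢ u → i ≢ w → swapF u w i ≡ i
swapF-other u w i p q with i ≟F u | i ≟F w
... | yes e | _ = ⊥-elim (p e)
... | no _ | yes e = ⊥-elim (q e)
... | no _ | no _ = refl

swapF-inv : ∀ (u w i : Fin n) → swapF u w (swapF u w i) ≡ i
swapF-inv u w i with i ≟F u | i ≟F w
... | yes refl | _ = swapF-right i w
... | no _ | yes refl = swapF-left u i
... | no p | no q = swapF-other u w i p q

transposition : Fin n → Fin n → Involution n
transposition u w = record { fun = swapF u w ; inv = swapF-inv u w }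

-- Compression

imp⁺ : ∀ {a b} → (a ≡ true → b ≡ true) → not a ∨ b ≡ true
imp⁺ {true} p = p refl
imp⁺ {false} p = refl

imp⁻ : ∀ {a b} → not a ∨ b ≡ true → a ≡ true → b ≡ true
imp⁻ p refl = p

allS : Family n → Bool
allS p = all p (allSubsets _)

allS⁺ : ∀ {p : Family n} → (∀ X → p X ≡ true) → allS p ≡ true
allS⁺ h = all-true _ (allSubsets _) λ X _ → h X

allS⁻ : ∀ {p : Family n} → allS p ≡ true → ∀ X → p X ≡ true
allS⁻ h X = all-true⁻ _ (allSubsets _) h (allSubsets-complete X)

filterᵇ-filterᵇ : ∀ (p q : A → Bool) xs → (∀ x → p x ≡ true → q x ≡ true) → filterᵇ p (filterᵇ q xs) ≡ filterᵇ p xs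
filterᵇ-filterᵇ p q [] h = refl
filterᵇ-filterᵇ p q (x ∷ xs) h with q x in eq
... | true rewrite filterᵇ-∷ p x (filterᵇ q xs) | filterᵇ-∷ p x xs | filterᵇ-filterᵇ p q xs h = refl
... | false rewrite filterᵇ-∷ p x xs | not-true (λ r → true≢false (h x r) eq) = filterᵇ-filterᵇ p q xs h

members-∈-sublists : ∀ (P F : Family n) → (∀ X → P X ≡ true → F X ≡ true) → members P ∈ sublists (members F)
members-∈-sublists P F h = subst (_∈ sublists (members F)) (filterᵇ-filterᵇ P F (allSubsets _) h)
  (filterᵇ-∈-sublists P (members F))

sublist-⊆ : ∀ {F : Family n} {L} → L ∈ sublists (members F) → ∀ {X} → X ∈ L → F X ≡ true
sublist-⊆ {F = F} r X∈ = ∈-members⁻ F (sub-∈ r X∈)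

members-mem : ∀ {F : Family n} {L} → L ∈ sublists (members F) → members (mem L) ≡ L
members-mem {F = F} {L} r = trans
  (sym (filterᵇ-filterᵇ (mem L) F (allSubsets _) λ X p → sublist-⊆ {F = F} r (mem⁻ p)))
  (filterᵇ-mem (members-Unique F) r)

mem-members : ∀ (P : Family n) X → mem (members P) X ≡ P X
mem-members P X = bool-ext (λ p → ∈-members⁻ P (mem⁻ p)) (λ p → mem⁺ (∈-members P p))

members-cong : ∀ {P Q : Family n} → (∀ X → P X ≡ Q X) → members P ≡ members Q
members-cong h = filterᵇ-cong (allSubsets _) λ X _ → h X

-- A pairing of each down set X with the up set h X. That compression loses no intersecting
-- subfamilies only depends on `up-meets` and `cross`.
record Pairing (n : ℕ) : Set where
  field
    h : Subset n → Subset n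
    up : Subset n → Bool
    h-inv : ∀ X → h (h X) ≡ X
    up-h : ∀ X → up (h X) ≡ not (up X)
    up-meets : ∀ X Y → up X ≡ true → up Y ≡ true → meets X Y ≡ true
    cross : ∀ X Y → up X ≡ false → up Y ≡ false → meets X (h Y) ≡ meets Y (h X)
    card-h : ∀ X → up X ≡ false → ∣ h X ∣ ≡ suc ∣ X ∣

-- Termination measure of the compression: a partner `h X` has one more element than the down set
-- `X`, and the weight is bounded by the total size of all subsets.
weight : Family n → ℕ
weight F = ∑ (allSubsets _) λ X → 𝟙 (F X) * ∣ X ∣

module Compress {n : ℕ} (π : Pairing n) (A : Family n) where
  open Pairing π

  ∑-pairs : ∀ φ → ∑ (allSubsets n) (λ X → φ X + φ (h X)) ≡ 2 * ∑ (allSubsets n) φ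
  ∑-pairs φ = trans (∑-+ (allSubsets n) φ (φ ∘ h)) (cong (∑ (allSubsets n) φ +_)
    (trans (∑-bij h (allSubsets-Unique n) (λ _ → allSubsets-complete _) h-inv φ) (sym (+-identityʳ _))))

  -- `X` and `h X` form the same pair, so a relation between pair sums only has to be checked at
  -- down sets. It is used for both equality and ≤.
  down-suffices : (_~_ : ℕ → ℕ → Set) (φ ψ : Subset n → ℕ) →
    (∀ X → up X ≡ false → (φ X + φ (h X)) ~ (ψ X + ψ (h X))) → ∀ X → (φ X + φ (h X)) ~ (ψ X + ψ (h X))
  down-suffices _~_ φ ψ H X with up X in eq
  ... | false = H X eq
  ... | true = subst₂ _~_ (flip φ) (flip ψ) (H (h X) (trans (up-h X) (cong not eq)))
    where
    flip : ∀ (φ : Subset n → ℕ) → φ (h X) + φ (h (h X)) ≡ φ X + φ (h X)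
    flip φ rewrite h-inv X = +-comm (φ (h X)) (φ X)

  ∑-pairs-≡ : ∀ φ ψ → (∀ X → up X ≡ false → φ X + φ (h X) ≡ ψ X + ψ (h X)) →
    ∑ (allSubsets n) φ ≡ ∑ (allSubsets n) ψ
  ∑-pairs-≡ φ ψ H = *-cancelˡ-≡ _ _ 2 (trans (sym (∑-pairs φ))
    (trans (∑-cong (allSubsets n) λ X _ → down-suffices _≡_ φ ψ H X) (∑-pairs ψ)))

  ∑-pairs-< : ∀ φ ψ → (∀ X → up X ≡ false → φ X + φ (h X) ≤ ψ X + ψ (h X)) →
    ∀ X → φ X + φ (h X) < ψ X + ψ (h X) → ∑ (allSubsets n) φ < ∑ (allSubsets n) ψ
  ∑-pairs-< φ ψ H X lt = *-cancelˡ-< 2 _ _ (subst₂ _<_ (∑-pairs φ) (∑-pairs ψ)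
    (∑-mono-< (allSubsets n) (λ X _ → down-suffices _≤_ φ ψ H X) (allSubsets-complete X) lt))

  compress : Family n
  compress X = if up X then A X ∨ A (h X) else A X ∧ A (h X)

  compress-down : ∀ X → up X ≡ false → compress X ≡ A X ∧ A (h X)
  compress-down X u rewrite u = refl

  compress-h : ∀ X → up X ≡ false → compress (h X) ≡ A (h X) ∨ A X
  compress-h X u rewrite up-h X | u | h-inv X = refl

  compress-size : size compress ≡ size A
  compress-size = trans (size-∑ compress) (trans (∑-pairs-≡ _ _ lemma) (sym (size-∑ A)))
    where
    lemma : ∀ X → up X ≡ false → 𝟙 (compress X) + 𝟙 (compress (h X)) ≡ 𝟙 (A X) + 𝟙 (A (h X))
    lemma X u rewrite compress-down X u | compress-h X u with A X | A (h X)
    ... | true | true = refl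
    ... | true | false = refl
    ... | false | true = refl
    ... | false | false = refl

  compress-weight : ∀ X → up X ≡ false → A X ≡ true → A (h X) ≡ false → weight A < weight compress
  compress-weight X u a b = ∑-pairs-< _ _ le X strict
    where
    le : ∀ X → up X ≡ false → 𝟙 (A X) * ∣ X ∣ + 𝟙 (A (h X)) * ∣ h X ∣ ≤
      𝟙 (compress X) * ∣ X ∣ + 𝟙 (compress (h X)) * ∣ h X ∣
    le X u rewrite compress-down X u | compress-h X u | card-h X u with A X | A (h X)
    ... | true | true = ≤-refl
    ... | true | false rewrite +-identityʳ ∣ X ∣ | +-identityʳ ∣ X ∣ = n≤1+n _
    ... | false | true = ≤-refl
    ... | false | false = ≤-refl
    strict : 𝟙 (A X) * ∣ X ∣ + 𝟙 (A (h X)) * ∣ h X ∣ <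
      𝟙 (compress X) * ∣ X ∣ + 𝟙 (compress (h X)) * ∣ h X ∣
    strict rewrite compress-down X u | compress-h X u | card-h X u | a | b
      | +-identityʳ ∣ X ∣ | +-identityʳ ∣ X ∣ = ≤-refl

  -- The pattern of a subfamily P records the pairs of which P contains exactly one set.
  -- A set of the pattern whose partner is not in A has to be moved up, and then so has
  -- everything linked to it; the sets to be moved only depend on the pattern.
  pattern′ : Family n → Family n
  pattern′ P X = (P X ∧ not (P (h X))) ∨ (not (P X) ∧ P (h X))

  Forced : Family n → Family n → Set
  Forced q K = ∀ X → up X ≡ false → q X ≡ true → A (h X) ≡ false → K X ≡ true

  Linked : Family n → Family n → Set
  Linked q K = ∀ X Y → up X ≡ false → up Y ≡ false → q X ≡ true → q Y ≡ true → K X ≡ true →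
    meets X (h Y) ≡ false → K Y ≡ true

  Closed : Family n → Family n → Set
  Closed q K = Forced q K × Linked q K

  forcedᵇ : Family n → Family n → Bool
  forcedᵇ q K = allS λ X → not (not (up X) ∧ q X ∧ not (A (h X))) ∨ K X

  linkedᵇ : Family n → Family n → Bool
  linkedᵇ q K = allS λ X → allS λ Y →
    not (not (up X) ∧ not (up Y) ∧ q X ∧ q Y ∧ K X ∧ not (meets X (h Y))) ∨ K Y

  closed⁺ : ∀ q K → Closed q K → forcedᵇ q K ∧ linkedᵇ q K ≡ true
  closed⁺ q K (f , l) = ∧-intro
    (allS⁺ λ X → imp⁺ λ r → let a , r1 = ∧-true {not (up X)} r ; b , c = ∧-true {q X} r1 in
      f X (not-true⁻ a) b (not-true⁻ c))
    (allS⁺ λ X → allS⁺ λ Y → imp⁺ λ r →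
      let a , r1 = ∧-true {not (up X)} r ; b , r2 = ∧-true {not (up Y)} r1 ; c , r3 = ∧-true {q X} r2
          d , r4 = ∧-true {q Y} r3 ; e , g = ∧-true {K X} r4 in
      l X Y (not-true⁻ a) (not-true⁻ b) c d e (not-true⁻ g))

  closed⁻ : ∀ q K → forcedᵇ q K ∧ linkedᵇ q K ≡ true → Closed q K
  closed⁻ q K r = let a , b = ∧-true {forcedᵇ q K} r in
    (λ X u qx ah → imp⁻ (allS⁻ a X) (∧-intro (cong not u) (∧-intro qx (cong not ah)))) ,
    (λ X Y u v qx qy kx m → imp⁻ (allS⁻ (allS⁻ b X) Y)
      (∧-intro (cong not u) (∧-intro (cong not v) (∧-intro qx (∧-intro qy (∧-intro kx (cong not m)))))))

  abstract
    -- The least closed family, encoded as the intersection of all closed ones. Letting `K` run over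
    -- the finitely many sublists of all subsets makes membership a Boolean without iterating the
    -- links.
    closure : Family n → Family n
    closure q X = all (λ K → not (forcedᵇ q (mem K) ∧ linkedᵇ q (mem K)) ∨ mem K X) (sublists (allSubsets n))

    closure⁺ : ∀ q X → (∀ K → Closed q K → K X ≡ true) → closure q X ≡ true
    closure⁺ q X H = all-true _ (sublists (allSubsets n)) λ K _ → imp⁺ λ r → H (mem K) (closed⁻ q (mem K) r)

    -- The induction principle of the closure: a property holds for all its elements as soon as it
    -- is preserved by forcing and linking.
    closure⁻ : ∀ q X → closure q X ≡ true → ∀ K → Closed q K → K X ≡ true
    closure⁻ q X r K (f , l) = trans (sym (mem-members K X))
      (imp⁻ (all-true⁻ _ (sublists (allSubsets n)) r (filterᵇ-∈-sublists K (allSubsets n))) (closed⁺ q (mem (members K))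
        ((λ Y a b c → trans (mem-members K Y) (f Y a b c)) ,
         (λ Y W a b c d e g → trans (mem-members K W) (l Y W a b c d (trans (sym (mem-members K Y)) e) g)))))

  closure-Closed : ∀ q → Closed q (closure q)
  closure-Closed q =
    (λ X a b c → closure⁺ q X λ K (f , l) → f X a b c) ,
    (λ X Y a b c d e g → closure⁺ q Y λ K cl → proj₂ cl X Y a b c d (closure⁻ q X e K cl) g)

  Closed-cong : ∀ {q q'} K → (∀ X → q X ≡ q' X) → Closed q K → Closed q' K
  Closed-cong K e (f , l) =
    (λ X a b → f X a (trans (e X) b)) , (λ X Y a b c d → l X Y a b (trans (e X) c) (trans (e Y) d))

  closure-cong : ∀ {q q'} → (∀ X → q X ≡ q' X) → ∀ X → closure q X ≡ closure q' X
  closure-cong {q} {q'} e X = bool-ext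
    (λ p → closure⁺ q' X λ K cl → closure⁻ q X p K (Closed-cong K (λ Y → sym (e Y)) cl))
    (λ p → closure⁺ q X λ K cl → closure⁻ q' X p K (Closed-cong K e cl))

  move : Family n → Family n
  move P X = if up X then P X ∨ closure (pattern′ P) (h X) else P X ∧ not (closure (pattern′ P) X)

  -- Inverse of `move`. The pattern survives the move and determines the closure, so pattern and
  -- image together tell which sets have to go back down.
  unmove : Family n → Family n → Family n
  unmove q Q X = if up X then Q X ∧ not (closure q (h X)) else Q X ∨ closure q X

  pattern-P : ∀ P X → pattern′ P X ≡ true → P (h X) ≡ false → P X ≡ true
  pattern-P P X r s rewrite s with P X | r
  ... | true | _ = refl
  ... | false | ()

  pattern-P′ : ∀ P X → pattern′ P X ≡ true → P X ≡ true → P (h X) ≡ false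
  pattern-P′ P X r s rewrite s with P (h X) | r
  ... | false | _ = refl

  module Move (P : Family n) (P⊆A : ∀ X → P X ≡ true → A X ≡ true)
              (int : ∀ X Y → P X ≡ true → P Y ≡ true → meets X Y ≡ true) where
    Z = closure (pattern′ P)

    -- Induction over the closure. A forced `X` lies in `P` because its partner is not even in `A`.
    -- A linked `Y` lies in `P` because its partner is disjoint from a member of `P`, so of the pair
    -- of `Y` it can only be `Y` itself that `P` contains.
    Z⊆P : ∀ X → Z X ≡ true → up X ≡ false × P X ≡ true × pattern′ P X ≡ true
    Z⊆P X z =
      let r = closure⁻ (pattern′ P) X z (λ X → not (up X) ∧ P X ∧ pattern′ P X)
            ((λ X u q a → ∧-intro (cong not u) (∧-intro
                (pattern-P P X q (not-true λ p → true≢false (P⊆A _ p) a)) q)) ,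
             (λ X Y u v qx qy k m → ∧-intro (cong not v) (∧-intro (pattern-P P Y qy (not-true λ p →
                true≢false (int X (h Y) (proj₁ (∧-true {P X} (proj₂ (∧-true {not (up X)} k)))) p) m)) qy)))
          a , r1 = ∧-true {not (up X)} r
          b , c = ∧-true {P X} r1
      in not-true⁻ a , b , c

    Z-h : ∀ X → Z X ≡ true → P (h X) ≡ false
    Z-h X z = let _ , p , q = Z⊆P X z in pattern-P′ P X q p

    move-up : ∀ X → up X ≡ true → move P X ≡ P X ∨ Z (h X)
    move-up X u rewrite u = refl

    move-down : ∀ X → up X ≡ false → move P X ≡ P X ∧ not (Z X)
    move-down X u rewrite u = refl

    move-h : ∀ X → up X ≡ false → move P (h X) ≡ P (h X) ∨ Z X
    move-h X u rewrite up-h X | u | h-inv X = refl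

    -- A down set of `P` that stays has its partner in `A`, for otherwise it would be forced up: its
    -- partner would not be in `P`, so it would belong to the pattern.
    move⊆compress : ∀ X → move P X ≡ true → compress X ≡ true
    move⊆compress X m with up X in eq
    ... | true with ∨-true {P X} m
    ...   | inj₁ p rewrite P⊆A X p = refl
    ...   | inj₂ z rewrite P⊆A (h X) (proj₁ (proj₂ (Z⊆P (h X) z))) with A X
    ...     | true = refl
    ...     | false = refl
    move⊆compress X m | false with ∧-true {P X} m
    ... | p , nz with A (h X) in ah
    ...   | true = ∧-intro (P⊆A X p) refl
    ...   | false = ⊥-elim (true≢false (proj₁ (closure-Closed (pattern′ P)) X eq pat ah) (not-true⁻ nz))
      where
      pat : pattern′ P X ≡ true
      pat rewrite p | not-true {P (h X)} (λ r → true≢false (P⊆A _ r) ah) = refl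

    -- The critical case is `Y` moved up from `h Y` and disjoint from the unmoved `X`. By `cross`,
    -- `h Y` is then disjoint from `h X`. If `h X` is in `P`, two members of `P` are disjoint; if
    -- not, `X` is in the pattern and linked to `h Y`, so it would have moved too.
    move-mixed : ∀ X Y → up X ≡ false → P X ≡ true → Z X ≡ false → up Y ≡ true → move P Y ≡ true → meets X Y ≡ true
    move-mixed X Y u p nz v m with ∨-true {P Y} (trans (sym (move-up Y v)) m)
    ... | inj₁ py = int X Y p py
    ... | inj₂ z with meets X Y in eq
    ...   | true = refl
    ...   | false with P (h X) in phx
    ...     | true = ⊥-elim (true≢false (int (h Y) (h X) (proj₁ (proj₂ (Z⊆P _ z))) phx)
                (trans (cross (h Y) X (proj₁ (Z⊆P _ z)) u) (trans (cong (meets X) (h-inv Y)) eq)))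
    ...     | false = ⊥-elim (true≢false (proj₂ (closure-Closed (pattern′ P)) (h Y) X (proj₁ (Z⊆P _ z)) u
                (proj₂ (proj₂ (Z⊆P _ z))) pat z
                (trans (cross (h Y) X (proj₁ (Z⊆P _ z)) u) (trans (cong (meets X) (h-inv Y)) eq))) nz)
      where
      pat : pattern′ P X ≡ true
      pat rewrite p | phx = refl

    move-int : ∀ X Y → move P X ≡ true → move P Y ≡ true → meets X Y ≡ true
    move-int X Y mx my with up X in ux | up Y in uy
    ... | true | true = up-meets X Y ux uy
    ... | false | false = int X Y (proj₁ (∧-true mx)) (proj₁ (∧-true my))
    ... | false | true = move-mixed X Y ux (proj₁ (∧-true mx)) (not-true⁻ (proj₂ (∧-true {P X} mx))) uy
          (trans (move-up Y uy) my)
    ... | true | false = trans (meets-comm X Y) (move-mixed Y X uy (proj₁ (∧-true my))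
          (not-true⁻ (proj₂ (∧-true {P Y} my))) ux (trans (move-up X ux) mx))

    move-size : size (move P) ≡ size P
    move-size = trans (size-∑ (move P)) (trans (∑-pairs-≡ _ _ lemma) (sym (size-∑ P)))
      where
      lemma : ∀ X → up X ≡ false → 𝟙 (move P X) + 𝟙 (move P (h X)) ≡ 𝟙 (P X) + 𝟙 (P (h X))
      lemma X u rewrite move-down X u | move-h X u with Z X in z
      ... | true rewrite proj₁ (proj₂ (Z⊆P X z)) | Z-h X z = refl
      ... | false with P X | P (h X)
      ...   | true | true = refl
      ...   | true | false = refl
      ...   | false | true = refl
      ...   | false | false = refl

    pattern-h : ∀ Q X → pattern′ Q (h X) ≡ pattern′ Q X
    pattern-h Q X rewrite h-inv X with Q X | Q (h X)
    ... | true | true = refl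
    ... | true | false = refl
    ... | false | true = refl
    ... | false | false = refl

    move-pattern-down : ∀ X → up X ≡ false → pattern′ (move P) X ≡ pattern′ P X
    move-pattern-down X u = trans (cong₂ (λ a b → (a ∧ not b) ∨ (not a ∧ b)) (move-down X u) (move-h X u)) lemma
      where
      lemma : (((P X ∧ not (Z X)) ∧ not (P (h X) ∨ Z X)) ∨ (not (P X ∧ not (Z X)) ∧ (P (h X) ∨ Z X))) ≡ pattern′ P X
      lemma with Z X in z
      ... | true rewrite proj₁ (proj₂ (Z⊆P X z)) | Z-h X z = refl
      ... | false with P X | P (h X)
      ...   | true | true = refl
      ...   | true | false = refl
      ...   | false | true = refl
      ...   | false | false = refl

    move-pattern : ∀ X → pattern′ (move P) X ≡ pattern′ P X
    move-pattern X = go (up X) refl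
      where
      go : ∀ b → up X ≡ b → pattern′ (move P) X ≡ pattern′ P X
      go false eq = move-pattern-down X eq
      go true eq = trans (sym (pattern-h (move P) X))
        (trans (move-pattern-down (h X) (trans (up-h X) (cong not eq))) (pattern-h P X))

    unmove-move : ∀ X → unmove (pattern′ P) (move P) X ≡ P X
    unmove-move X with up X in eq
    ... | true with Z (h X) in z
    ...   | true = trans (∧-zeroʳ′ _) (sym (trans (cong P (sym (h-inv X))) (Z-h (h X) z)))
      where
      ∧-zeroʳ′ : ∀ b → b ∧ false ≡ false
      ∧-zeroʳ′ true = refl
      ∧-zeroʳ′ false = refl
    ...   | false with P X
    ...     | true = refl
    ...     | false = refl
    unmove-move X | false with Z X in z
    ... | true rewrite proj₁ (proj₂ (Z⊆P X z)) = refl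
    ... | false with P X
    ...   | true = refl
    ...   | false = refl

  Good : ℕ → Family n → List (List (Subset n))
  Good s F = filterᵇ (good s) (sublists (members F))

  moveL : List (Subset n) → List (Subset n)
  moveL L = members (move (mem L))

  module _ (s : ℕ) where
    module InGood {L} (r : L ∈ Good s A) where
      L∈ = proj₁ (∈-filterᵇ⁻ (good s) (sublists (members A)) r)
      gd = good⁻ (proj₂ (∈-filterᵇ⁻ (good s) (sublists (members A)) r))
      open Move (mem L) (λ X p → sublist-⊆ {F = A} L∈ (mem⁻ p))
        (λ X Y a b → inter⁻ (proj₂ gd) (mem⁻ a) (mem⁻ b)) public

      moveL-good : moveL L ∈ Good s compress
      moveL-good = ∈-filterᵇ⁺ (good s) (members-∈-sublists (move (mem L)) compress move⊆compress)
        (good⁺ (trans move-size (trans (cong length (members-mem {F = A} L∈)) (proj₁ gd)))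
          (inter⁺ λ X Y a b → move-int X Y (∈-members⁻ (move (mem L)) a) (∈-members⁻ (move (mem L)) b)))

      moveL-∈ : ∀ {X} → X ∈ moveL L → move (mem L) X ≡ true
      moveL-∈ = ∈-members⁻ (move (mem L))

    moveL-inj : ∀ {L M} → L ∈ Good s A → M ∈ Good s A → moveL L ≡ moveL M → L ≡ M
    moveL-inj {L} {M} l m e = trans (sym (members-mem {F = A} (InGood.L∈ l)))
      (trans (members-cong same) (members-mem {F = A} (InGood.L∈ m)))
      where
      moved : ∀ X → move (mem L) X ≡ move (mem M) X
      moved X = trans (sym (mem-members (move (mem L)) X)) (trans (cong (λ K → mem K X) e) (mem-members (move (mem M)) X))
      pat : ∀ X → pattern′ (mem L) X ≡ pattern′ (mem M) X
      pat X = trans (sym (InGood.move-pattern l X)) (trans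
        (cong₂ (λ a b → (a ∧ not b) ∨ (not a ∧ b)) (moved X) (moved (h X))) (InGood.move-pattern m X))
      same : ∀ X → mem L X ≡ mem M X
      same X = trans (sym (InGood.unmove-move l X)) (trans step (InGood.unmove-move m X))
        where
        step : unmove (pattern′ (mem L)) (move (mem L)) X ≡ unmove (pattern′ (mem M)) (move (mem M)) X
        step rewrite moved X | closure-cong pat X | closure-cong pat (h X) = refl

    compress-≤ : numIntersecting s A ≤ numIntersecting s compress
    compress-≤ rewrite good-filter s A | good-filter s compress =
      inj-length moveL (filterᵇ-unique (good s) (sublists-Unique (members-Unique A))) (λ r → InGood.moveL-good r) moveL-inj

    -- Since `h X` is not in `A`, a preimage of `L` would contain `X`. It would also contain `Y` or
    -- `h Y`, and `X` is disjoint from both. So `L` is missed by the injection.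
    compress-< : ∀ X Y → up X ≡ false → A X ≡ true → A (h X) ≡ false →
      meets X Y ≡ false → meets X (h Y) ≡ false → up Y ≡ true →
      ∀ L → L ∈ Good s compress → h X ∈ L → Y ∈ L → numIntersecting s A < numIntersecting s compress
    compress-< X Y u a b m m' v L L∈ hX∈ Y∈ rewrite good-filter s A | good-filter s compress =
      inj-length-< moveL (filterᵇ-unique (good s) (sublists-Unique (members-Unique A))) (λ r → InGood.moveL-good r) moveL-inj L∈
        λ {K} r e → let open InGood r in notImage r (moveL-∈ (subst (h X ∈_) (sym e) hX∈)) (moveL-∈ (subst (Y ∈_) (sym e) Y∈))
      where
      notImage : ∀ {K} → K ∈ Good s A → move (mem K) (h X) ≡ true → move (mem K) Y ≡ true → ⊥
      notImage {K} r p q with ∨-true {mem K (h X)} (trans (sym (InGood.move-h r X u)) p)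
      ... | inj₁ ph = true≢false (sublist-⊆ {F = A} (InGood.L∈ r) (mem⁻ ph)) b
      ... | inj₂ z with ∨-true {mem K Y} (trans (sym (InGood.move-up r Y v)) q)
      ...   | inj₁ py = true≢false (inter⁻ (proj₂ (InGood.gd r)) (mem⁻ (proj₁ (proj₂ (InGood.Z⊆P r X z)))) (mem⁻ py)) m
      ...   | inj₂ zy = true≢false (inter⁻ (proj₂ (InGood.gd r)) (mem⁻ (proj₁ (proj₂ (InGood.Z⊆P r X z))))
                (mem⁻ (proj₁ (proj₂ (InGood.Z⊆P r (h Y) zy))))) m'

-- From arbitrary families to layered ones

∑-== : ∀ (v : Fin n) → ∑ (allFin n) (λ i → 𝟙 (does (i ≟F v))) ≡ 1
∑-== {n} v = ∑-𝟙≡1 (allFin-Unique n) (λ i → does (i ≟F v))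
  (λ {x} {y} _ _ p q → trans (f p) (sym (f q))) (∈-Fin v) (dec-true (v ≟F v) refl)
  where
  f : ∀ {i} → does (i ≟F v) ≡ true → i ≡ v
  f {i} p with i ≟F v
  ... | yes q = q

infixl 6 _⊖_
_⊖_ : Subset n → Fin n → Subset n
Y ⊖ v = tabulate λ i → lookup Y i ∧ not (does (i ≟F v))

⊖-self : ∀ (Y : Subset n) v → lookup (Y ⊖ v) v ≡ false
⊖-self Y v rewrite Vec.lookup∘tabulate (λ i → lookup Y i ∧ not (does (i ≟F v))) v
  | dec-true (v ≟F v) refl with lookup Y v
... | true = refl
... | false = refl

⊖-other : ∀ (Y : Subset n) {v i} → i ≢ v → lookup (Y ⊖ v) i ≡ lookup Y i
⊖-other Y {v} {i} p rewrite Vec.lookup∘tabulate (λ i → lookup Y i ∧ not (does (i ≟F v))) i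
  | dec-false (i ≟F v) p with lookup Y i
... | true = refl
... | false = refl

card-⊖ : ∀ (Y : Subset n) v → Y ∋ v → ∣ Y ∣ ≡ suc ∣ Y ⊖ v ∣
card-⊖ {n} Y v yv rewrite card-∑ Y | card-∑ (Y ⊖ v) = trans
  (∑-cong (allFin n) λ i _ → lemma i)
  (trans (∑-+ (allFin n) (λ i → 𝟙 (does (i ≟F v))) (𝟙 ∘ lookup (Y ⊖ v))) (cong (_+ ∑ (allFin n) (𝟙 ∘ lookup (Y ⊖ v))) (∑-== v)))
  where
  lemma : ∀ i → 𝟙 (lookup Y i) ≡ 𝟙 (does (i ≟F v)) + 𝟙 (lookup (Y ⊖ v) i)
  lemma i with i ≟F v
  ... | yes refl rewrite ⊖-self Y i | yv = refl
  ... | no p rewrite ⊖-other Y p = refl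

findFin : ∀ (p : Fin n → Bool) → (∃[ i ] p i ≡ true) ⊎ (∀ i → p i ≡ false)
findFin {zero} p = inj₂ λ ()
findFin {suc n} p with p zero in eq | findFin (p ∘ suc)
... | true | _ = inj₁ (zero , eq)
... | false | inj₁ (i , q) = inj₁ (suc i , q)
... | false | inj₂ q = inj₂ λ { zero → eq ; (suc i) → q i }

∧-not-false : ∀ {a b} → a ∧ not b ≡ false → a ≡ true → b ≡ true
∧-not-false {true} {true} p q = refl

∃-⊄ : ∀ (X Y : Subset n) → ∣ X ∣ < ∣ Y ∣ → ∃[ v ] Y ∋ v × lookup X v ≡ false
∃-⊄ X Y lt with findFin (λ i → lookup Y i ∧ not (lookup X i))
... | inj₁ (v , p) = v , proj₁ (∧-true p) , not-true⁻ (proj₂ (∧-true {lookup Y v} p))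
... | inj₂ q = ⊥-elim (<-irrefl refl (≤-trans lt (card-mono Y X λ i yi → ∧-not-false (q i) yi)))

-- A product of transpositions, each swapping a point of `X` outside `Y` with a point of `Y` outside
-- `X`; `k` bounds the number of them. Fixing all points where the two sets agree keeps the
-- transpositions disjoint, so they commute and the product is again an involution.
exchange : ∀ k (X Y : Subset n) → ∣ X ∣ ≡ ∣ Y ∣ → ∑ (allFin n) (λ i → 𝟙 (lookup X i ∧ not (lookup Y i))) ≤ k →
  Σ (Involution n) λ p → act p X ≡ Y × (∀ i → lookup X i ≡ lookup Y i → Involution.fun p i ≡ i)
exchange {n} k X Y c m with X ≟S Y
... | yes refl = record { fun = id ; inv = λ _ → refl } , Vec.tabulate∘lookup X , λ _ _ → refl
... | no X≢Y with findFin (λ i → lookup X i ∧ not (lookup Y i)) | findFin (λ i → lookup Y i ∧ not (lookup X i))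
... | inj₂ q | _ = ⊥-elim (X≢Y (⊆-card-≡ X Y (λ i → ∧-not-false (q i)) (≤-reflexive (sym c))))
... | inj₁ _ | inj₂ q = ⊥-elim (X≢Y (sym (⊆-card-≡ Y X (λ i → ∧-not-false (q i)) (≤-reflexive c))))
exchange {n} zero X Y c m | no X≢Y | inj₁ (i , p) | inj₁ _ =
  ⊥-elim (<-irrefl refl (≤-trans (≤-trans (≤-reflexive (cong 𝟙 (sym p)))
    (∑-∈ (allFin n) (λ i → 𝟙 (lookup X i ∧ not (lookup Y i))) (∈-Fin i))) m))
exchange {n} (suc k) X Y c m | no X≢Y | inj₁ (i , p) | inj₁ (j , q) = record { fun = fn ; inv = fn-inv } , act-fn , fixes
  where
  τ = transposition i j
  Y₁ = act τ Y
  xi = proj₁ (∧-true {lookup X i} p)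
  yi = not-true⁻ (proj₂ (∧-true {lookup X i} p))
  yj = proj₁ (∧-true {lookup Y j} q)
  xj = not-true⁻ (proj₂ (∧-true {lookup Y j} q))
  y₁i : lookup Y₁ i ≡ true
  y₁i rewrite act-∋ τ Y i | swapF-left i j = yj
  y₁j : lookup Y₁ j ≡ false
  y₁j rewrite act-∋ τ Y j | swapF-right i j = yi
  y₁ : ∀ {a} → a ≢ i → a ≢ j → lookup Y₁ a ≡ lookup Y a
  y₁ {a} r s rewrite act-∋ τ Y a | swapF-other i j a r s = refl
  smaller : ∑ (allFin n) (λ a → 𝟙 (lookup X a ∧ not (lookup Y₁ a))) < ∑ (allFin n) (λ a → 𝟙 (lookup X a ∧ not (lookup Y a)))
  smaller = ∑-mono-< (allFin n) le (∈-Fin i) lt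
    where
    le : ∀ a → a ∈ allFin n → 𝟙 (lookup X a ∧ not (lookup Y₁ a)) ≤ 𝟙 (lookup X a ∧ not (lookup Y a))
    le a _ with a ≟F i | a ≟F j
    ... | yes refl | _ rewrite y₁i | xi = z≤n
    ... | no _ | yes refl rewrite xj = z≤n
    ... | no r | no s rewrite y₁ r s = ≤-refl
    lt : 𝟙 (lookup X i ∧ not (lookup Y₁ i)) < 𝟙 (lookup X i ∧ not (lookup Y i))
    lt rewrite y₁i | xi | yi = ≤-refl
  rec = exchange k X Y₁ (trans c (sym (card-act τ Y))) (≤-pred (≤-trans smaller m))
  p₁ = proj₁ rec
  open Involution p₁ renaming (fun to g; inv to g-inv)
  gi : g i ≡ i
  gi = proj₂ (proj₂ rec) i (trans xi (sym y₁i))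
  gj : g j ≡ j
  gj = proj₂ (proj₂ rec) j (trans xj (sym y₁j))
  fn : Fin n → Fin n
  fn a = g (swapF i j a)
  comm : ∀ a → fn a ≡ swapF i j (g a)
  comm a with a ≟F i | a ≟F j
  ... | yes refl | _ rewrite gi | swapF-left i j = gj
  ... | no _ | yes refl rewrite gj | swapF-right i j = gi
  ... | no r | no s = sym (swapF-other i j (g a)
        (λ e → r (trans (sym (g-inv a)) (trans (cong g e) gi)))
        (λ e → s (trans (sym (g-inv a)) (trans (cong g e) gj))))
  fn-inv : ∀ a → fn (fn a) ≡ a
  fn-inv a = trans (cong fn (comm a)) (trans (cong g (swapF-inv i j (g a))) (g-inv a))
  act-fn : act (record { fun = fn ; inv = fn-inv }) X ≡ Y
  act-fn = ≗⇒≡ λ a → trans (act-∋ (record { fun = fn ; inv = fn-inv }) X a)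
    (trans (sym (act-∋ p₁ X (swapF i j a)))
    (trans (cong (λ Z → lookup Z (swapF i j a)) (proj₁ (proj₂ rec)))
    (trans (act-∋ τ Y (swapF i j a)) (cong (lookup Y) (swapF-inv i j a)))))
  fixes : ∀ a → lookup X a ≡ lookup Y a → fn a ≡ a
  fixes a e with a ≟F i | a ≟F j
  ... | yes refl | _ = ⊥-elim (true≢false xi (trans e yi))
  ... | no _ | yes refl = ⊥-elim (true≢false yj (trans (sym e) xj))
  ... | no r | no s = proj₂ (proj₂ rec) a (trans e (sym (y₁ r s)))

-- Pairings that apply an involution and toggle a point

module _ (p : Involution n) (v : Fin n) (pv : Involution.fun p v ≡ v) where
  open Involution p

  shift-h : Subset n → Subset n
  shift-h X = tabulate λ i → if does (i ≟F v) then not (lookup X v) else lookup X (fun i)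

  shift-h-v : ∀ X → lookup (shift-h X) v ≡ not (lookup X v)
  shift-h-v X rewrite Vec.lookup∘tabulate (λ i → if does (i ≟F v) then not (lookup X v) else lookup X (fun i)) v
    | dec-true (v ≟F v) refl = refl

  shift-h-other : ∀ X {i} → i ≢ v → lookup (shift-h X) i ≡ lookup X (fun i)
  shift-h-other X {i} q
    rewrite Vec.lookup∘tabulate (λ i → if does (i ≟F v) then not (lookup X v) else lookup X (fun i)) i
    | dec-false (i ≟F v) q = refl

  fun-≢ : ∀ {i} → i ≢ v → fun i ≢ v
  fun-≢ {i} q e = q (trans (sym (inv i)) (trans (cong fun e) pv))

  shift-pairing : Pairing n
  shift-pairing = record
    { h = shift-h
    ; up = λ X → lookup X v
    ; h-inv = λ X → ≗⇒≡ λ i → h-inv X i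
    ; up-h = shift-h-v
    ; up-meets = λ X Y a b → meets⁺ X Y a b
    ; cross = λ X Y a b → bool-ext (cross X Y a b) (cross Y X b a)
    ; card-h = card-h
    }
    where
    h-inv : ∀ X i → lookup (shift-h (shift-h X)) i ≡ lookup X i
    h-inv X i with i ≟F v
    ... | yes refl = trans (shift-h-v (shift-h X)) (trans (cong not (shift-h-v X)) (not-involutive _))
    ... | no q = trans (shift-h-other (shift-h X) q)
          (trans (shift-h-other X (fun-≢ q)) (cong (lookup X) (inv i)))
    -- The common point cannot be v, which `X` avoids; applying the involution to it gives a common
    -- point of `Y` and `shift-h X`.
    cross : ∀ X Y → lookup X v ≡ false → lookup Y v ≡ false → meets X (shift-h Y) ≡ true → meets Y (shift-h X) ≡ true
    cross X Y a b m with meets⁻ X (shift-h Y) m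
    ... | i , xi , yi with i ≟F v
    ...   | yes refl = ⊥-elim (true≢false xi a)
    ...   | no q = meets⁺ Y (shift-h X) {fun i} (trans (sym (shift-h-other Y q)) yi)
              (trans (shift-h-other X (fun-≢ q)) (trans (cong (lookup X) (inv i)) xi))
    card-h : ∀ X → lookup X v ≡ false → ∣ shift-h X ∣ ≡ suc ∣ X ∣
    card-h X a rewrite card-∑ (shift-h X) | card-∑ X = trans (∑-cong (allFin n) λ i _ → lemma i)
      (trans (∑-+ (allFin n) (λ i → 𝟙 (does (i ≟F v))) (λ i → 𝟙 (lookup X (fun i))))
        (cong₂ _+_ (∑-== v) (∑-involution p (𝟙 ∘ lookup X))))
      where
      lemma : ∀ i → 𝟙 (lookup (shift-h X) i) ≡ 𝟙 (does (i ≟F v)) + 𝟙 (lookup X (fun i))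
      lemma i with i ≟F v
      ... | yes refl rewrite shift-h-v X | pv | a = refl
      ... | no q rewrite shift-h-other X q = refl

  shift-disjoint : ∀ X Y → lookup X v ≡ false →
    (∀ i → Y ∋ i → i ≡ v ⊎ lookup (shift-h X) i ≡ false) → lookup Y v ≡ true → meets X (shift-h Y) ≡ false
  shift-disjoint X Y a H yv = not-true λ m → bad (meets⁻ X (shift-h Y) m)
    where
    bad : ∃[ i ] X ∋ i × shift-h Y ∋ i → ⊥
    bad (i , xi , yi) with i ≟F v
    ... | yes refl = true≢false xi a
    ... | no q with H (fun i) (trans (sym (shift-h-other Y q)) yi)
    ...   | inj₁ e = fun-≢ q e
    ...   | inj₂ e = true≢false (trans (trans (shift-h-other X (fun-≢ q)) (cong (lookup X) (inv i))) xi) e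

-- Layered families and their large intersecting subfamilies

record Layered (B : Family n) : Set where
  field
    big : ∀ X → 3 ≤ ∣ X ∣ → B X ≡ true
    small : ∀ X → B X ≡ true → 2 ≤ ∣ X ∣

Big : ∀ n → List (Subset n)
Big n = filterᵇ (λ X → 3 ≤ᵇ ∣ X ∣) (allSubsets n)

Pairs : ∀ n → List (Subset n)
Pairs n = filterᵇ (λ X → ∣ X ∣ ≡ᵇ 2) (allSubsets n)

canon-↭ : ∀ {K : List (Subset n)} → Unique K → members (mem K) ↭ K
canon-↭ {K = K} u = Unique-⊆⊇ (members-Unique (mem K)) u
  (λ p → mem⁻ (∈-members⁻ (mem K) p)) (λ p → ∈-members (mem K) (mem⁺ p))

-- Takes one set from each complementary pair: the one containing v if it lies in `B`, and its
-- complement otherwise. For layered `B` the result is an intersecting subfamily of size 2^(n - 1).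
selfDual : Family n → Fin n → Family n
selfDual B v X = if lookup X v then B X else not (B (∁ X))

selfDual-half : ∀ (F : Family n) → (∀ X → F (∁ X) ≡ not (F X)) → 2 * size F ≡ 2 ^ n
selfDual-half {n} F H = begin
  2 * size F ≡⟨ cong (2 *_) (size-∑ F) ⟩
  2 * ∑ (allSubsets n) (𝟙 ∘ F) ≡⟨ cong (∑ (allSubsets n) (𝟙 ∘ F) +_) (trans (+-identityʳ _)
    (sym (∑-bij ∁ (allSubsets-Unique n) (λ _ → allSubsets-complete _) ∁-∁ (𝟙 ∘ F)))) ⟩
  ∑ (allSubsets n) (𝟙 ∘ F) + ∑ (allSubsets n) (λ X → 𝟙 (F (∁ X))) ≡⟨ sym (∑-+ (allSubsets n) _ _) ⟩
  ∑ (allSubsets n) (λ X → 𝟙 (F X) + 𝟙 (F (∁ X))) ≡⟨ ∑-cong (allSubsets n) (λ X _ → one X) ⟩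
  ∑ (allSubsets n) (λ _ → 1) ≡⟨ sym (length-∑ (allSubsets n)) ⟩
  length (allSubsets n) ≡⟨ length-allSubsets n ⟩
  2 ^ n ∎
  where
  open ≡-Reasoning
  one : ∀ X → 𝟙 (F X) + 𝟙 (F (∁ X)) ≡ 1
  one X rewrite H X with F X
  ... | true = refl
  ... | false = refl

module SelfDual {B : Family n} (lay : Layered B) (5≤n : 5 ≤ n) (v : Fin n) where
  open Layered lay

  co-small : ∀ X → B X ≡ false → ∣ X ∣ ≤ 2
  co-small X b with 3 ≤? ∣ X ∣
  ... | yes p = ⊥-elim (true≢false (big X p) b)
  ... | no p = ≤-pred (≰⇒> p)

  selfDual-⊆ : ∀ X → selfDual B v X ≡ true → B X ≡ true
  selfDual-⊆ X p with lookup X v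
  ... | true = p
  ... | false = big X (+-cancelˡ-≤ (∣ ∁ X ∣) 3 (∣ X ∣)
        (≤-trans (+-monoˡ-≤ 3 (co-small (∁ X) (not-true⁻ p))) (subst (5 ≤_) (sym (card-∁ X)) 5≤n)))

  -- Were they disjoint, `X` would lie inside `∁ Y`. The latter is not in `B`, so it has at most two
  -- elements, while `X` in `B` has at least two; they would coincide.
  selfDual-cross : ∀ X Y → B X ≡ true → B (∁ Y) ≡ false → meets X Y ≡ true
  selfDual-cross X Y bx by = subst (λ Z → meets X Z ≡ true) (∁-∁ Y)
    (meets-∁ X (∁ Y) (≤-trans (co-small (∁ Y) by) (small X bx)) λ { refl → true≢false bx by })

  selfDual-int : ∀ X Y → selfDual B v X ≡ true → selfDual B v Y ≡ true → meets X Y ≡ true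
  selfDual-int X Y p q with lookup X v in xv | lookup Y v in yv
  ... | true | true = meets⁺ X Y xv yv
  ... | true | false = selfDual-cross X Y p (not-true⁻ q)
  ... | false | true = trans (meets-comm X Y) (selfDual-cross Y X q (not-true⁻ p))
  ... | false | false = subst₂ (λ Z W → meets Z W ≡ true) (∁-∁ X) (∁-∁ Y)
        (meets-∁∁ (∁ X) (∁ Y) (≤-trans (s≤s (+-mono-≤ (co-small (∁ X) (not-true⁻ p)) (co-small (∁ Y) (not-true⁻ q)))) 5≤n))

  selfDual-size : 2 * size (selfDual B v) ≡ 2 ^ n
  selfDual-size = selfDual-half (selfDual B v) dual
    where
    dual : ∀ X → selfDual B v (∁ X) ≡ not (selfDual B v X)
    dual X rewrite ∁-∋ X v | ∁-∁ X with lookup X v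
    ... | true = refl
    ... | false = sym (not-involutive _)

half-2^ : ∀ n {k} → 1 ≤ n → 2 * k ≡ 2 ^ n → k ≡ 2 ^ (n ∸ 1)
half-2^ (suc n) _ e = *-cancelˡ-≡ _ _ 2 e

take-∈ : ∀ k (xs : List A) {x} → x ∈ List.take k xs → x ∈ xs
take-∈ (suc k) (y ∷ xs) (here p) = here p
take-∈ (suc k) (y ∷ xs) (there p) = there (take-∈ k xs p)

subfamily-containing : ∀ {s} (F S : Family n) → (∀ X → S X ≡ true → F X ≡ true) →
  (∀ X Y → S X ≡ true → S Y ≡ true → meets X Y ≡ true) → 2 ≤ s → s ≤ size S →
  ∀ {X Y} → S X ≡ true → S Y ≡ true → X ≢ Y →
  ∃[ L ] (L ∈ filterᵇ (good s) (sublists (members F)) × X ∈ L × Y ∈ L)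
subfamily-containing {s = suc zero} F S S⊆F int (s≤s ())
subfamily-containing {s = suc (suc s)} F S S⊆F int _ s≤ {X} {Y} sx sy X≢Y
  with ∈-extract (∈-members S sx)
... | r₁ , p₁ with ∈-extract {x = Y} (∈-∷-≢ (∈-resp-↭ p₁ (∈-members S sy)) (X≢Y ∘ sym))
... | r₂ , p₂ = members (mem K) , ∈-filterᵇ⁺ (good (suc (suc s))) (members-∈-sublists (mem K) F λ Z p → S⊆F Z (K⊆S (mem⁻ p)))
      (good⁺ (trans (↭-length (canon-↭ uK)) lenK)
        (inter⁺ λ Z W a b → int Z W (K⊆S (mem⁻ (∈-members⁻ (mem K) a))) (K⊆S (mem⁻ (∈-members⁻ (mem K) b))))) ,
    ∈-members (mem K) (mem⁺ {L = K} (here refl)) , ∈-members (mem K) (mem⁺ {L = K} (there (here refl)))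
  where
  K = X ∷ Y ∷ List.take s r₂
  perm : members S ↭ X ∷ Y ∷ r₂
  perm = ptrans p₁ (prep X p₂)
  sub : ∀ {Z} → Z ∈ K → Z ∈ X ∷ Y ∷ r₂
  sub (here p) = here p
  sub (there (here p)) = there (here p)
  sub (there (there p)) = there (there (take-∈ s r₂ p))
  uK : Unique K
  uK = Uniq.take⁺ (suc (suc s)) (Unique-↭ perm (members-Unique S))
  K⊆S : ∀ {Z} → Z ∈ K → S Z ≡ true
  K⊆S p = ∈-members⁻ S (∈-resp-↭ (↭-sym perm) (sub p))
  lenK : length K ≡ suc (suc s)
  lenK = cong (2 +_) (trans (length-take s r₂) (m≤n⇒m⊓n≡m (≤-pred (≤-pred (subst (suc (suc s) ≤_) (↭-length perm) s≤)))))

findS : ∀ (p : Subset n → Bool) → (∃[ X ] p X ≡ true) ⊎ (∀ X → p X ≡ false)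
findS {zero} p with p [] in eq
... | true = inj₁ ([] , eq)
... | false = inj₂ λ { [] → eq }
findS {suc n} p with findS (λ X → p (true ∷ X)) | findS (λ X → p (false ∷ X))
... | inj₁ (X , q) | _ = inj₁ (true ∷ X , q)
... | inj₂ _ | inj₁ (X , q) = inj₁ (false ∷ X , q)
... | inj₂ q | inj₂ r = inj₂ λ { (true ∷ X) → q X ; (false ∷ X) → r X }

-- No containment between `X` and `Y` is asked for: by `pairing-taking`, any two sets of consecutive
-- sizes are partners under some pairing.
Stable : Family n → Set
Stable A = ∀ X Y → A X ≡ true → ∣ Y ∣ ≡ suc ∣ X ∣ → A Y ≡ true

stable? : (A : Family n) → Stable A ⊎ (∃[ X ] ∃[ Y ] A X ≡ true × A Y ≡ false × ∣ Y ∣ ≡ suc ∣ X ∣)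
stable? {n} A with findS (λ X → not (allS λ Y → not (bad X Y)))
  where
  bad : Subset n → Subset n → Bool
  bad X Y = A X ∧ not (A Y) ∧ (∣ Y ∣ ≡ᵇ suc ∣ X ∣)
... | inj₁ (X , p) with findS (λ Y → A X ∧ not (A Y) ∧ (∣ Y ∣ ≡ᵇ suc ∣ X ∣))
...   | inj₁ (Y , r) = let a , r₁ = ∧-true {A X} r ; b , c = ∧-true {not (A Y)} r₁ in
          inj₂ (X , Y , a , not-true⁻ b , ≡ᵇ-true⁻ c)
...   | inj₂ r = ⊥-elim (true≢false (allS⁺ λ Y → cong not (r Y)) (not-true⁻ p))
stable? A | inj₂ p = inj₁ λ X Y ax c → f X Y ax c (p X)
  where
  f : ∀ X Y → A X ≡ true → ∣ Y ∣ ≡ suc ∣ X ∣ →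
    not (allS λ Y → not (A X ∧ not (A Y) ∧ (∣ Y ∣ ≡ᵇ suc ∣ X ∣))) ≡ false → A Y ≡ true
  f X Y ax c q with A Y in ay
  ... | true = refl
  ... | false = ⊥-elim (true≢false (∧-intro {A X} ax (∧-intro (cong not ay) (≡ᵇ-true c)))
        (not-true⁻ (allS⁻ (not-false q) Y)))
    where
    not-false : ∀ {b} → not b ≡ false → b ≡ true
    not-false {true} _ = refl

stable-upward : ∀ {A : Family n} → Stable A → ∀ k X Y → ∣ Y ∣ ≡ suc (k + ∣ X ∣) → A X ≡ true → A Y ≡ true
stable-upward st zero X Y c ax = st X Y ax c
stable-upward {A = A} st (suc k) X Y c ax with ∃-⊄ ⟦ [] ⟧ Y (subst (_< ∣ Y ∣) (sym (card-⟦⟧ {us = []} [])) (subst (0 <_) (sym c) (s≤s z≤n)))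
... | v , yv , _ = st (Y ⊖ v) Y (stable-upward st k X (Y ⊖ v)
        (suc-injective (trans (sym (card-⊖ Y v yv)) c)) ax) (card-⊖ Y v yv)

-- If a set of size at least 3 is missing, then so are all smaller sets, and `A` is no larger than
-- `Big n`. If a set of size at most 1 is present, then so are all larger sets, and `A` exceeds
-- `Big n` and `Pairs n` together.
stable⇒layered : ∀ {A : Family n} → Stable A → length (Big n) < size A →
  size A ≤ length (Big n) + length (Pairs n) → Layered A
stable⇒layered {n} {A} st lo hi = record { big = big ; small = small }
  where
  up : ∀ X Y → ∣ X ∣ < ∣ Y ∣ → A X ≡ true → A Y ≡ true
  up X Y lt = stable-upward st (∣ Y ∣ ∸ suc ∣ X ∣) X Y
    (sym (trans (sym (+-suc (∣ Y ∣ ∸ suc ∣ X ∣) ∣ X ∣)) (m∸n+n≡m lt)))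
  big : ∀ X → 3 ≤ ∣ X ∣ → A X ≡ true
  big X c with A X in ax
  ... | true = refl
  ... | false = ⊥-elim (<-irrefl refl (≤-trans lo (Unique-length (members-Unique A)
        λ {Y} p → ∈-filterᵇ⁺ (λ X → 3 ≤ᵇ ∣ X ∣) (allSubsets-complete Y) (≤ᵇ-true (f Y (∈-members⁻ A p))))))
    where
    f : ∀ Y → A Y ≡ true → 3 ≤ ∣ Y ∣
    f Y ay with 3 ≤? ∣ Y ∣
    ... | yes q = q
    ... | no q = ⊥-elim (true≢false (up Y X (≤-trans (≰⇒> q) c) ay) ax)
  small : ∀ X → A X ≡ true → 2 ≤ ∣ X ∣
  small X ax with 2 ≤? ∣ X ∣
  ... | yes q = q
  ... | no q = ⊥-elim (<-irrefl refl (≤-trans lt hi))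
    where
    inBig : ∀ {Y} → Y ∈ Big n → 3 ≤ ∣ Y ∣
    inBig p = ≤ᵇ-true⁻ (proj₂ (∈-filterᵇ⁻ (λ X → 3 ≤ᵇ ∣ X ∣) (allSubsets n) p))
    inPairs : ∀ {Y} → Y ∈ Pairs n → ∣ Y ∣ ≡ 2
    inPairs p = ≡ᵇ-true⁻ (proj₂ (∈-filterᵇ⁻ (λ X → ∣ X ∣ ≡ᵇ 2) (allSubsets n) p))
    uniq : Unique (X ∷ Big n ++ Pairs n)
    uniq = Unique-∷ (Uniq.++⁺ (filterᵇ-unique _ (allSubsets-Unique n)) (filterᵇ-unique _ (allSubsets-Unique n))
        λ (a , b) → <-irrefl refl (≤-trans (inBig a) (≤-reflexive (inPairs b))))
      λ p → q (f (∈-++⁻ (Big n) p))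
      where
      f : X ∈ Big n ⊎ X ∈ Pairs n → 2 ≤ ∣ X ∣
      f (inj₁ p) = ≤-trans (s≤s (s≤s z≤n)) (inBig p)
      f (inj₂ p) = ≤-reflexive (sym (inPairs p))
    inA : ∀ {Y} → Y ∈ X ∷ Big n ++ Pairs n → Y ∈ members A
    inA (here refl) = ∈-members A ax
    inA {Y} (there p) with ∈-++⁻ (Big n) p
    ... | inj₁ r = ∈-members A (up X Y (≤-trans (≰⇒> q) (≤-trans (s≤s (s≤s z≤n)) (inBig r))) ax)
    ... | inj₂ r = ∈-members A (up X Y (≤-trans (≰⇒> q) (≤-reflexive (sym (inPairs r)))) ax)
    lt : suc (length (Big n) + length (Pairs n)) ≤ size A
    lt = subst (λ k → suc k ≤ size A) (length-++ (Big n)) (Unique-length uniq inA)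

-- Choose v in `Y` but not in `X` and exchange `X` with `Y ⊖ v`. Both avoid v, so the involution
-- fixes it.
pairing-taking : ∀ (X Y : Subset n) → ∣ Y ∣ ≡ suc ∣ X ∣ →
  Σ (Involution n) λ p → ∃[ v ] Σ (Involution.fun p v ≡ v) λ pv → lookup X v ≡ false × shift-h p v pv X ≡ Y
pairing-taking X Y c with ∃-⊄ X Y (≤-reflexive (sym c))
... | v , yv , xv with exchange _ X (Y ⊖ v) (suc-injective (trans (sym c) (card-⊖ Y v yv))) ≤-refl
... | p , a , fx = p , v , pv , xv , ≗⇒≡ eq
  where
  pv = fx v (trans xv (sym (⊖-self Y v)))
  eq : ∀ i → lookup (shift-h p v pv X) i ≡ lookup Y i
  eq i with i ≟F v
  ... | yes refl = trans (shift-h-v p v pv X) (trans (cong not xv) (sym yv))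
  ... | no q = trans (shift-h-other p v pv X q) (trans (sym (act-∋ p X i))
        (trans (cong (λ Z → lookup Z i) a) (⊖-other Y q)))

weight-≤ : ∀ (F : Family n) → weight F ≤ ∑ (allSubsets n) ∣_∣
weight-≤ {n} F = ∑-mono (allSubsets n) λ X _ → ≤-trans (*-monoˡ-≤ ∣ X ∣ (𝟙≤1 (F X))) (≤-reflexive (+-identityʳ _))

avoid-2 : ∀ (X : Subset n) → suc ∣ X ∣ < n → ∃[ a ] ∃[ b ] a ≢ b × lookup X a ≡ false × lookup X b ≡ false
avoid-2 {n} X lt with elems (∁ X) in eq | length-elems (∁ X) | elems-Unique (∁ X)
... | a ∷ b ∷ l | _ | (p ∷ _) ∷ _ = a , b , p , out (here refl) , out (there (here refl))
  where
  out : ∀ {i} → i ∈ a ∷ b ∷ l → lookup X i ≡ false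
  out {i} r = not-true⁻ (trans (sym (∁-∋ X i)) (∈-elems⁻ (∁ X) (subst (i ∈_) (sym eq) r)))
... | [] | q | _ = ⊥-elim (<-irrefl refl (≤-trans (<⇒≤ lt)
      (≤-reflexive (trans (sym (card-∁ X)) (cong (_+ ∣ X ∣) (sym q))))))
... | a ∷ [] | q | _ = ⊥-elim (<-irrefl refl (≤-trans lt
      (≤-reflexive (trans (sym (card-∁ X)) (cong (_+ ∣ X ∣) (sym q))))))

module Reduction {n s : ℕ} (7≤n : 7 ≤ n) (2≤s : 2 ≤ s) (s≤ : s ≤ 2 ^ (n ∸ 1)) where

  -- If the compressed family is layered, the set X that was moved has at most two elements,
  -- which leaves room for a set Y = {v, a, b} disjoint from X and from the partner of Y. No
  -- intersecting family containing Y and the partner of X comes from one in A.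
  last-step : ∀ (A : Family n) p v pv X → lookup X v ≡ false → A X ≡ true → A (shift-h p v pv X) ≡ false →
    Layered (Compress.compress (shift-pairing p v pv) A) →
    numIntersecting s A < numIntersecting s (Compress.compress (shift-pairing p v pv) A)
  last-step A p v pv X xv ax ahx lay = go (avoid-2 E cE)
    where
    open Compress (shift-pairing p v pv) A
    open Layered lay
    hX = shift-h p v pv X
    xsmall : ∣ X ∣ ≤ 2
    xsmall with 3 ≤? ∣ X ∣
    ... | no q = ≤-pred (≰⇒> q)
    ... | yes q = ⊥-elim (true≢false (big X q) (trans (compress-down X xv) (trans (cong (A X ∧_) ahx) (∧-false (A X)))))
      where
      ∧-false : ∀ b → b ∧ false ≡ false
      ∧-false true = refl
      ∧-false false = refl
    E : Subset n
    E = ⟦ elems X ++ elems hX ⟧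
    -- `X` has at most 2 elements and its partner at most 3, so n ≥ 7 leaves two points outside
    -- both.
    cE : suc ∣ E ∣ < n
    cE = ≤-trans (s≤s (s≤s (≤-trans (card-≤ E {elems X ++ elems hX} ⟦⟧-∋⁻)
      (≤-trans (≤-reflexive (trans (length-++ (elems X)) (cong₂ _+_ (length-elems X)
        (trans (length-elems hX) (Pairing.card-h (shift-pairing p v pv) X xv)))))
      (+-mono-≤ xsmall (s≤s xsmall)))))) 7≤n
    go : ∃[ a ] ∃[ b ] a ≢ b × lookup E a ≡ false × lookup E b ≡ false → numIntersecting s A < numIntersecting s compress
    -- Both sets contain v and lie in the compressed family, hence in its self-dual subfamily at v.
    -- That subfamily is intersecting and has at least s members.
    go (a , b , a≢b , ea , eb) = finish (subfamily-containing compress (selfDual compress v) selfDual-⊆ selfDual-int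
        2≤s (subst (s ≤_) (sym (half-2^ n (≤-trans (s≤s z≤n) 7≤n) selfDual-size)) s≤)
        (trans (sd hX hXv) hXin) (trans (sd Y yv) (big Y (≤-reflexive (sym cY)))) hX≢Y)
      where
      open SelfDual lay (≤-trans (s≤s (s≤s (s≤s (s≤s (s≤s z≤n))))) 7≤n) v
      sd : ∀ Z → lookup Z v ≡ true → selfDual compress v Z ≡ compress Z
      sd Z z rewrite z = refl
      outX : ∀ {i} → lookup E i ≡ false → lookup X i ≡ false
      outX {i} e = not-true λ q → true≢false (⟦⟧-∋ (∈-++⁺ˡ (∈-elems X q))) e
      outhX : ∀ {i} → lookup E i ≡ false → lookup hX i ≡ false
      outhX {i} e = not-true λ q → true≢false (⟦⟧-∋ (∈-++⁺ʳ (elems X) (∈-elems hX q))) e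
      hXv : lookup hX v ≡ true
      hXv = trans (shift-h-v p v pv X) (cong not xv)
      hXin : compress hX ≡ true
      hXin = trans (compress-h X xv) (trans (cong (_∨ A X) ahx) ax)
      v≢ : ∀ {i} → lookup E i ≡ false → v ≢ i
      v≢ e refl = true≢false hXv (outhX e)
      us = v ∷ a ∷ b ∷ []
      Y = ⟦ us ⟧
      yv : lookup Y v ≡ true
      yv = ⟦⟧-∋ {us = us} (here refl)
      cY : ∣ Y ∣ ≡ 3
      cY = card-⟦⟧ {us = us} (Unique-3 (v≢ ea) (v≢ eb) a≢b)
      inY : ∀ i → Y ∋ i → i ≡ v ⊎ lookup E i ≡ false
      inY i q with ⟦⟧-∋⁻ {us = us} q
      ... | here e = inj₁ e
      ... | there (here refl) = inj₂ ea
      ... | there (there (here refl)) = inj₂ eb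
      hX≢Y : hX ≢ Y
      hX≢Y e = true≢false (⟦⟧-∋ {us = us} (there (here refl))) (subst (λ Z → lookup Z a ≡ false) e (outhX ea))
      XY : meets X Y ≡ false
      XY = not-true λ m → bad (meets⁻ X Y m)
        where
        bad : ∃[ i ] X ∋ i × Y ∋ i → ⊥
        bad (i , xi , yi) with inY i yi
        ... | inj₁ refl = true≢false xi xv
        ... | inj₂ e = true≢false xi (outX e)
      XhY : meets X (shift-h p v pv Y) ≡ false
      XhY = shift-disjoint p v pv X Y xv (λ i yi → f (inY i yi)) yv
        where
        f : ∀ {i} → i ≡ v ⊎ lookup E i ≡ false → i ≡ v ⊎ lookup hX i ≡ false
        f (inj₁ q) = inj₁ q
        f (inj₂ q) = inj₂ (outhX q)
      finish : ∃[ L ] (L ∈ filterᵇ (good s) (sublists (members compress)) × hX ∈ L × Y ∈ L) →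
        numIntersecting s A < numIntersecting s compress
      finish (L , L∈ , hX∈ , Y∈) = compress-< s X Y xv ax ahx XY XhY yv L L∈ hX∈ Y∈

  -- `k` bounds the weight still to be gained. In the recursive case strictness comes from
  -- `last-step` if one compression already gives a layered family, and otherwise from the later
  -- compressions.
  reduce : ∀ k (A : Family n) → length (Big n) < size A → size A ≤ length (Big n) + length (Pairs n) →
    ∑ (allSubsets n) ∣_∣ ≤ weight A + k →
    ∃[ B ] Layered B × size B ≡ size A × numIntersecting s A ≤ numIntersecting s B ×
      (Layered A ⊎ numIntersecting s A < numIntersecting s B)
  reduce k A lo hi w with stable? A
  ... | inj₁ st = A , stable⇒layered st lo hi , refl , ≤-refl , inj₁ (stable⇒layered st lo hi)
  ... | inj₂ (X , Y , ax , ay , c) with pairing-taking X Y c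
  ... | p , v , pv , xv , refl = go k w
    where
    open Compress (shift-pairing p v pv) A
    heavier = compress-weight X xv ax ay
    go : ∀ k → ∑ (allSubsets n) ∣_∣ ≤ weight A + k → ∃[ B ] Layered B × size B ≡ size A ×
      numIntersecting s A ≤ numIntersecting s B × (Layered A ⊎ numIntersecting s A < numIntersecting s B)
    go zero w = ⊥-elim (<-irrefl refl (≤-trans heavier (≤-trans (weight-≤ compress) (≤-trans w (≤-reflexive (+-identityʳ _))))))
    go (suc k) w with reduce k compress (subst (length (Big n) <_) (sym compress-size) lo)
      (subst (_≤ length (Big n) + length (Pairs n)) (sym compress-size) hi)
      (≤-trans w (≤-trans (≤-reflexive (+-suc (weight A) k)) (+-monoˡ-≤ k heavier)))
    ... | B , lay , sz , le , inj₂ lt = B , lay , trans sz compress-size , ≤-trans (compress-≤ s) le ,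
          inj₂ (≤-<-trans (compress-≤ s) lt)
    ... | B , lay , sz , le , inj₁ lay′ = B , lay , trans sz compress-size , ≤-trans (compress-≤ s) le ,
          inj₂ (<-≤-trans (last-step A p v pv X xv ax ay lay′) le)

-- Layered families as graphs

Edges : Family n → List (Subset n)
Edges {n} A = filterᵇ A (Pairs n)

∈-Big : ∀ {X : Subset n} → 3 ≤ ∣ X ∣ → X ∈ Big n
∈-Big {X = X} p = ∈-filterᵇ⁺ (λ X → 3 ≤ᵇ ∣ X ∣) (allSubsets-complete X) (≤ᵇ-true p)

∈-Big⁻ : ∀ {X : Subset n} → X ∈ Big n → 3 ≤ ∣ X ∣
∈-Big⁻ {n} p = ≤ᵇ-true⁻ (proj₂ (∈-filterᵇ⁻ (λ X → 3 ≤ᵇ ∣ X ∣) (allSubsets n) p))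

∈-Pairs : ∀ {X : Subset n} → ∣ X ∣ ≡ 2 → X ∈ Pairs n
∈-Pairs {X = X} p = ∈-filterᵇ⁺ (λ X → ∣ X ∣ ≡ᵇ 2) (allSubsets-complete X) (≡ᵇ-true p)

∈-Pairs⁻ : ∀ {X : Subset n} → X ∈ Pairs n → ∣ X ∣ ≡ 2
∈-Pairs⁻ {n} p = ≡ᵇ-true⁻ (proj₂ (∈-filterᵇ⁻ (λ X → ∣ X ∣ ≡ᵇ 2) (allSubsets n) p))

Big-Unique : ∀ n → Unique (Big n)
Big-Unique n = filterᵇ-unique _ (allSubsets-Unique n)

Pairs-Unique : ∀ n → Unique (Pairs n)
Pairs-Unique n = filterᵇ-unique _ (allSubsets-Unique n)

Edges-Unique : ∀ (A : Family n) → Unique (Edges A)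
Edges-Unique A = filterᵇ-unique A (Pairs-Unique _)

∈-Edges⁻ : ∀ {A : Family n} {X} → X ∈ Edges A → ∣ X ∣ ≡ 2 × A X ≡ true
∈-Edges⁻ {n} {A} p = let a , b = ∈-filterᵇ⁻ A (Pairs n) p in ∈-Pairs⁻ a , b

∈-Edges : ∀ {A : Family n} {X} → ∣ X ∣ ≡ 2 → A X ≡ true → X ∈ Edges A
∈-Edges {A = A} p q = ∈-filterᵇ⁺ A (∈-Pairs p) q

split-2-3 : ∀ (F : Family n) (H : List (Subset n)) → Unique H → (∀ {X} → X ∈ H → ∣ X ∣ ≡ 2 × F X ≡ true) →
  (∀ X → F X ≡ true → X ∈ H ⊎ 3 ≤ ∣ X ∣) → members F ↭ H ++ filterᵇ F (Big n)
split-2-3 {n} F H u sub cov = Unique-⊆⊇ (members-Unique F)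
  (Uniq.++⁺ u (filterᵇ-unique F (Big-Unique n))
    λ (a , b) → <-irrefl refl (≤-trans (∈-Big⁻ (proj₁ (∈-filterᵇ⁻ F (Big n) b))) (≤-reflexive (proj₁ (sub a)))))
  (λ {X} p → f X (∈-members⁻ F p) (cov X (∈-members⁻ F p)))
  (λ p → ∈-members F (g (∈-++⁻ H p)))
  where
  f : ∀ X → F X ≡ true → X ∈ H ⊎ 3 ≤ ∣ X ∣ → X ∈ H ++ filterᵇ F (Big n)
  f X fx (inj₁ p) = ∈-++⁺ˡ p
  f X fx (inj₂ p) = ∈-++⁺ʳ H (∈-filterᵇ⁺ F (∈-Big p) fx)
  g : ∀ {X} → X ∈ H ⊎ X ∈ filterᵇ F (Big n) → F X ≡ true
  g (inj₁ p) = proj₂ (sub p)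
  g (inj₂ p) = proj₂ (∈-filterᵇ⁻ F (Big n) p)

filterᵇ-all : ∀ (p : A → Bool) xs → (∀ x → x ∈ xs → p x ≡ true) → filterᵇ p xs ≡ xs
filterᵇ-all p [] h = refl
filterᵇ-all p (x ∷ xs) h rewrite filterᵇ-∷ p x xs | h x (here refl) = cong (x ∷_) (filterᵇ-all p xs λ y q → h y (there q))

layered-members : ∀ {A : Family n} → Layered A → members A ↭ Edges A ++ Big n
layered-members {n} {A} lay = subst (λ l → members A ↭ Edges A ++ l)
  (filterᵇ-all A (Big n) λ X p → big X (∈-Big⁻ p))
  (split-2-3 A (Edges A) (Edges-Unique A) (λ p → ∈-Edges⁻ p) cov)
  where
  open Layered lay
  cov : ∀ X → A X ≡ true → X ∈ Edges A ⊎ 3 ≤ ∣ X ∣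
  cov X ax with 3 ≤? ∣ X ∣
  ... | yes p = inj₂ p
  ... | no p = inj₁ (∈-Edges (≤-antisym (≤-pred (≰⇒> p)) (small X ax)) ax)

layered-size : ∀ {A : Family n} → Layered A → size A ≡ length (Edges A) + length (Big n)
layered-size {A = A} lay = trans (↭-length (layered-members lay)) (length-++ (Edges A))

-- Counts the intersecting families of size s that consist of the 2-sets in H and of larger sets.
extensions : ℕ → List (Subset n) → ℕ
extensions {n} s H = SS (Big n) λ B → 𝟙 (good s (H ++ B))

extensions-↭ : ∀ {s} → Resp↭ (extensions {n} s)
extensions-↭ {n} p = SS-cong′ (Big n) λ B → good-↭ (++⁺ʳ B p)

layered-count : ∀ {A : Family n} s → Layered A → numIntersecting s A ≡ SS (Edges A) (extensions s)
layered-count {n} {A} s lay = trans (numIntersecting-SS s A)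
  (trans (SS-↭ _ good-↭ (layered-members lay)) (SS-++ (Edges A) (Big n) _))

extensions-0 : ∀ s {H : List (Subset n)} → inter? H ≡ false → extensions s H ≡ 0
extensions-0 {n} s {H} p = ∑-zero (sublists (Big n)) λ B _ → cong 𝟙 (not-true λ q →
  true≢false (inter-⊆ (λ X∈ → ∈-++⁺ˡ X∈) (proj₂ (good⁻ {s = s} {L = H ++ B} q))) p)

Big-act : ∀ (p : Involution n) → Big n ↭ map (act p) (Big n)
Big-act {n} p = ↭-sym (Unique-⊆⊇ (Unique-map (act p) (λ {X} {Y} _ _ e → trans (sym (act-act p X)) (trans (cong (act p) e) (act-act p Y))) (Big-Unique n))
  (Big-Unique n) (λ r → let Y , Y∈ , e = ∈-map⁻ (act p) r in subst (_∈ Big n) (sym e) (big Y∈))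
  λ {X} r → subst (_∈ map (act p) (Big n)) (act-act p X) (∈-map⁺ (act p) (big r)))
  where
  big : ∀ {Y} → Y ∈ Big n → act p Y ∈ Big n
  big {Y} r = ∈-Big (subst (3 ≤_) (sym (card-act p Y)) (∈-Big⁻ r))

good-act : ∀ (p : Involution n) s L → good s (map (act p) L) ≡ good s L
good-act p s L = bool-ext
  (λ h → let a , b = good⁻ {s = s} h in good⁺ (trans (sym (length-map (act p) L)) a)
    (inter⁺ λ X Y X∈ Y∈ → trans (sym (meets-act p X Y)) (inter⁻ b (∈-map⁺ (act p) X∈) (∈-map⁺ (act p) Y∈))))
  (λ h → let a , b = good⁻ {s = s} h in good⁺ (trans (length-map (act p) L) a)
    (inter⁺ λ X Y X∈ Y∈ → let X' , X'∈ , e = ∈-map⁻ (act p) X∈ ; Y' , Y'∈ , e' = ∈-map⁻ (act p) Y∈ in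
      trans (cong₂ meets e e') (trans (meets-act p X' Y') (inter⁻ b X'∈ Y'∈))))

extensions-act : ∀ (p : Involution n) s H → extensions s (map (act p) H) ≡ extensions s H
extensions-act {n} p s H = trans (SS-↭ _ (λ q → good-↭ (++⁺ˡ (map (act p) H) q)) (Big-act p))
  (trans (SS-map (act p) (Big n) _) (SS-cong′ (Big n) λ B →
    cong 𝟙 (trans (cong (good s) (sym (map-++ (act p) H B))) (good-act p s (H ++ B)))))

acts : List (Involution n) → Subset n → Subset n
acts [] X = X
acts (p ∷ ps) X = act p (acts ps X)

map-id′ : ∀ {f : A → A} xs → (∀ x → x ∈ xs → f x ≡ x) → map f xs ≡ xs
map-id′ [] h = refl
map-id′ (x ∷ xs) h = cong₂ _∷_ (h x (here refl)) (map-id′ xs λ y q → h y (there q))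

extensions-acts : ∀ (ps : List (Involution n)) s H → extensions s (map (acts ps) H) ≡ extensions s H
extensions-acts [] s H = cong (extensions s) (map-id′ H λ _ _ → refl)
extensions-acts (p ∷ ps) s H = trans (cong (extensions s) (map-∘ {g = act p} {f = acts ps} H))
  (trans (extensions-act p s (map (acts ps) H)) (extensions-acts ps s H))

card-acts : ∀ (ps : List (Involution n)) X → ∣ acts ps X ∣ ≡ ∣ X ∣
card-acts [] X = refl
card-acts (p ∷ ps) X = trans (card-act p (acts ps X)) (card-acts ps X)

act-inj : ∀ (p : Involution n) {X Y} → act p X ≡ act p Y → X ≡ Y
act-inj p {X} {Y} e = trans (sym (act-act p X)) (trans (cong (act p) e) (act-act p Y))

acts-inj : ∀ (ps : List (Involution n)) {X Y} → acts ps X ≡ acts ps Y → X ≡ Y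
acts-inj [] e = e
acts-inj (p ∷ ps) e = acts-inj ps (act-inj p e)

act-⟦⟧ : ∀ (p : Involution n) u v → act p ⟦ u ∷ v ∷ [] ⟧ ≡ ⟦ Involution.fun p u ∷ Involution.fun p v ∷ [] ⟧
act-⟦⟧ p u v = subset-ext
  (λ i q → ⟦⟧-∋ (f i (⟦⟧-∋⁻ {us = u ∷ v ∷ []} (trans (sym (act-∋ p ⟦ u ∷ v ∷ [] ⟧ i)) q))))
  (λ i q → trans (act-∋ p ⟦ u ∷ v ∷ [] ⟧ i) (⟦⟧-∋ (g i (⟦⟧-∋⁻ {us = fun u ∷ fun v ∷ []} q))))
  where
  open Involution p
  f : ∀ i → fun i ∈ u ∷ v ∷ [] → i ∈ fun u ∷ fun v ∷ []
  f i (here e) = here (trans (sym (inv i)) (cong fun e))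
  f i (there (here e)) = there (here (trans (sym (inv i)) (cong fun e)))
  g : ∀ i → i ∈ fun u ∷ fun v ∷ [] → fun i ∈ u ∷ v ∷ []
  g i (here e) = here (trans (cong fun e) (inv u))
  g i (there (here e)) = there (here (trans (cong fun e) (inv v)))

-- Stars and the symmetry of their extension counts

record Star (v : Fin n) (H : List (Subset n)) : Set where
  field
    unique : Unique H
    edge : ∀ {X} → X ∈ H → ∣ X ∣ ≡ 2
    centre : ∀ {X} → X ∈ H → X ∋ v

Star-tail : ∀ {v : Fin n} {e H} → Star v (e ∷ H) → Star v H
Star-tail st = record { unique = Unique-tail unique ; edge = λ p → edge (there p) ; centre = λ p → centre (there p) }
  where open Star st

-- Edges are moved one at a time to their destination by transpositions fixing the centre.
Star-transport : ∀ {v : Fin n} H H' → Star v H → Star v H' → length H ≡ length H' →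
  ∃[ ps ] (map (acts ps) H ↭ H' × (∀ X → lookup (acts ps X) v ≡ lookup X v))
Star-transport [] [] _ _ _ = [] , prefl , λ _ → refl
Star-transport {n} {v} (e ∷ H) (e' ∷ H') st st' len
  with Star-transport H H' (Star-tail st) (Star-tail st') (suc-injective len)
... | ps , perm , keep
  with card-2-at (acts ps e) (trans (card-acts ps e) (Star.edge st (here refl))) (trans (keep e) (Star.centre st (here refl)))
     | card-2-at e' (Star.edge st' (here refl)) (Star.centre st' (here refl))
... | x , x≢v , ex | y , y≢v , ey = τ ∷ ps , perm' , λ X → trans (act-∋ τ (acts ps X) v)
      (trans (cong (lookup (acts ps X)) (swapF-other x y v (x≢v ∘ sym) (y≢v ∘ sym))) (keep X))
  where
  τ = transposition x y
  e₁∉ : acts ps e ∉ H'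
  e₁∉ r with ∈-map⁻ (acts ps) (∈-resp-↭ (↭-sym perm) r)
  ... | X , X∈ , eq = Unique-head (Star.unique st) (subst (_∈ H) (sym (acts-inj ps eq)) X∈)
  -- An edge at v is determined by its other end. The edges already in place differ from both {v,x}
  -- and {v,y}, so they contain neither x nor y and the transposition leaves them alone.
  fixed : ∀ X → X ∈ H' → act τ X ≡ X
  fixed X X∈ with card-2-at X (Star.edge st' (there X∈)) (Star.centre st' (there X∈))
  ... | z , z≢v , refl = trans (act-⟦⟧ τ v z) (cong₂ (λ a b → ⟦ a ∷ b ∷ [] ⟧)
        (swapF-other x y v (x≢v ∘ sym) (y≢v ∘ sym))
        (swapF-other x y z (λ { refl → e₁∉ (subst (_∈ H') (sym ex) X∈) })
          (λ { refl → Unique-head (Star.unique st') (subst (_∈ H') (sym ey) X∈) })))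
  moved : act τ (acts ps e) ≡ e'
  moved = trans (cong (act τ) ex) (trans (act-⟦⟧ τ v x) (trans (cong₂ (λ a b → ⟦ a ∷ b ∷ [] ⟧)
    (swapF-other x y v (x≢v ∘ sym) (y≢v ∘ sym)) (swapF-left x y)) (sym ey)))
  perm' : map (acts (τ ∷ ps)) (e ∷ H) ↭ e' ∷ H'
  perm' = subst (λ z → z ∷ map (acts (τ ∷ ps)) H ↭ e' ∷ H') (sym moved) (prep e'
    (subst₂ _↭_ (sym (map-∘ {g = act τ} {f = acts ps} H)) (map-id′ H' fixed) (map⁺ (act τ) perm)))

Star-act : ∀ {v : Fin n} {H} p → Star v H → Star (Involution.fun p v) (map (act p) H)
Star-act {v = v} {H} p st = record
  { unique = Unique-map (act p) (λ _ _ e → act-inj p e) unique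
  ; edge = λ r → let X , X∈ , e = ∈-map⁻ (act p) r in trans (cong ∣_∣ e) (trans (card-act p X) (edge X∈))
  ; centre = λ r → let X , X∈ , e = ∈-map⁻ (act p) r in
      trans (cong (λ Z → lookup Z (Involution.fun p v)) e)
        (trans (act-∋ p X _) (trans (cong (lookup X) (Involution.inv p v)) (centre X∈))) }
  where open Star st

extensions-Star : ∀ s {v v' : Fin n} {H H'} → Star v H → Star v' H' → length H ≡ length H' →
  extensions s H ≡ extensions s H'
extensions-Star s {v} {v'} {H} {H'} st st' len
  with Star-transport (map (act τ) H) H' (subst (λ c → Star c (map (act τ) H)) (swapF-left v v') (Star-act τ st)) st'
    (trans (length-map (act τ) H) len)
  where τ = transposition v v'
... | ps , perm , _ = trans (sym (extensions-act (transposition v v') s H))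
      (trans (sym (extensions-acts ps s _)) (extensions-↭ {s = s} perm))

others : Fin n → List (Fin n)
others {n} v = filterᵇ (λ i → not (does (i ≟F v))) (allFin n)

∈-others : ∀ {v i : Fin n} → i ≢ v → i ∈ others v
∈-others {v = v} {i} p = ∈-filterᵇ⁺ _ (∈-Fin i) (cong not (dec-false (i ≟F v) p))

∈-others⁻ : ∀ {v i : Fin n} → i ∈ others v → i ≢ v
∈-others⁻ {n} {v} p refl = true≢false (dec-true (v ≟F v) refl)
  (not-true⁻ (proj₂ (∈-filterᵇ⁻ (λ i → not (does (i ≟F v))) (allFin n) p)))

length-others : ∀ (v : Fin n) → suc (length (others v)) ≡ n
length-others {n} v = trans (cong₂ _+_ (sym (∑-== v)) (length-filter-∑ (λ i → not (does (i ≟F v))) (allFin n)))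
  (trans (sym (∑-+ (allFin n) _ _)) (trans (∑-cong (allFin n) λ i _ → one (does (i ≟F v)))
    (trans (sym (length-∑ (allFin n))) (length-allFin n))))
  where
  one : ∀ b → 𝟙 b + 𝟙 (not b) ≡ 1
  one true = refl
  one false = refl

spokes : Fin n → List (Subset n)
spokes v = map (λ i → ⟦ v ∷ i ∷ [] ⟧) (others v)

spoke-inj : ∀ {v i j : Fin n} → i ≢ v → ⟦ v ∷ i ∷ [] ⟧ ≡ ⟦ v ∷ j ∷ [] ⟧ → i ≡ j
spoke-inj {v = v} {i} {j} p e with ⟦⟧-∋⁻ {us = v ∷ j ∷ []} (subst (_∋ i) e (⟦⟧-∋ {us = v ∷ i ∷ []} (there (here refl))))
... | here q = ⊥-elim (p q)
... | there (here q) = q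

spokes-Star : ∀ (v : Fin n) → Star v (spokes v)
spokes-Star {n} v = record
  { unique = Unique-map _ (λ {i} {j} i∈ _ e → spoke-inj (∈-others⁻ i∈) e) (filterᵇ-unique _ (allFin-Unique n))
  ; edge = λ r → let i , i∈ , e = ∈-map⁻ _ r in trans (cong ∣_∣ e)
      (card-⟦⟧ {us = v ∷ i ∷ []} (Unique-2 (∈-others⁻ i∈ ∘ sym)))
  ; centre = λ r → let i , i∈ , e = ∈-map⁻ _ r in subst (_∋ v) (sym e) (⟦⟧-∋ (here refl)) }

∈-spokes : ∀ {v : Fin n} {X} → ∣ X ∣ ≡ 2 → X ∋ v → X ∈ spokes v
∈-spokes {v = v} {X} c xv with card-2-at X c xv
... | u , u≢v , refl = ∈-map⁺ _ (∈-others u≢v)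

length-spokes : ∀ (v : Fin n) → suc (length (spokes v)) ≡ n
length-spokes v = trans (cong suc (length-map _ (others v))) (length-others v)

Star-take : ∀ {v : Fin n} {H} k → Star v H → Star v (List.take k H)
Star-take {H = H} k st = record { unique = Uniq.take⁺ k unique ; edge = λ p → edge (take-∈ k H p) ; centre = λ p → centre (take-∈ k H p) }
  where open Star st

Star-length : ∀ {v : Fin n} {H} → Star v H → suc (length H) ≤ n
Star-length {v = v} st = ≤-trans (s≤s (Unique-length unique λ p → ∈-spokes (edge p) (centre p))) (≤-reflexive (length-spokes v))
  where open Star st

-- The number g(k), read off from one representative star at an arbitrary reference vertex. It has
-- this meaning for k ≤ n - 1, the number of spokes.
starExt : Fin n → ℕ → ℕ → ℕ
starExt v s k = extensions s (List.take k (spokes v))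

length-take-spokes : ∀ (v : Fin n) {k} → suc k ≤ n → length (List.take k (spokes v)) ≡ k
length-take-spokes v {k} p = trans (length-take k (spokes v))
  (m≤n⇒m⊓n≡m (≤-pred (≤-trans p (≤-reflexive (sym (length-spokes v))))))

extensions-starExt : ∀ s (c : Fin n) {v H} → Star v H → extensions s H ≡ starExt c s (length H)
extensions-starExt s c st = extensions-Star s st (Star-take _ (spokes-Star c)) (sym (length-take-spokes c (Star-length st)))

pair-≡ : ∀ (X : Subset n) {x y} → ∣ X ∣ ≡ 2 → X ∋ x → X ∋ y → x ≢ y → X ≡ ⟦ x ∷ y ∷ [] ⟧
pair-≡ X {x} {y} c p q x≢y = sym (⊆-card-≡ ⟦ x ∷ y ∷ [] ⟧ X (λ i r → f i (⟦⟧-∋⁻ {us = x ∷ y ∷ []} r))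
  (≤-reflexive (trans c (sym (card-⟦⟧ {us = x ∷ y ∷ []} (Unique-2 x≢y))))))
  where
  f : ∀ i → i ∈ x ∷ y ∷ [] → X ∋ i
  f i (here refl) = p
  f i (there (here refl)) = q

meets-pair : ∀ (X : Subset n) a b → meets X ⟦ a ∷ b ∷ [] ⟧ ≡ true → X ∋ a ⊎ X ∋ b
meets-pair X a b m with meets⁻ X ⟦ a ∷ b ∷ [] ⟧ m
... | i , xi , p with ⟦⟧-∋⁻ {us = a ∷ b ∷ []} p
...   | here refl = inj₁ xi
...   | there (here refl) = inj₂ xi

-- Intersecting families of 2-sets

triangle : Fin n → Fin n → Fin n → List (Subset n)
triangle a b c = ⟦ a ∷ b ∷ [] ⟧ ∷ ⟦ a ∷ c ∷ [] ⟧ ∷ ⟦ b ∷ c ∷ [] ⟧ ∷ []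

Triangle : List (Subset n) → Set
Triangle H = ∃[ a ] ∃[ b ] ∃[ c ] a ≢ b × a ≢ c × b ≢ c × H ↭ triangle a b c

all-false : ∀ (p : A → Bool) xs → all p xs ≡ false → ∃[ x ] x ∈ xs × p x ≡ false
all-false p (x ∷ xs) h with p x in eq
... | false = x , here refl , eq
... | true = let y , y∈ , q = all-false p xs h in y , there y∈ , q

Unique-triangle : ∀ {a b c : Fin n} → a ≢ b → a ≢ c → b ≢ c → Unique (triangle a b c)
Unique-triangle {a = a} {b} {c} p q r = Unique-3 (λ e → r (spoke-inj (p ∘ sym) e))
  (λ e → f (⟦⟧-∋⁻ {us = b ∷ c ∷ []} (subst (_∋ a) e (⟦⟧-∋ (here refl)))))
  (λ e → f (⟦⟧-∋⁻ {us = b ∷ c ∷ []} (subst (_∋ a) e (⟦⟧-∋ (here refl)))))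
  where
  f : a ∈ b ∷ c ∷ [] → ⊥
  f (here e) = p e
  f (there (here e)) = q e

-- An edge avoiding a has to meet ab and ac, so it is bc. Once bc is present, an edge at a has to
-- meet it and is ab or ac.
star-or-triangle : ∀ (a b c : Fin n) H → Unique H → (∀ {X} → X ∈ H → ∣ X ∣ ≡ 2) → inter? H ≡ true →
  ⟦ a ∷ b ∷ [] ⟧ ∈ H → ⟦ a ∷ c ∷ [] ⟧ ∈ H → a ≢ b → a ≢ c → b ≢ c → Star a H ⊎ Triangle H
star-or-triangle a b c H u e int ab ac a≢b a≢c b≢c with all (λ X → lookup X a) H in eq
... | true = inj₁ (record { unique = u ; edge = e ; centre = λ p → all-true⁻ (λ X → lookup X a) H eq p })
... | false with all-false (λ X → lookup X a) H eq
...   | Z , Z∈ , za = inj₂ (a , b , c , a≢b , a≢c , b≢c , Unique-⊆⊇ u (Unique-triangle a≢b a≢c b≢c) sub sup)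
  where
  avoid : ∀ {X} → X ∈ H → lookup X a ≡ false → X ≡ ⟦ b ∷ c ∷ [] ⟧
  avoid {X} X∈ xa with meets-pair X a b (inter⁻ int X∈ ab) | meets-pair X a c (inter⁻ int X∈ ac)
  ... | inj₁ p | _ = ⊥-elim (true≢false p xa)
  ... | inj₂ _ | inj₁ p = ⊥-elim (true≢false p xa)
  ... | inj₂ p | inj₂ q = pair-≡ X (e X∈) p q b≢c
  bc : ⟦ b ∷ c ∷ [] ⟧ ∈ H
  bc = subst (_∈ H) (avoid Z∈ za) Z∈
  sub : ∀ {X} → X ∈ H → X ∈ triangle a b c
  sub {X} X∈ with lookup X a in xa
  ... | false = there (there (here (avoid X∈ xa)))
  ... | true with meets-pair X b c (inter⁻ int X∈ bc)
  ...   | inj₁ p = here (pair-≡ X (e X∈) xa p a≢b)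
  ...   | inj₂ p = there (here (pair-≡ X (e X∈) xa p a≢c))
  sup : ∀ {X} → X ∈ triangle a b c → X ∈ H
  sup (here refl) = ab
  sup (there (here refl)) = ac
  sup (there (there (here refl))) = bc

classify : ∀ (c : Fin n) H → Unique H → (∀ {X} → X ∈ H → ∣ X ∣ ≡ 2) → inter? H ≡ true →
  (∃[ v ] Star v H) ⊎ Triangle H
-- The empty family is a star with any centre; `c` provides one.
classify c [] u e int = inj₁ (c , record { unique = u ; edge = λ () ; centre = λ () })
classify c (X ∷ []) u e int with card-2 X (e (here refl))
... | a , b , _ , refl = inj₁ (a , record { unique = u ; edge = e ; centre = λ { (here refl) → ⟦⟧-∋ (here refl) } })
classify c (X ∷ Y ∷ H) u e int with meets⁻ X Y (inter⁻ int (here refl) (there (here refl)))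
... | a , xa , ya with card-2-at X (e (here refl)) xa | card-2-at Y (e (there (here refl))) ya
... | b , b≢a , refl | d , d≢a , refl with star-or-triangle a b d (⟦ a ∷ b ∷ [] ⟧ ∷ ⟦ a ∷ d ∷ [] ⟧ ∷ H) u e int
    (here refl) (there (here refl)) (b≢a ∘ sym) (d≢a ∘ sym) (λ { refl → Unique-head u (here refl) })
... | inj₁ st = inj₁ (a , st)
... | inj₂ t = inj₂ t

-- Bounds on the number of extensions from intersecting families of size 2^(n-1)

S-∈ : ∀ d g {k} → k ≤ d → g k ≤ S d g
S-∈ zero g z≤n = ≤-refl
S-∈ (suc d) g {zero} z≤n = ≤-trans (S-∈ d g z≤n) (m≤m+n _ _)
S-∈ (suc d) g {suc k} (s≤s p) = ≤-trans (S-∈ d (g ∘ suc) p) (m≤n+m _ _)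

-- The binomial coefficient C(m, s - h), and 0 if h > s.
completions : ℕ → ℕ → ℕ → ℕ
completions s h m = S m λ k → 𝟙 ((h + k) ≡ᵇ s)

extensions-≥ : ∀ s H (P : Family n) → (∀ X Y → P X ≡ true → P Y ≡ true → meets X Y ≡ true) →
  (∀ {X} → X ∈ H → P X ≡ true) → completions s (length H) (length (filterᵇ P (Big n))) ≤ extensions s H
extensions-≥ {n} s H P int sub = ≤-trans (≤-reflexive (trans (sym (SS-length (filterᵇ P (Big n)) _))
  (sym (SS-filter P (Big n) _)))) (∑-mono (sublists (Big n)) λ B _ → le B)
  where
  le : ∀ B → 𝟙 (all P B) * 𝟙 ((length H + length B) ≡ᵇ s) ≤ 𝟙 (good s (H ++ B))
  le B with all P B in a | (length H + length B) ≡ᵇ s in b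
  ... | false | _ = z≤n
  ... | true | false = z≤n
  ... | true | true = ≤-reflexive (cong 𝟙 (sym (good⁺ {s = s} {L = H ++ B} (trans (length-++ H) (≡ᵇ-true⁻ b))
        (inter⁺ λ X Y p q → int X Y (inP (∈-++⁻ H p)) (inP (∈-++⁻ H q))))))
    where
    inP : ∀ {X} → X ∈ H ⊎ X ∈ B → P X ≡ true
    inP (inj₁ p) = sub p
    inP (inj₂ p) = all-true⁻ P B a p

-- An extension only uses sets that meet all of `H`, and `P` contains them. When these sets also
-- meet each other this agrees with the lower bound, which is what happens for triangles.
extensions-≤ : ∀ s H (P : Family n) → (∀ X → (∀ {Y} → Y ∈ H → meets X Y ≡ true) → P X ≡ true) →
  extensions s H ≤ completions s (length H) (length (filterᵇ P (Big n)))
extensions-≤ {n} s H P sup = ≤-trans (∑-mono (sublists (Big n)) λ B _ → le B)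
  (≤-reflexive (trans (SS-filter P (Big n) _) (SS-length (filterᵇ P (Big n)) _)))
  where
  le : ∀ B → 𝟙 (good s (H ++ B)) ≤ 𝟙 (all P B) * 𝟙 ((length H + length B) ≡ᵇ s)
  le B with good s (H ++ B) in g
  ... | false = z≤n
  ... | true rewrite all-true P B (λ X X∈ → sup X λ Y∈ → inter⁻ (proj₂ (good⁻ {s = s} {L = H ++ B} g)) (∈-++⁺ʳ H X∈) (∈-++⁺ˡ Y∈))
        | ≡ᵇ-true (trans (sym (length-++ H {B})) (proj₁ (good⁻ {s = s} {L = H ++ B} g))) = ≤-refl

withEdges : List (Subset n) → Family n
withEdges H X = (3 ≤ᵇ ∣ X ∣) ∨ mem H X

withEdges-⁻ : ∀ (H : List (Subset n)) X → withEdges H X ≡ true → 3 ≤ ∣ X ∣ ⊎ X ∈ H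
withEdges-⁻ H X p with ∨-true {3 ≤ᵇ ∣ X ∣} p
... | inj₁ q = inj₁ (≤ᵇ-true⁻ q)
... | inj₂ q = inj₂ (mem⁻ q)

withEdges-∈ : ∀ (H : List (Subset n)) {X} → X ∈ H → withEdges H X ≡ true
withEdges-∈ H {X} p rewrite mem⁺ p with 3 ≤ᵇ ∣ X ∣
... | true = refl
... | false = refl

withEdges-Layered : ∀ {H : List (Subset n)} → (∀ {X} → X ∈ H → ∣ X ∣ ≡ 2) → Layered (withEdges H)
withEdges-Layered {H = H} e = record
  { big = λ X p → cong (_∨ mem H X) (≤ᵇ-true p)
  ; small = λ X p → f X (withEdges-⁻ H X p) }
  where
  f : ∀ X → 3 ≤ ∣ X ∣ ⊎ X ∈ H → 2 ≤ ∣ X ∣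
  f X (inj₁ p) = ≤-trans (n≤1+n 2) p
  f X (inj₂ p) = ≤-reflexive (sym (e p))

-- The self-dual family at the centre contains `H` and has no other 2-sets, so it offers 2^(n - 1)
-- minus |H| larger sets that can be combined freely.
Star-extensions-≥ : ∀ s {v : Fin n} {H} → 5 ≤ n → Star v H →
  ∃[ m ] length H + m ≡ 2 ^ (n ∸ 1) × completions s (length H) m ≤ extensions s H
Star-extensions-≥ {n} s {v} {H} 5≤n st = length (filterᵇ F (Big n)) ,
  trans (sym (trans (↭-length (split-2-3 F H unique (λ p → edge p , inF p) cov)) (length-++ H)))
    (half-2^ n (≤-trans (s≤s z≤n) 5≤n) selfDual-size) ,
  extensions-≥ s H F selfDual-int inF
  where
  open Star st
  open SelfDual (withEdges-Layered edge) 5≤n v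
  F = selfDual (withEdges H) v
  inF : ∀ {X} → X ∈ H → F X ≡ true
  inF {X} p rewrite centre p = withEdges-∈ H p
  cov : ∀ X → F X ≡ true → X ∈ H ⊎ 3 ≤ ∣ X ∣
  cov X p with withEdges-⁻ H X (selfDual-⊆ X p)
  ... | inj₁ q = inj₂ q
  ... | inj₂ q = inj₁ q

Star-extensions-pos : ∀ {s} {v : Fin n} {H} → 5 ≤ n → Star v H → length H ≤ s → s ≤ 2 ^ (n ∸ 1) → 0 < extensions s H
Star-extensions-pos {n} {s} {v} {H} 5≤n st h≤s s≤ with Star-extensions-≥ s 5≤n st
... | m , eq , le = ≤-trans (≤-trans (≤-reflexive (cong 𝟙 (sym (≡ᵇ-true (m+[n∸m]≡n h≤s)))))
      (S-∈ m (λ k → 𝟙 ((length H + k) ≡ᵇ s)) {s ∸ length H}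
        (≤-trans (∸-monoˡ-≤ (length H) (≤-trans s≤ (≤-reflexive (sym eq)))) (≤-reflexive (m+n∸m≡n (length H) m))))) le

majority : Fin n → Fin n → Fin n → Family n
majority a b c X = (lookup X a ∧ lookup X b) ∨ ((lookup X a ∨ lookup X b) ∧ lookup X c)

majority-dual : ∀ (a b c : Fin n) X → majority a b c (∁ X) ≡ not (majority a b c X)
majority-dual a b c X rewrite ∁-∋ X a | ∁-∋ X b | ∁-∋ X c with lookup X a | lookup X b | lookup X c
... | true | true | _ = refl
... | true | false | true = refl
... | true | false | false = refl
... | false | true | true = refl
... | false | true | false = refl
... | false | false | _ = refl

majority-int : ∀ (a b c : Fin n) X Y → majority a b c X ≡ true → majority a b c Y ≡ true → meets X Y ≡ true
majority-int a b c X Y p q with lookup X a in xa | lookup Y a in ya | lookup X b in xb | lookup Y b in yb | lookup X c in xc | lookup Y c in yc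
... | true | true | _ | _ | _ | _ = meets⁺ X Y xa ya
... | _ | _ | true | true | _ | _ = meets⁺ X Y xb yb
... | _ | _ | _ | _ | true | true = meets⁺ X Y xc yc
majority-int a b c X Y () q | true | _ | false | _ | false | _
majority-int a b c X Y () q | false | _ | true | _ | false | _
majority-int a b c X Y () q | false | _ | false | _ | _ | _
majority-int a b c X Y p () | _ | true | _ | false | _ | false
majority-int a b c X Y p () | _ | false | _ | true | _ | false
majority-int a b c X Y p () | _ | false | _ | false | _ | _

majority-⊇ : ∀ {a b c : Fin n} X → majority a b c X ≡ true →
  (X ∋ a × X ∋ b) ⊎ (X ∋ a × X ∋ c) ⊎ (X ∋ b × X ∋ c)
majority-⊇ {a = a} {b} {c} X p with lookup X a | lookup X b | lookup X c
... | true | true | _ = inj₁ (refl , refl)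
... | true | false | true = inj₂ (inj₁ (refl , refl))
... | false | true | true = inj₂ (inj₂ (refl , refl))

-- A set meeting all three sides contains two of the corners. So the sets available are those with
-- at least two of a, b, c; they form a self-dual intersecting family whose only 2-sets are the
-- sides. The count is thus exact, whereas for a star with three edges the same number is a lower
-- bound.
Triangle-extensions : ∀ s {H : List (Subset n)} → 1 ≤ n → Triangle H →
  ∃[ m ] 3 + m ≡ 2 ^ (n ∸ 1) × extensions s H ≡ completions s 3 m
Triangle-extensions {n} s 1≤n (a , b , c , a≢b , a≢c , b≢c , perm) = length (filterᵇ F (Big n)) ,
  trans (sym (trans (↭-length (split-2-3 F Δ (Unique-triangle a≢b a≢c b≢c) sub cov)) (length-++ Δ {filterᵇ F (Big n)})))
    (half-2^ n 1≤n (selfDual-half F (majority-dual a b c))) ,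
  trans (extensions-↭ {s = s} perm) (≤-antisym (extensions-≤ s Δ F sup) (extensions-≥ s Δ F (majority-int a b c) (proj₂ ∘ sub)))
  where
  Δ = triangle a b c
  F = majority a b c
  ab : ∀ {X : Subset n} → X ∋ a → X ∋ b → F X ≡ true
  ab p q rewrite p | q = refl
  ac : ∀ {X : Subset n} → X ∋ a → X ∋ c → F X ≡ true
  ac {X} p q rewrite p | q with lookup X b
  ... | true = refl
  ... | false = refl
  bc : ∀ {X : Subset n} → X ∋ b → X ∋ c → F X ≡ true
  bc {X} p q rewrite p | q with lookup X a
  ... | true = refl
  ... | false = refl
  sub : ∀ {X} → X ∈ Δ → ∣ X ∣ ≡ 2 × F X ≡ true
  sub (here refl) = card-⟦⟧ {us = a ∷ b ∷ []} (Unique-2 a≢b) , ab {⟦ a ∷ b ∷ [] ⟧} (⟦⟧-∋ (here refl)) (⟦⟧-∋ (there (here refl)))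
  sub (there (here refl)) = card-⟦⟧ {us = a ∷ c ∷ []} (Unique-2 a≢c) , ac {⟦ a ∷ c ∷ [] ⟧} (⟦⟧-∋ (here refl)) (⟦⟧-∋ (there (here refl)))
  sub (there (there (here refl))) = card-⟦⟧ {us = b ∷ c ∷ []} (Unique-2 b≢c) , bc {⟦ b ∷ c ∷ [] ⟧} (⟦⟧-∋ (here refl)) (⟦⟧-∋ (there (here refl)))
  two-or-more : ∀ (X : Subset n) {x y} → x ≢ y → X ∋ x → X ∋ y → X ≡ ⟦ x ∷ y ∷ [] ⟧ ⊎ 3 ≤ ∣ X ∣
  two-or-more X {x} {y} x≢y p q with 3 ≤? ∣ X ∣
  ... | yes r = inj₂ r
  ... | no r = inj₁ (pair-≡ X (≤-antisym (≤-pred (≰⇒> r)) (card-≥ X (Unique-2 x≢y) λ { (here refl) → p ; (there (here refl)) → q })) p q x≢y)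
  cov : ∀ X → F X ≡ true → X ∈ Δ ⊎ 3 ≤ ∣ X ∣
  cov X p with majority-⊇ {a = a} {b} {c} X p
  cov X p | inj₁ (q , r) with two-or-more X a≢b q r
  ... | inj₁ e = inj₁ (here e)
  ... | inj₂ e = inj₂ e
  cov X p | inj₂ (inj₁ (q , r)) with two-or-more X a≢c q r
  ... | inj₁ e = inj₁ (there (here e))
  ... | inj₂ e = inj₂ e
  cov X p | inj₂ (inj₂ (q , r)) with two-or-more X b≢c q r
  ... | inj₁ e = inj₁ (there (there (here e)))
  ... | inj₂ e = inj₂ e
  sup : ∀ X → (∀ {Y} → Y ∈ Δ → meets X Y ≡ true) → F X ≡ true
  sup X h with meets-pair X a b (h (here refl)) | meets-pair X a c (h (there (here refl))) | meets-pair X b c (h (there (there (here refl))))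
  ... | inj₁ p | _ | inj₁ q = ab {X} p q
  ... | inj₁ p | _ | inj₂ q = ac {X} p q
  ... | inj₂ p | inj₁ q | _ = ab {X} q p
  ... | inj₂ p | inj₂ q | _ = bc {X} p q

Triangle-≤-Star : ∀ s {v : Fin n} {H K} → 5 ≤ n → Triangle H → Star v K → length K ≡ 3 → extensions s H ≤ extensions s K
Triangle-≤-Star s 5≤n t st len with Triangle-extensions s (≤-trans (s≤s z≤n) 5≤n) t | Star-extensions-≥ s 5≤n st
... | m , e , eq | m' , e' , le rewrite len = ≤-trans (≤-reflexive (trans eq
      (cong (completions s 3) (+-cancelˡ-≡ 3 m m' (trans e (sym e')))))) le

-- Binomial coefficients and ternary words

δ : ℕ → ℕ → ℕ
δ u t = 𝟙 (t ≡ᵇ u)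

S-zero : ∀ d {g : ℕ → ℕ} → (∀ k → g k ≡ 0) → S d g ≡ 0
S-zero zero p = p 0
S-zero (suc d) p = cong₂ _+_ (S-zero d p) (S-zero d λ k → p (suc k))

binom : ℕ → ℕ → ℕ
binom q u = S q (δ u)

binom-suc-0 : ∀ q → binom (suc q) 0 ≡ binom q 0
binom-suc-0 q = trans (cong (binom q 0 +_) (S-zero q λ _ → refl)) (+-identityʳ _)

-- The absorption identity (u + 1) C(q,u + 1) = (q - u) C(q,u), with the subtraction moved to the
-- left side.
binom-absorb : ∀ q u → suc u * binom q (suc u) + u * binom q u ≡ q * binom q u
binom-absorb zero zero = refl
binom-absorb zero (suc u) = cong₂ _+_ (*-zeroʳ u) (*-zeroʳ u)
binom-absorb (suc q) zero rewrite binom-suc-0 q = trans (lemma (binom q 1) (binom q 0))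
  (trans (cong (_+ binom q 0) (binom-absorb q zero)) (+-comm (q * binom q 0) (binom q 0)))
  where
  lemma : ∀ a b → 1 * (a + b) + 0 ≡ 1 * a + 0 + b
  lemma = solve-∀
binom-absorb (suc q) (suc u) = trans (lemma u (binom q (suc (suc u))) (binom q (suc u)) (binom q u))
  (trans (cong₂ (λ x y → x + y + binom q (suc u) + binom q u) (binom-absorb q (suc u)) (binom-absorb q u))
    (lemma₂ q (binom q (suc u)) (binom q u)))
  where
  lemma : ∀ u a b c → suc (suc u) * (a + b) + suc u * (b + c) ≡
    (suc (suc u) * a + suc u * b) + (suc u * b + u * c) + b + c
  lemma = solve-∀
  lemma₂ : ∀ q b c → q * b + q * c + b + c ≡ suc q * (b + c)
  lemma₂ = solve-∀

-- Sum over the words of length q in {0, +, −}, with g evaluated at the number of nonzero letters.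
ternary : ℕ → (ℕ → ℕ) → ℕ
ternary zero g = g 0
ternary (suc q) g = ternary q g + 2 * ternary q (g ∘ suc)

ternary-zero : ∀ d {g : ℕ → ℕ} → (∀ k → g k ≡ 0) → ternary d g ≡ 0
ternary-zero zero p = p 0
ternary-zero (suc d) p rewrite ternary-zero d p | ternary-zero d (λ k → p (suc k)) = refl

ternary-cong : ∀ q {g h : ℕ → ℕ} → (∀ t → g t ≡ h t) → ternary q g ≡ ternary q h
ternary-cong zero e = e 0
ternary-cong (suc q) e = cong₂ (λ a b → a + 2 * b) (ternary-cong q e) (ternary-cong q λ t → e (suc t))

S≤ternary : ∀ q g → S q g ≤ ternary q g
S≤ternary zero g = ≤-refl
S≤ternary (suc q) g = +-mono-≤ (S≤ternary q g) (≤-trans (S≤ternary q (g ∘ suc)) (m≤m+n _ _))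

ternary-δ : ∀ q u → ternary q (δ u) ≡ 2 ^ u * binom q u
ternary-δ zero zero = refl
ternary-δ zero (suc u) = sym (*-zeroʳ (2 ^ suc u))
ternary-δ (suc q) zero rewrite ternary-δ q zero | ternary-zero q {δ zero ∘ suc} (λ _ → refl) | binom-suc-0 q = +-identityʳ _
ternary-δ (suc q) (suc u) rewrite ternary-δ q (suc u) | ternary-δ q u = lemma (2 ^ u) (binom q (suc u)) (binom q u)
  where
  lemma : ∀ a b c → 2 * a * b + 2 * (a * c) ≡ 2 * a * (b + c)
  lemma = solve-∀

2^-lower : ∀ u → 3 ≤ u → 2 * suc u ≤ 2 ^ u
2^-lower (suc zero) (s≤s ())
2^-lower (suc (suc zero)) (s≤s (s≤s ()))
2^-lower (suc (suc (suc zero))) _ = ≤-refl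
2^-lower (suc (suc (suc (suc u)))) _ = ≤-trans (≤-reflexive (lemma (3 + u)))
  (≤-trans (+-mono-≤ (2^-lower (suc (suc (suc u))) (s≤s (s≤s (s≤s z≤n)))) 2≤)
  (≤-reflexive (cong (2 ^ suc (suc (suc u)) +_) (sym (+-identityʳ _)))))
  where
  lemma : ∀ k → 2 * suc (suc k) ≡ 2 * suc k + 2
  lemma = solve-∀
  2≤ : 2 ≤ 2 ^ suc (suc (suc u))
  2≤ = ≤-trans (≤-reflexive (sym (*-identityʳ 2))) (*-monoʳ-≤ 2 (≤-trans (m^n>0 2 (suc (suc u))) ≤-refl))

-- What remains of `binom-ratio` after multiplying by u + 1 and cancelling C(q,u), with d = q - u.
-- For u = 1 both sides agree, so the factor 2q leaves no slack there; from u = 3 on, 2 (u + 1) ≤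
-- 2^u suffices.
ternary-arith : ∀ u d → 2 * (u + d) * suc u ≤ 2 ^ u * (2 * d + suc u)
ternary-arith zero d = ≤-trans (m≤m+n _ 1) (≤-reflexive (lemma d))
  where
  lemma : ∀ d → 2 * (0 + d) * 1 + 1 ≡ 1 * (2 * d + 1)
  lemma = solve-∀
ternary-arith (suc zero) d = ≤-reflexive (lemma d)
  where
  lemma : ∀ d → 2 * (1 + d) * 2 ≡ 2 * (2 * d + 2)
  lemma = solve-∀
ternary-arith (suc (suc zero)) d = ≤-trans (m≤m+n _ (2 * d)) (≤-reflexive (lemma d))
  where
  lemma : ∀ d → 2 * (2 + d) * 3 + 2 * d ≡ 4 * (2 * d + 3)
  lemma = solve-∀
ternary-arith u@(suc (suc (suc _))) d = ≤-trans (m≤m+n _ (2 * suc u * (d + 1)))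
  (≤-trans (≤-reflexive (lemma u d)) (*-monoˡ-≤ (2 * d + suc u) (2^-lower u (s≤s (s≤s (s≤s z≤n))))))
  where
  lemma : ∀ u d → 2 * (u + d) * suc u + 2 * suc u * (d + 1) ≡ 2 * suc u * (2 * d + suc u)
  lemma = solve-∀

-- On the left, choices of u among the sets {v,w,j}; on the right, signed choices of u + 1 of them,
-- or of u of them next to `∁ e`. The sign is the choice between {v,w,j} and its complement.
binom-ratio : ∀ q u → 2 * q * binom q u ≤ ternary q (δ (suc u)) + ternary q (δ u)
binom-ratio q u rewrite ternary-δ q (suc u) | ternary-δ q u with binom q u in eq
... | zero = ≤-trans (≤-reflexive (*-zeroʳ (2 * q))) z≤n
... | suc c = *-cancelˡ-≤ (suc u) (begin
  suc u * (2 * q * b₀) ≡⟨ cong (λ z → suc u * (2 * z * b₀)) (sym u+d) ⟩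
  suc u * (2 * (u + d) * b₀) ≡⟨ lemma₁ u d b₀ ⟩
  2 * (u + d) * suc u * b₀ ≤⟨ *-monoˡ-≤ b₀ (ternary-arith u d) ⟩
  2 ^ u * (2 * d + suc u) * b₀ ≡⟨ lemma₂ u d b₀ (2 ^ u) ⟩
  2 * 2 ^ u * (d * b₀) + suc u * (2 ^ u * b₀) ≡⟨ cong (λ z → 2 * 2 ^ u * z + suc u * (2 ^ u * b₀)) (sym absorb) ⟩
  2 * 2 ^ u * (suc u * binom q (suc u)) + suc u * (2 ^ u * b₀) ≡⟨ lemma₃ u (2 ^ u) (binom q (suc u)) b₀ ⟩
  suc u * (2 * 2 ^ u * binom q (suc u) + 2 ^ u * b₀) ∎)
  where
  open ≤-Reasoning
  b₀ = suc c
  id₀ : suc u * binom q (suc u) + u * b₀ ≡ q * b₀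
  id₀ = subst (λ z → suc u * binom q (suc u) + u * z ≡ q * z) eq (binom-absorb q u)
  u≤q : u ≤ q
  u≤q = *-cancelʳ-≤ u q b₀ (≤-trans (m≤n+m (u * b₀) _) (≤-reflexive id₀))
  d = q ∸ u
  u+d : u + d ≡ q
  u+d = m+[n∸m]≡n u≤q
  absorb : suc u * binom q (suc u) ≡ d * b₀
  absorb = +-cancelʳ-≡ (u * b₀) _ _ (trans id₀ (trans (cong (_* b₀) (sym u+d)) (trans (*-distribʳ-+ b₀ u d) (+-comm (u * b₀) (d * b₀)))))
  lemma₁ : ∀ u d c → suc u * (2 * (u + d) * c) ≡ 2 * (u + d) * suc u * c
  lemma₁ = solve-∀
  lemma₂ : ∀ u d c e → e * (2 * d + suc u) * c ≡ 2 * e * (d * c) + suc u * (e * c)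
  lemma₂ = solve-∀
  lemma₃ : ∀ u e b c → 2 * e * (suc u * b) + suc u * (e * c) ≡ suc u * (2 * e * b + e * c)
  lemma₃ = solve-∀

-- Removing one edge from a star

flat : List (Subset n) → List (Subset n)
flat [] = []
flat (a ∷ as) = a ∷ ∁ a ∷ flat as

data Choice {n : ℕ} : List (Subset n) → List (Subset n) → Set where
  [] : Choice [] []
  none : ∀ {a as Q} → Choice as Q → Choice (a ∷ as) Q
  plus : ∀ {a as Q} → Choice as Q → Choice (a ∷ as) (a ∷ Q)
  minus : ∀ {a as Q} → Choice as Q → Choice (a ∷ as) (∁ a ∷ Q)

-- Each word is one of the sublists of `flat as`. The sublists containing some a together with its
-- complement are dropped, hence only an inequality.
ternary-≤-SS : ∀ (as : List (Subset n)) g F → (∀ {Q} → Choice as Q → g (length Q) ≤ F Q) → ternary (length as) g ≤ SS (flat as) F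
ternary-≤-SS [] g F h = ≤-trans (h []) (≤-reflexive (sym (+-identityʳ _)))
ternary-≤-SS (a ∷ as) g F h rewrite SS-∷ a (∁ a ∷ flat as) F | SS-∷ (∁ a) (flat as) F | SS-∷ (∁ a) (flat as) (F ∘ (a ∷_))
  | +-identityʳ (ternary (length as) (g ∘ suc)) = begin
  ternary (length as) g + (ternary (length as) (g ∘ suc) + ternary (length as) (g ∘ suc))
    ≤⟨ +-mono-≤ (ternary-≤-SS as g F (λ c → h (none c)))
        (+-mono-≤ (ternary-≤-SS as (g ∘ suc) (F ∘ (∁ a ∷_)) (λ c → h (minus c)))
          (≤-trans (ternary-≤-SS as (g ∘ suc) (F ∘ (a ∷_)) (λ c → h (plus c))) (m≤m+n _ _))) ⟩
  SS (flat as) F + (SS (flat as) (F ∘ (∁ a ∷_)) + (SS (flat as) (F ∘ (a ∷_)) + _)) ≡⟨ sym (+-assoc (SS (flat as) F) _ _) ⟩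
  SS (flat as) F + SS (flat as) (F ∘ (∁ a ∷_)) + (SS (flat as) (F ∘ (a ∷_)) + _) ∎
  where open ≤-Reasoning

∈-flat⁻ : ∀ (as : List (Subset n)) {X} → X ∈ flat as → X ∈ as ⊎ (∃[ a ] a ∈ as × X ≡ ∁ a)
∈-flat⁻ (a ∷ as) (here p) = inj₁ (here p)
∈-flat⁻ (a ∷ as) (there (here p)) = inj₂ (a , here refl , p)
∈-flat⁻ (a ∷ as) (there (there p)) with ∈-flat⁻ as p
... | inj₁ q = inj₁ (there q)
... | inj₂ (b , q , e) = inj₂ (b , there q , e)

Choice-⊆ : ∀ {as Q : List (Subset n)} {X} → Choice as Q → X ∈ Q → X ∈ flat as
Choice-⊆ (none c) p = there (there (Choice-⊆ c p))
Choice-⊆ (plus c) (here p) = here p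
Choice-⊆ (plus c) (there p) = there (there (Choice-⊆ c p))
Choice-⊆ (minus c) (here p) = there (here p)
Choice-⊆ (minus c) (there p) = there (there (Choice-⊆ c p))

∈-Choice : ∀ {as Q : List (Subset n)} {X} → Choice as Q → X ∈ Q → X ∈ as ⊎ (∃[ a ] a ∈ as × X ≡ ∁ a)
∈-Choice c p = ∈-flat⁻ _ (Choice-⊆ c p)

filterᵇ-flat : ∀ (p : Subset n → Bool) as → (∀ {a} → a ∈ as → p a ≡ true × p (∁ a) ≡ false) →
  length (filterᵇ p (flat as)) ≡ length as
filterᵇ-flat p [] h = refl
filterᵇ-flat p (a ∷ as) h rewrite filterᵇ-∷ p a (∁ a ∷ flat as) | proj₁ (h (here refl))
  | filterᵇ-∷ p (∁ a) (flat as) | proj₂ (h (here refl)) = cong suc (filterᵇ-flat p as λ q → h (there q))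

flat-Unique : ∀ (as : List (Subset n)) → Unique as → (∀ {a b} → a ∈ as → b ∈ as → a ≢ ∁ b) → Unique (flat as)
flat-Unique [] u h = []
flat-Unique (a ∷ as) u h = Unique-∷ (Unique-∷ (flat-Unique as (Unique-tail u) λ p q → h (there p) (there q))
    λ p → f (∈-flat⁻ as p)) λ p → g p
  where
  f : ∁ a ∈ as ⊎ (∃[ b ] b ∈ as × ∁ a ≡ ∁ b) → ⊥
  f (inj₁ p) = h (there p) (here refl) refl
  f (inj₂ (b , p , e)) = Unique-head u (subst (_∈ as) (trans (sym (∁-∁ b)) (trans (cong ∁ (sym e)) (∁-∁ a))) p)
  g : a ∈ ∁ a ∷ flat as → ⊥
  g (here p) = h (here refl) (here refl) p
  g (there p) with ∈-flat⁻ as p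
  ... | inj₁ q = Unique-head u q
  ... | inj₂ (b , q , e) = h (here refl) (there q) e

∈-flat : ∀ {as : List (Subset n)} {a} → a ∈ as → a ∈ flat as × ∁ a ∈ flat as
∈-flat (here refl) = here refl , there (here refl)
∈-flat (there p) = there (there (proj₁ (∈-flat p))) , there (there (proj₂ (∈-flat p)))

Choice-exclusive : ∀ {as Q : List (Subset n)} → Choice as Q → Unique (flat as) → ∀ {a} → a ∈ as → a ∈ Q → ∁ a ∈ Q → ⊥
Choice-exclusive (none c) u (here refl) q r = Unique-head u (there (Choice-⊆ c q))
Choice-exclusive (plus c) u (here refl) q (here e) = Unique-head u (here (sym e))
Choice-exclusive (plus c) u (here refl) q (there r) = Unique-head (Unique-tail u) (Choice-⊆ c r)
Choice-exclusive (minus c) u (here refl) (here e) r = Unique-head u (here e)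
Choice-exclusive (minus c) u (here refl) (there q) r = Unique-head u (there (Choice-⊆ c q))
Choice-exclusive (none c) u (there p) q r = Choice-exclusive c (Unique-tail (Unique-tail u)) p q r
Choice-exclusive (plus c) u (there p) (here refl) r = Unique-head u (there (proj₁ (∈-flat p)))
Choice-exclusive {as = _ ∷ as} (plus c) u (there p) (there q) (here e) = Unique-head u (there (subst (_∈ flat as) e (proj₂ (∈-flat p))))
Choice-exclusive (plus c) u (there p) (there q) (there r) = Choice-exclusive c (Unique-tail (Unique-tail u)) p q r
Choice-exclusive {as = _ ∷ as} (minus c) u (there p) (here e) r = Unique-head (Unique-tail u) (subst (_∈ flat as) e (proj₁ (∈-flat p)))
Choice-exclusive {as = _ ∷ as} (minus c) u (there p) (there q) (here e) = Unique-head (Unique-tail u) (subst (_∈ flat as) e (proj₂ (∈-flat p)))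
Choice-exclusive (minus c) u (there p) (there q) (there r) = Choice-exclusive c (Unique-tail (Unique-tail u)) p q r

length-filterᵇ-map : ∀ (p : B → Bool) (f : A → B) xs → length (filterᵇ p (map f xs)) ≡ length (filterᵇ (p ∘ f) xs)
length-filterᵇ-map p f xs = trans (length-filter-∑ p (map f xs)) (trans (∑-map f xs (𝟙 ∘ p)) (sym (length-filter-∑ (p ∘ f) xs)))

-- Fix the sets other than ∁ e and the sets {v,w,j}, ∁ {v,w,j}, where e = {v,w} and j ranges over
-- the q points such that {v,j} is not in e ∷ H. An extension of e ∷ H may contain any of the sets
-- {v,w,j} and none of the others. If e is dropped then ∁ e and ∁ {v,w,j} become available.
module Ratio {n : ℕ} (7≤n : 7 ≤ n) (s : ℕ) {v w : Fin n} {H : List (Subset n)}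
  (st : Star v (⟦ v ∷ w ∷ [] ⟧ ∷ H)) (w≢v : w ≢ v) where
  open Star st

  e = ⟦ v ∷ w ∷ [] ⟧
  ce : ∣ e ∣ ≡ 2
  ce = edge (here refl)

  tri : Fin n → Subset n
  tri j = ⟦ v ∷ w ∷ j ∷ [] ⟧

  J : List (Fin n)
  J = filterᵇ (λ j → not (mem (e ∷ H) ⟦ v ∷ j ∷ [] ⟧)) (others v)

  as : List (Subset n)
  as = map tri J

  q = length J

  length-as : length as ≡ q
  length-as = length-map tri J

  -- Of the n - 1 spokes at v, |H| + 1 belong to the star, and the others correspond to `J`.
  q-count : q + suc (suc (length H)) ≡ n
  q-count = trans (trans (cong (λ z → q + suc z) count) (+-suc q _)) (trans (cong suc (+-comm q _)) (trans (cong suc (sym total)) (length-spokes v)))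
    where
    f₁ = filterᵇ (mem (e ∷ H)) (spokes v)
    count : suc (length H) ≡ length f₁
    count = sym (↭-length (Unique-⊆⊇ (filterᵇ-unique (mem (e ∷ H)) (Star.unique (spokes-Star v))) unique
      (λ p → mem⁻ (proj₂ (∈-filterᵇ⁻ (mem (e ∷ H)) (spokes v) p)))
      (λ p → ∈-filterᵇ⁺ (mem (e ∷ H)) (∈-spokes (edge p) (centre p)) (mem⁺ p))))
    total : length (spokes v) ≡ length f₁ + q
    total = trans (↭-length (filterᵇ-split (mem (e ∷ H)) (spokes v))) (trans (length-++ f₁)
      (cong (length f₁ +_) (length-filterᵇ-map (not ∘ mem (e ∷ H)) (λ j → ⟦ v ∷ j ∷ [] ⟧) (others v))))

  J-prop : ∀ {j} → j ∈ J → j ≢ v × ⟦ v ∷ j ∷ [] ⟧ ∉ e ∷ H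
  J-prop {j} p = let a , b = ∈-filterᵇ⁻ (λ j → not (mem (e ∷ H) ⟦ v ∷ j ∷ [] ⟧)) (others v) p in
    ∈-others⁻ a , λ r → true≢false (mem⁺ r) (not-true⁻ b)

  J-w : ∀ {j} → j ∈ J → j ≢ w
  J-w p refl = proj₂ (J-prop p) (here refl)

  a-card : ∀ {a} → a ∈ as → ∣ a ∣ ≡ 3
  a-card p with ∈-map⁻ tri p
  ... | j , j∈ , refl = card-⟦⟧ {us = v ∷ w ∷ j ∷ []} (Unique-3 (w≢v ∘ sym) (proj₁ (J-prop j∈) ∘ sym) (J-w j∈ ∘ sym))

  a-v : ∀ {a} → a ∈ as → a ∋ v
  a-v p with ∈-map⁻ tri p
  ... | j , j∈ , refl = ⟦⟧-∋ (here refl)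

  a-w : ∀ {a} → a ∈ as → a ∋ w
  a-w p with ∈-map⁻ tri p
  ... | j , j∈ , refl = ⟦⟧-∋ (there (here refl))

  as-Unique : Unique as
  as-Unique = Unique-map tri inj (filterᵇ-unique _ (filterᵇ-unique _ (allFin-Unique n)))
    where
    inj : ∀ {x y} → x ∈ J → y ∈ J → tri x ≡ tri y → x ≡ y
    inj {x} {y} x∈ y∈ eq with ⟦⟧-∋⁻ {us = v ∷ w ∷ y ∷ []} (subst (_∋ x) eq (⟦⟧-∋ {us = v ∷ w ∷ x ∷ []} (there (there (here refl)))))
    ... | here r = ⊥-elim (proj₁ (J-prop x∈) r)
    ... | there (here r) = ⊥-elim (J-w x∈ r)
    ... | there (there (here r)) = r

  ∁-v : ∀ X → X ∋ v → lookup (∁ X) v ≡ false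
  ∁-v X p = trans (∁-∋ X v) (cong not p)

  as-∁ : ∀ {a b} → a ∈ as → b ∈ as → a ≢ ∁ b
  as-∁ {b = b} p q refl = true≢false (a-v p) (∁-v b (a-v q))

  ∁-big : ∀ (X : Subset n) → ∣ X ∣ ≤ 3 → 3 ≤ ∣ ∁ X ∣
  ∁-big X c = +-cancelʳ-≤ (∣ X ∣) 3 (∣ ∁ X ∣) (≤-trans (+-monoʳ-≤ 3 c)
    (≤-trans (n≤1+n 6) (≤-trans 7≤n (≤-reflexive (sym (card-∁ X))))))

  Sp : List (Subset n)
  Sp = ∁ e ∷ flat as

  ∁-inj : ∀ {X Y : Subset n} → ∁ X ≡ ∁ Y → X ≡ Y
  ∁-inj {X} {Y} r = trans (sym (∁-∁ X)) (trans (cong ∁ r) (∁-∁ Y))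

  2≢3 : 2 ≢ 3
  2≢3 ()

  Sp-Unique : Unique Sp
  Sp-Unique = Unique-∷ (flat-Unique as as-Unique as-∁) λ p → f (∈-flat⁻ as p)
    where
    f : ∁ e ∈ as ⊎ (∃[ a ] a ∈ as × ∁ e ≡ ∁ a) → ⊥
    f (inj₁ p) = true≢false (a-v p) (∁-v e (centre (here refl)))
    f (inj₂ (a , p , r)) = 2≢3 (trans (sym ce) (trans (cong ∣_∣ (∁-inj r)) (a-card p)))

  Sp-Big : ∀ {X} → X ∈ Sp → X ∈ Big n
  Sp-Big (here refl) = ∈-Big (∁-big e (≤-trans (≤-reflexive ce) (n≤1+n 2)))
  Sp-Big (there p) with ∈-flat⁻ as p
  ... | inj₁ q = ∈-Big (≤-reflexive (sym (a-card q)))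
  ... | inj₂ (a , q , refl) = ∈-Big (∁-big a (≤-reflexive (a-card q)))

  abstract
    rest : List (Subset n)
    rest = proj₁ (Unique-extract Sp-Unique Sp-Big)

    Big-perm : Big n ↭ Sp ++ rest
    Big-perm = proj₂ (Unique-extract Sp-Unique Sp-Big)

  rest-Big : ∀ {X} → X ∈ rest → 3 ≤ ∣ X ∣
  rest-Big p = ∈-Big⁻ (∈-resp-↭ (↭-sym Big-perm) (∈-++⁺ʳ Sp p))

  rest-≢ : ∀ {X a} → X ∈ rest → a ∈ as → X ≢ a
  rest-≢ p q refl = Unique-++-disjoint Sp (Unique-↭ Big-perm (Big-Unique n)) (there (proj₁ (∈-flat q))) p

  -- The sum over `R` is put outside, because the two counts are compared for each fixed choice of
  -- the unaffected sets.
  decompose : ∀ F → Resp↭ F → SS (Big n) F ≡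
    SS rest (λ R → SS (flat as) (λ Q → F (Q ++ R)) + SS (flat as) (λ Q → F (∁ e ∷ Q ++ R)))
  decompose F r = trans (SS-↭ F r Big-perm) (trans (SS-∷ (∁ e) (flat as ++ rest) F)
    (trans (cong₂ _+_ (part F) (part (F ∘ (∁ e ∷_)))) (sym (∑-+ (sublists rest) _ _))))
    where
    part : ∀ F → SS (flat as ++ rest) F ≡ SS rest (λ R → SS (flat as) (λ Q → F (Q ++ R)))
    part F = trans (SS-++ (flat as) rest F) (∑-swap (sublists (flat as)) (sublists rest) (λ Q R → F (Q ++ R)))

  -- For fixed `R`: the selections of sets {v,w,j} that complete `e ∷ H` to size s, against the
  -- signed selections that complete `H`, without and with `∁ e`.
  lhsTerm rhsTerm : List (Subset n) → ℕ
  lhsTerm R = S q (λ t → 𝟙 ((suc (length H) + (t + length R)) ≡ᵇ s))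
  rhsTerm R = ternary q (λ t → 𝟙 ((length H + (t + length R)) ≡ᵇ s)) + ternary q (λ t → 𝟙 ((length H + suc (t + length R)) ≡ᵇ s))

  compatible : List (Subset n) → ℕ
  compatible R = 𝟙 (inter? (e ∷ H ++ R))

  -- `∁ e` and every ∁ {v,w,j} are disjoint from e, so only the sets {v,w,j}, those of `flat as`
  -- containing v, can accompany it.
  upper : extensions s (e ∷ H) ≤ SS rest (λ R → compatible R * lhsTerm R)
  upper = ≤-trans (≤-reflexive (decompose _ λ p → good-↭ (++⁺ˡ (e ∷ H) p))) (∑-mono (sublists rest) λ R R∈ → bound R)
    where
    bound : ∀ R → SS (flat as) (λ Q → 𝟙 (good s (e ∷ H ++ Q ++ R))) + SS (flat as) (λ Q → 𝟙 (good s (e ∷ H ++ ∁ e ∷ Q ++ R))) ≤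
      compatible R * lhsTerm R
    bound R = ≤-trans (≤-reflexive (trans (cong (SS (flat as) (λ Q → 𝟙 (good s (e ∷ H ++ Q ++ R))) +_)
        (∑-zero (sublists (flat as)) λ Q _ → cong 𝟙 (not-true λ g → second Q (proj₂ (good⁻ {s = s} g))))) (+-identityʳ _)))
      (≤-trans (∑-mono (sublists (flat as)) first) (≤-reflexive (trans (∑-* (sublists (flat as)) (compatible R) _)
        (cong (compatible R *_) (trans (SS-filter (λ X → lookup X v) (flat as) _) (trans (SS-length (filterᵇ (λ X → lookup X v) (flat as)) _)
          (cong (λ z → S z (λ t → 𝟙 ((suc (length H) + (t + length R)) ≡ᵇ s)))
            (trans (filterᵇ-flat (λ X → lookup X v) as λ {a} p → a-v p , ∁-v a (a-v p)) length-as))))))))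
      where
      second : ∀ Q → inter? (e ∷ H ++ ∁ e ∷ Q ++ R) ≡ true → ⊥
      second Q i with meets⁻ e (∁ e) (inter⁻ i (here refl) (there (∈-++⁺ʳ H (here refl))))
      ... | i , a , b = true≢false b (trans (∁-∋ e i) (cong not a))
      first : ∀ Q → Q ∈ sublists (flat as) → 𝟙 (good s (e ∷ H ++ Q ++ R)) ≤
        compatible R * (𝟙 (all (λ X → lookup X v) Q) * 𝟙 ((suc (length H) + (length Q + length R)) ≡ᵇ s))
      first Q Q∈ with good s (e ∷ H ++ Q ++ R) in g
      ... | false = z≤n
      ... | true = ≤-reflexive (sym (cong₂ _*_ (cong 𝟙 (inter-⊆ {K = e ∷ H ++ R} {L = e ∷ H ++ Q ++ R} keep (proj₂ (good⁻ {s = s} g))))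
          (cong₂ _*_ (cong 𝟙 (all-true (λ X → lookup X v) Q positive))
            (cong 𝟙 (≡ᵇ-true (trans (sym (trans (length-++ (e ∷ H)) (cong (suc (length H) +_) (length-++ Q)))) (proj₁ (good⁻ {s = s} g))))))))
        where
        keep : ∀ {X} → X ∈ e ∷ H ++ R → X ∈ e ∷ H ++ Q ++ R
        keep p with ∈-++⁻ (e ∷ H) p
        ... | inj₁ a = ∈-++⁺ˡ a
        ... | inj₂ b = ∈-++⁺ʳ (e ∷ H) (∈-++⁺ʳ Q b)
        positive : ∀ X → X ∈ Q → lookup X v ≡ true
        positive X X∈ with ∈-flat⁻ as (sub-∈ Q∈ X∈)
        ... | inj₁ p = a-v p
        ... | inj₂ (a , p , refl) = ⊥-elim (bad (meets-pair (∁ a) v w (trans (meets-comm (∁ a) e)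
              (inter⁻ (proj₂ (good⁻ {s = s} g)) (here refl) (∈-++⁺ʳ (e ∷ H) (∈-++⁺ˡ X∈))))))
          where
          bad : ∁ a ∋ v ⊎ ∁ a ∋ w → ⊥
          bad (inj₁ r) = true≢false r (∁-v a (a-v p))
          bad (inj₂ r) = true≢false r (trans (∁-∋ a w) (cong not (a-w p)))

  module Lower (R : List (Subset n)) (R∈ : R ∈ sublists rest) (int : inter? (e ∷ H ++ R) ≡ true)
               {Q : List (Subset n)} (ch : Choice as Q) where

    data Kind (X : Subset n) : Set where
      inH : X ∈ H → Kind X
      isC : X ≡ ∁ e → Kind X
      isA : X ∈ as → X ∈ Q → Kind X
      isB : ∀ a → a ∈ as → X ≡ ∁ a → X ∈ Q → Kind X
      inR : X ∈ R → Kind X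

    kind : ∀ {X} → X ∈ H ++ ∁ e ∷ Q ++ R → Kind X
    kind p with ∈-++⁻ H p
    ... | inj₁ q = inH q
    ... | inj₂ (here q) = isC q
    ... | inj₂ (there q) with ∈-++⁻ Q q
    ...   | inj₂ r = inR r
    ...   | inj₁ r with ∈-Choice ch r
    ...     | inj₁ a = isA a r
    ...     | inj₂ (a , a∈ , eq) = isB a a∈ eq r

    old : ∀ {X Y} → X ∈ e ∷ H ++ R → Y ∈ e ∷ H ++ R → meets X Y ≡ true
    old p q = inter⁻ int p q

    oldH : ∀ {X} → X ∈ H → X ∈ e ∷ H ++ R
    oldH p = there (∈-++⁺ˡ p)

    oldR : ∀ {X} → X ∈ R → X ∈ e ∷ H ++ R
    oldR p = there (∈-++⁺ʳ H p)

    Rrest : ∀ {X} → X ∈ R → X ∈ rest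
    Rrest = sub-∈ R∈

    -- Here the choice of `J` matters: an edge {v,u} of `H` has u ≠ w since it differs from e, and u
    -- ≠ j since {v,j} is not in the star. So u lies outside {v,w,j}.
    H-∁a : ∀ {X a} → X ∈ H → a ∈ as → meets X (∁ a) ≡ true
    H-∁a {X} {a} p r with ∈-map⁻ tri r
    ... | j , j∈ , refl with card-2-at X (edge (there p)) (centre (there p))
    ...   | u , u≢v , refl = meets⁺ X (∁ (tri j)) {u} (⟦⟧-∋ (there (here refl)))
            (trans (∁-∋ (tri j) u) (cong not (⟦⟧-∌ {us = v ∷ w ∷ j ∷ []} λ
              { (here x) → u≢v x
              ; (there (here refl)) → Unique-head unique p
              ; (there (there (here refl))) → proj₂ (J-prop j∈) (there p) })))

    small : ∀ {a} → a ∈ as → ∣ a ∣ ≤ 3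
    small p = ≤-reflexive (a-card p)

    e≤3 : ∣ e ∣ ≤ 3
    e≤3 = ≤-trans (≤-reflexive ce) (n≤1+n 2)

    both-co : ∀ X Y → ∣ X ∣ ≤ 3 → ∣ Y ∣ ≤ 3 → meets (∁ X) (∁ Y) ≡ true
    both-co X Y p q = meets-∁∁ X Y (≤-trans (s≤s (+-mono-≤ p q)) 7≤n)

    R-a : ∀ {X a} → X ∈ R → a ∈ as → meets X a ≡ true
    R-a {X} {a} p r with meets-pair X v w (old (oldR p) (here refl))
    ... | inj₁ x = meets⁺ X a x (a-v r)
    ... | inj₂ x = meets⁺ X a x (a-w r)

    H-C : ∀ {X} → X ∈ H → meets X (∁ e) ≡ true
    H-C {X} p = meets-∁ X e (≤-reflexive (trans ce (sym (edge (there p))))) λ { refl → Unique-head unique p }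

    A-C : ∀ {X} → X ∈ as → meets X (∁ e) ≡ true
    A-C {X} p = meets-∁ X e (≤-trans e≤3 (≤-reflexive (sym (a-card p)))) λ { refl → 2≢3 (trans (sym ce) (a-card p)) }

    R-C : ∀ {X} → X ∈ R → meets X (∁ e) ≡ true
    R-C {X} p = meets-∁ X e (≤-trans e≤3 (rest-Big (Rrest p))) λ { refl → <-irrefl refl (≤-trans (rest-Big (Rrest p)) (≤-reflexive ce)) }

    A-B : ∀ {X} → X ∈ as → X ∈ Q → ∀ a → a ∈ as → ∁ a ∈ Q → meets X (∁ a) ≡ true
    A-B {X} p q a a∈ r = meets-∁ X a (≤-reflexive (trans (a-card a∈) (sym (a-card p))))
      λ { refl → Choice-exclusive ch (flat-Unique as as-Unique as-∁) a∈ q r }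

    -- A set of size at least 3 can miss the complement of the 3-set a only by being a itself, and
    -- all these a have been separated from `rest`.
    R-B : ∀ {X} → X ∈ R → ∀ {a} → a ∈ as → meets X (∁ a) ≡ true
    R-B {X} p {a} a∈ = meets-∁ X a (≤-trans (small a∈) (rest-Big (Rrest p))) (rest-≢ (Rrest p) a∈)

    flip : ∀ {X Y : Subset n} → meets X Y ≡ true → meets Y X ≡ true
    flip {X} {Y} = trans (meets-comm Y X)

    kinds-meet : ∀ {X Y} → Kind X → Kind Y → meets X Y ≡ true
    kinds-meet (inH p) (inH q) = old (oldH p) (oldH q)
    kinds-meet (inH p) (isC refl) = H-C p
    kinds-meet {X} {Y} (inH p) (isA a _) = meets⁺ X Y (centre (there p)) (a-v a)
    kinds-meet (inH p) (isB a a∈ refl _) = H-∁a p a∈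
    kinds-meet (inH p) (inR q) = old (oldH p) (oldR q)
    kinds-meet (isC refl) (isC refl) = both-co e e e≤3 e≤3
    kinds-meet (isC refl) (isB a a∈ refl _) = both-co e a e≤3 (small a∈)
    kinds-meet {X} {Y} (isA a _) (isA b _) = meets⁺ X Y (a-v a) (a-v b)
    kinds-meet (isA p q) (isB a a∈ refl r) = A-B p q a a∈ r
    kinds-meet (isA p _) (isC refl) = A-C p
    kinds-meet (isB a a∈ refl _) (isB b b∈ refl _) = both-co a b (small a∈) (small b∈)
    kinds-meet (inR p) (inR q) = old (oldR p) (oldR q)
    kinds-meet (inR p) (isA a _) = R-a p a
    kinds-meet (inR p) (isB a a∈ refl _) = R-B p a∈
    kinds-meet (inR p) (isC refl) = R-C p
    kinds-meet {X} {Y} (isC refl) (inH p) = flip {Y} {X} (H-C p)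
    kinds-meet {X} {Y} (isA a _) (inH p) = meets⁺ X Y (a-v a) (centre (there p))
    kinds-meet {X} {Y} (isB a a∈ refl _) (inH p) = flip {Y} {X} (H-∁a p a∈)
    kinds-meet (inR q) (inH p) = old (oldR q) (oldH p)
    kinds-meet (isB a a∈ refl _) (isC refl) = both-co a e (small a∈) e≤3
    kinds-meet {X} {Y} (isB a a∈ refl r) (isA p q) = flip {Y} {X} (A-B p q a a∈ r)
    kinds-meet {X} {Y} (isC refl) (isA p _) = flip {Y} {X} (A-C p)
    kinds-meet {X} {Y} (isA a _) (inR p) = flip {Y} {X} (R-a p a)
    kinds-meet {X} {Y} (isB a a∈ refl _) (inR p) = flip {Y} {X} (R-B p a∈)
    kinds-meet {X} {Y} (isC refl) (inR p) = flip {Y} {X} (R-C p)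

    withC : inter? (H ++ ∁ e ∷ Q ++ R) ≡ true
    withC = inter⁺ λ X Y p q → kinds-meet (kind p) (kind q)

    withoutC : inter? (H ++ Q ++ R) ≡ true
    withoutC = inter-⊆ {L = H ++ ∁ e ∷ Q ++ R} (λ p → f (∈-++⁻ H p)) withC
      where
      f : ∀ {X} → X ∈ H ⊎ X ∈ Q ++ R → X ∈ H ++ ∁ e ∷ Q ++ R
      f (inj₁ p) = ∈-++⁺ˡ p
      f (inj₂ p) = ∈-++⁺ʳ H (there p)

  lower : SS rest (λ R → compatible R * rhsTerm R) ≤ extensions s H
  lower = ≤-trans (∑-mono (sublists rest) bound) (≤-reflexive (sym (decompose _ λ p → good-↭ (++⁺ˡ H p))))
    where
    bound : ∀ R → R ∈ sublists rest → compatible R * rhsTerm R ≤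
      SS (flat as) (λ Q → 𝟙 (good s (H ++ Q ++ R))) + SS (flat as) (λ Q → 𝟙 (good s (H ++ ∁ e ∷ Q ++ R)))
    bound R R∈ with inter? (e ∷ H ++ R) in int
    ... | false = z≤n
    ... | true = ≤-trans (≤-reflexive (+-identityʳ _)) (+-mono-≤
          (≤-trans (≤-reflexive (cong (λ z → ternary z (λ t → 𝟙 ((length H + (t + length R)) ≡ᵇ s))) (sym length-as))) (ternary-≤-SS as _ (λ Q → 𝟙 (good s (H ++ Q ++ R))) λ {Q} ch →
            𝟙-mono λ l → good⁺ (trans (trans (length-++ H) (cong (length H +_) (length-++ Q))) (≡ᵇ-true⁻ l)) (Lower.withoutC R R∈ int ch)))
          (≤-trans (≤-reflexive (cong (λ z → ternary z (λ t → 𝟙 ((length H + suc (t + length R)) ≡ᵇ s))) (sym length-as))) (ternary-≤-SS as _ (λ Q → 𝟙 (good s (H ++ ∁ e ∷ Q ++ R))) λ {Q} ch →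
            𝟙-mono λ l → good⁺ (trans (trans (length-++ H) (cong (λ z → length H + suc z) (length-++ Q))) (≡ᵇ-true⁻ l)) (Lower.withC R R∈ int ch))))

  term-ratio : ∀ R → 2 * q * lhsTerm R ≤ rhsTerm R
  term-ratio R with suc (length H) + length R ≤? s
  ... | no p = ≤-trans (≤-reflexive (trans (cong (2 * q *_) (S-zero q λ t → cong 𝟙 (not-true λ r →
        p (≤-trans (+-monoʳ-≤ (suc (length H)) (m≤n+m _ t)) (≤-reflexive (≡ᵇ-true⁻ r)))))) (*-zeroʳ (2 * q)))) z≤n
  ... | yes p = subst₂ _≤_ (cong (2 * q *_) (S-cong q λ t _ → cong 𝟙 (shift-≡ᵇ u (suc h) r t s su)))
        (cong₂ _+_ (ternary-cong q λ t → cong 𝟙 (shift-≡ᵇ (suc u) h r t s (trans (sym (lemma h r u)) su)))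
          (ternary-cong q λ t → cong 𝟙 (trans (shift-≡ᵇ u (suc h) r t s su) (cong (_≡ᵇ s) (sym (+-suc h (t + r)))))))
        (binom-ratio q u)
    where
    h = length H
    r = length R
    -- The number of sets {v,w,j} needed to complete `e ∷ H ++ R`. Without e it takes u + 1 signed
    -- sets, or u of them together with `∁ e`.
    u = s ∸ (suc h + r)
    su : suc h + r + u ≡ s
    su = m+[n∸m]≡n p
    lemma : ∀ h r u → suc h + r + u ≡ h + r + suc u
    lemma = solve-∀
    reorder : ∀ h r t → h + r + t ≡ h + (t + r)
    reorder = solve-∀
    shift-≡ᵇ : ∀ u h r t s → h + r + u ≡ s → (t ≡ᵇ u) ≡ ((h + (t + r)) ≡ᵇ s)
    shift-≡ᵇ u h r t s e = bool-ext
      (λ x → ≡ᵇ-true (trans (sym (reorder h r t)) (trans (cong (h + r +_) (≡ᵇ-true⁻ x)) e)))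
      (λ x → ≡ᵇ-true (+-cancelˡ-≡ (h + r) t u (trans (reorder h r t) (trans (≡ᵇ-true⁻ x) (sym e)))))

  ratio : 2 * q * extensions s (e ∷ H) ≤ extensions s H
  ratio = begin
    2 * q * extensions s (e ∷ H) ≤⟨ *-monoʳ-≤ (2 * q) upper ⟩
    2 * q * SS rest (λ R → compatible R * lhsTerm R) ≡⟨ sym (∑-* (sublists rest) (2 * q) _) ⟩
    SS rest (λ R → 2 * q * (compatible R * lhsTerm R)) ≤⟨ ∑-mono (sublists rest) (λ R _ →
      ≤-trans (≤-reflexive (lemma (2 * q) (compatible R) (lhsTerm R))) (*-monoʳ-≤ (compatible R) (term-ratio R))) ⟩
    SS rest (λ R → compatible R * rhsTerm R) ≤⟨ lower ⟩
    extensions s H ∎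
    where
    open ≤-Reasoning
    lemma : ∀ a b c → a * (b * c) ≡ b * (a * c)
    lemma = solve-∀

  -- ∁ e can always take the place of e.
  monotone : extensions s (e ∷ H) ≤ extensions s H
  monotone = ≤-trans upper (≤-trans (∑-mono (sublists rest) λ R _ → *-monoʳ-≤ (compatible R)
    (≤-trans (S≤ternary q _) (≤-trans (≤-reflexive (ternary-cong q λ t → cong (λ z → 𝟙 (z ≡ᵇ s)) (sym (+-suc (length H) (t + length R)))))
      (m≤n+m _ _)))) lower)

-- Numerical estimates

-- At q = 0, where the larger star uses every spoke, the first bound is void and the second one is
-- needed.
starExt-step : ∀ {s} (c : Fin n) → 7 ≤ n → ∀ k q → q + suc (suc k) ≡ n →
  2 * q * starExt c s (suc k) ≤ starExt c s k × starExt c s (suc k) ≤ starExt c s k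
starExt-step {n} {s} c 7≤n k q eq with List.take (suc k) (spokes c) in eqK | Star-take (suc k) (spokes-Star c)
  | length-take-spokes c {suc k} (≤-trans (m≤n+m _ q) (≤-reflexive eq))
... | X ∷ H | st | len with card-2-at X (Star.edge st (here refl)) (Star.centre st (here refl))
... | w , w≢c , refl = subst₂ (λ a b → 2 * q * a ≤ b) refl last
        (subst (λ z → 2 * z * extensions s (⟦ c ∷ w ∷ [] ⟧ ∷ H) ≤ extensions s H) q≡ R.ratio) ,
      subst (extensions s (⟦ c ∷ w ∷ [] ⟧ ∷ H) ≤_) last R.monotone
  where
  module R = Ratio 7≤n s st w≢c
  lenH : length H ≡ k
  lenH = suc-injective len
  last : extensions s H ≡ starExt c s k
  last = trans (extensions-starExt s c (Star-tail st)) (cong (starExt c s) lenH)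
  q≡ : R.q ≡ q
  q≡ = +-cancelʳ-≡ (suc (suc k)) R.q q (trans (trans (cong (λ z → R.q + suc (suc z)) (sym lenH)) R.q-count) (sym eq))

starExt-pos : ∀ {s} (c : Fin n) {k} → 5 ≤ n → suc k ≤ n → k ≤ s → s ≤ 2 ^ (n ∸ 1) → 0 < starExt c s k
starExt-pos {s = s} c {k} 5≤n k<n k≤s s≤ = Star-extensions-pos 5≤n (Star-take k (spokes-Star c))
  (≤-trans (≤-reflexive (length-take-spokes c k<n)) k≤s) s≤

-- The increments of d ↦ `S d h` are `S d (h ∘ suc)` and do not decrease, so this function is
-- convex. Starting from 0, after d steps it is at most d times the next increment.
S-tangent : ∀ d h → h 0 ≡ 0 → S d h ≤ d * S d (h ∘ suc)
S-tangent zero h h0 = ≤-reflexive h0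
S-tangent (suc d) h h0 = begin
  S d h + S d (h ∘ suc) ≤⟨ +-monoˡ-≤ _ (S-tangent d h h0) ⟩
  d * S d (h ∘ suc) + S d (h ∘ suc) ≡⟨ +-comm (d * S d (h ∘ suc)) _ ⟩
  suc d * S d (h ∘ suc) ≤⟨ *-monoʳ-≤ (suc d) (S-≤ d (h ∘ suc)) ⟩
  suc d * S (suc d) (h ∘ suc) ∎
  where open ≤-Reasoning

S-chord-suc : ∀ d h → h 0 ≡ 0 → suc d * S d h ≤ d * S (suc d) h
S-chord-suc d h h0 = begin
  S d h + d * S d h ≤⟨ +-monoˡ-≤ _ (S-tangent d h h0) ⟩
  d * S d (h ∘ suc) + d * S d h ≡⟨ +-comm (d * S d (h ∘ suc)) _ ⟩
  d * S d h + d * S d (h ∘ suc) ≡⟨ sym (*-distribˡ-+ d _ _) ⟩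
  d * S (suc d) h ∎
  where open ≤-Reasoning

-- The slope of the line from the origin to the point over d grows with d; `S-chord-suc` compares
-- consecutive slopes.
S-chord : ∀ h → h 0 ≡ 0 → ∀ {d L} → d ≤′ L → L * S d h ≤ d * S L h
S-chord h h0 {d} ≤′-refl = ≤-refl
S-chord h h0 {zero} (≤′-step {L} p) rewrite h0 = ≤-trans (≤-reflexive (*-zeroʳ (suc L))) z≤n
S-chord h h0 {suc d} (≤′-step {zero} (≤′-reflexive ()))
S-chord h h0 {suc d} (≤′-step {suc L} p) = *-cancelˡ-≤ (suc L) (begin
  suc L * (suc (suc L) * S (suc d) h) ≡⟨ lemma (suc L) (suc (suc L)) (S (suc d) h) ⟩
  suc (suc L) * (suc L * S (suc d) h) ≤⟨ *-monoʳ-≤ (suc (suc L)) (S-chord h h0 p) ⟩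
  suc (suc L) * (suc d * S (suc L) h) ≡⟨ lemma (suc (suc L)) (suc d) (S (suc L) h) ⟩
  suc d * (suc (suc L) * S (suc L) h) ≤⟨ *-monoʳ-≤ (suc d) (S-chord-suc (suc L) h h0) ⟩
  suc d * (suc L * S (suc (suc L)) h) ≡⟨ lemma (suc d) (suc L) (S (suc (suc L)) h) ⟩
  suc L * (suc d * S (suc (suc L)) h) ∎)
  where
  open ≤-Reasoning
  lemma : ∀ a b c → a * (b * c) ≡ b * (a * c)
  lemma = solve-∀

-- The excess of L * S (L + 1) h over (L + 1) * S L h, where L = suc M.
S-excess : ∀ M h → h 0 ≡ 0 → h 1 ≡ 0 → h 2 ≡ 0 →
  3 * (suc M * S (suc M) (h ∘ suc)) ≤ 3 * S (suc M) h + suc M * suc (suc M) * S M (λ k → h (suc (suc k)))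
S-excess zero h h0 h1 h2 rewrite h1 | h2 = z≤n
S-excess (suc M) h h0 h1 h2 = begin
  3 * (suc L * (s₁ + s₂)) ≡⟨ lemma₁ L s₁ s₂ ⟩
  3 * (L * s₁) + 3 * s₁ + 3 * (suc L * s₂) ≤⟨ +-monoˡ-≤ (3 * (suc L * s₂)) (+-monoˡ-≤ (3 * s₁) (S-excess M h h0 h1 h2)) ⟩
  3 * s₀ + L * suc L * S M u + 3 * s₁ + 3 * (suc L * s₂)
    ≡⟨ lemma₂ s₀ s₁ (suc L) L (S M u) s₂ ⟩
  -- The chord bound applies to `u` because its value at 0 is `h 2`, which vanishes. It supplies the
  -- growth from L (L + 1) to (L + 1)(L + 2).
  3 * (s₀ + s₁) + suc L * (L * S M u) + 3 * (suc L * s₂)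
    ≤⟨ +-monoˡ-≤ (3 * (suc L * s₂)) (+-monoʳ-≤ (3 * (s₀ + s₁)) (*-monoʳ-≤ (suc L) (S-chord-suc M u h2))) ⟩
  3 * (s₀ + s₁) + suc L * (M * s₂) + 3 * (suc L * s₂) ≡⟨ lemma₃ (s₀ + s₁) M s₂ ⟩
  3 * (s₀ + s₁) + suc L * suc (suc L) * s₂ ∎
  where
  open ≤-Reasoning
  L = suc M
  u = λ k → h (suc (suc k))
  s₀ = S L h
  s₁ = S L (h ∘ suc)
  s₂ = S L u
  lemma₁ : ∀ L a b → 3 * (suc L * (a + b)) ≡ 3 * (L * a) + 3 * a + 3 * (suc L * b)
  lemma₁ = solve-∀
  lemma₂ : ∀ a b k L x c → 3 * a + L * k * x + 3 * b + 3 * (k * c) ≡ 3 * (a + b) + k * (L * x) + 3 * (k * c)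
  lemma₂ = solve-∀
  lemma₃ : ∀ a M c → 3 * a + suc (suc M) * (M * c) + 3 * (suc (suc M) * c) ≡ 3 * a + suc (suc M) * suc (suc (suc M)) * c
  lemma₃ = solve-∀

range : ℕ → ℕ → List ℕ
range i zero = []
range i (suc m) = i ∷ range (suc i) m

S-∑ : ∀ d (js : List A) (F : A → ℕ → ℕ) → S d (λ k → ∑ js (λ j → F j k)) ≡ ∑ js (λ j → S d (F j))
S-∑ d [] F = S-zero d λ _ → refl
S-∑ d (j ∷ js) F = trans (S-+ d (F j) _) (cong (S d (F j) +_) (S-∑ d js F))

∑-range-below : ∀ (g : ℕ → ℕ) m {i k} → k < i → ∑ (range i m) (λ j → g j * 𝟙 (k ≡ᵇ j)) ≡ 0
∑-range-below g zero lt = refl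
∑-range-below g (suc m) {i} {k} lt with k ≡ᵇ i in eq
... | true = ⊥-elim (<-irrefl (≡ᵇ-true⁻ eq) lt)
... | false rewrite *-zeroʳ (g i) = ∑-range-below g m (m≤n⇒m≤1+n lt)

∑-range-δ : ∀ (g : ℕ → ℕ) m {i k} → i ≤ k → k < i + m → ∑ (range i m) (λ j → g j * 𝟙 (k ≡ᵇ j)) ≡ g k
∑-range-δ g zero {i} p q = ⊥-elim (<-irrefl refl (≤-trans q (≤-trans (≤-reflexive (+-identityʳ i)) p)))
∑-range-δ g (suc m) {i} {k} p q with k ≡ᵇ i in eq
... | true rewrite ≡ᵇ-true⁻ {k} eq | ∑-range-below g m {suc i} {i} ≤-refl = trans (+-identityʳ _) (*-identityʳ (g i))
... | false rewrite *-zeroʳ (g i) = ∑-range-δ g m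
      (≤∧≢⇒< p λ e → true≢false (≡ᵇ-true (sym e)) eq) (≤-trans q (≤-reflexive (+-suc i m)))

S-binom : ∀ d g → S d g ≡ ∑ (range 0 (suc d)) (λ j → g j * binom d j)
S-binom d g = trans (S-cong d λ k p → sym (∑-range-δ g (suc d) z≤n (s≤s p)))
  (trans (S-∑ d (range 0 (suc d)) (λ j k → g j * 𝟙 (k ≡ᵇ j)))
    (∑-cong (range 0 (suc d)) λ j _ → S-* d (g j) (δ j)))

binom-0 : ∀ q → binom q 0 ≡ 1
binom-0 zero = refl
binom-0 (suc q) = trans (binom-suc-0 q) (binom-0 q)

binom-step : ∀ {N} j d → j + d ≡ N → suc j * binom N (suc j) ≡ d * binom N j
binom-step {N} j d e = +-cancelʳ-≡ (j * binom N j) _ _ (trans (binom-absorb N j)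
  (trans (cong (_* binom N j) (trans (sym e) (+-comm j d))) (*-distribʳ-+ (binom N j) d j)))

-- The difference of the two sides is M² - 13 M - 6, which is positive from M = 14 on; at M = 14 + r
-- it equals 8 + 15 r + r².
quadratic : ∀ M → 14 ≤ M → (11 * M + 3) * suc (suc M) < 12 * suc M * M
quadratic M p = subst (λ M → (11 * M + 3) * suc (suc M) < 12 * suc M * M) (m+[n∸m]≡n p) (shifted (M ∸ 14))
  where
  shifted : ∀ r → (11 * (14 + r) + 3) * suc (suc (14 + r)) < 12 * suc (14 + r) * (14 + r)
  shifted r = ≤-trans (m≤m+n _ (7 + 15 * r + r * r)) (≤-reflexive (lemma r))
    where
    lemma : ∀ r → suc ((11 * (14 + r) + 3) * suc (suc (14 + r))) + (7 + 15 * r + r * r) ≡ 12 * suc (14 + r) * (14 + r)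
    lemma = solve-∀

tail-identity1 : ∀ d → suc (suc d) + d ≡ 2 * suc d
tail-identity1 = solve-∀

tail-identity2 : ∀ a b c → a * (b * c) ≡ b * (a * c)
tail-identity2 = solve-∀

tail-identity3 : ∀ a b c → a * (b * c) ≡ b * a * c
tail-identity3 = solve-∀

tail-identity4 : ∀ a b c → 4 * a * (b * c) ≡ 2 * a * b * (2 * c)
tail-identity4 = solve-∀

tail-identity5 : ∀ a b c → a * (b * c) ≡ b * (a * c)
tail-identity5 = solve-∀

tail-identity6 : ∀ a b x y → 16 * a * b * (x + y) ≡ 2 * a * (8 * b * x + 4 * b * (2 * y))
tail-identity6 = solve-∀

tail-identity7 : ∀ a b → 4 * a * (3 * b) ≡ 3 * (4 * a * b)
tail-identity7 = solve-∀

tail-identity8 : ∀ m x → 2 * suc m * (8 * m * x + 3 * (suc m * x)) ≡ (11 * m + 3) * (2 * suc m * x)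
tail-identity8 = solve-∀

tail-identity9 : ∀ a b x → 12 * a * b * x ≡ 4 * a * b * (3 * x)
tail-identity9 = solve-∀

tail-identity10 : ∀ a b x → 4 * a * b * (4 * x) ≡ 16 * a * b * x
tail-identity10 = solve-∀

-- Used with b(j) = C(N,j), N = n - 3 and h(j) = g(j + 2). The sum over j ≥ 1 of h(j) b(j) then
-- measures the gain from a vertex of full degree.
module Tail (M : ℕ) (14≤M : 14 ≤ M) (b h : ℕ → ℕ) (b-0 : b 0 ≡ 1)
  (b-step : ∀ j d → j + d ≡ suc (suc M) → suc j * b (suc j) ≡ d * b j) where
  N : ℕ
  N = suc (suc M)

  term : ℕ → ℕ
  term j = h j * b j

  module _ (ratio : ∀ j q → q + suc j ≡ N → 2 * q * h (suc j) ≤ h j)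
           (mono : ∀ j → suc j ≤ N → h (suc j) ≤ h j) where

    -- A weakening of the ratio bound, as d + 2 ≤ 2 (d + 1), whose factor N - j cancels the one in
    -- (j + 1) C(N,j + 1) = (N - j) C(N,j). The last index is left to monotonicity.
    step : ∀ j d → j + suc d ≡ N → suc d * h (suc j) ≤ h j
    step j zero e = ≤-trans (≤-reflexive (+-identityʳ _)) (mono j (≤-trans (≤-reflexive (+-comm 1 j)) (≤-reflexive e)))
    step j (suc d) e = ≤-trans (*-monoˡ-≤ (h (suc j)) (≤-trans (m≤m+n (suc (suc d)) d) (≤-reflexive (tail-identity1 d))))
      (ratio j (suc d) (trans (+-comm (suc d) (suc j)) (trans (sym (+-suc j (suc d))) e)))

    term-step : ∀ j → suc j ≤ N → suc j * term (suc j) ≤ term j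
    term-step j p = begin
      suc j * (h (suc j) * b (suc j)) ≡⟨ tail-identity2 (suc j) (h (suc j)) (b (suc j)) ⟩
      h (suc j) * (suc j * b (suc j)) ≡⟨ cong (h (suc j) *_) (b-step j (suc d) e) ⟩
      h (suc j) * (suc d * b j) ≡⟨ tail-identity3 (h (suc j)) (suc d) (b j) ⟩
      suc d * h (suc j) * b j ≤⟨ *-monoˡ-≤ (b j) (step j d e) ⟩
      h j * b j ∎
      where
      open ≤-Reasoning
      d = N ∸ suc j
      e : j + suc d ≡ N
      e = trans (+-suc j d) (m+[n∸m]≡n p)

    -- From index 2 on, each term is at most a third of the previous one, and the geometric series
    -- contributes the factor 3/2.
    tail : ∀ m i → 2 ≤ i → i + m ≤ suc N → 2 * ∑ (range i m) term ≤ 3 * term i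
    tail zero i p q = z≤n
    tail (suc zero) i p q = ≤-trans (≤-reflexive (cong (2 *_) (+-identityʳ (term i)))) (m≤n+m _ (term i))
    tail (suc (suc m)) i p q = begin
      2 * (term i + ∑ (range (suc i) (suc m)) term) ≡⟨ *-distribˡ-+ 2 (term i) _ ⟩
      2 * term i + 2 * ∑ (range (suc i) (suc m)) term ≤⟨ +-monoʳ-≤ (2 * term i)
        (tail (suc m) (suc i) (m≤n⇒m≤1+n p) (≤-trans (≤-reflexive (sym (+-suc i (suc m)))) q)) ⟩
      2 * term i + 3 * term (suc i) ≤⟨ +-monoʳ-≤ (2 * term i) (≤-trans (*-monoˡ-≤ (term (suc i)) (s≤s p))
        (term-step i (≤-pred (≤-trans (≤-trans (≤-reflexive (+-comm 2 i)) (+-monoʳ-≤ i (s≤s (s≤s z≤n)))) q)))) ⟩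
      2 * term i + term i ≡⟨ +-comm (2 * term i) (term i) ⟩
      3 * term i ∎
      where open ≤-Reasoning

    -- Up to lower-order terms, T₁ is at most h(0)/2 and T₂ at most T₁/4. With the factor 3/2 for
    -- the tail this gives W ≤ (1/2 + 3/16) h(0) = 11/16 h(0), below 12/16 h(0); `quadratic` takes
    -- care of the lower-order terms.
    W-bound : 0 < h 0 → 4 * ∑ (range 1 N) term < 3 * h 0
    W-bound h0 = ≰⇒> λ bad → contra bad
      where
      open ≤-Reasoning
      W = ∑ (range 1 N) term
      T₁ = term 1
      T₂ = term 2
      rest = ∑ (range 2 (suc M)) term
      restT₂ : 2 * rest ≤ 3 * T₂
      restT₂ = tail (suc M) 2 ≤-refl ≤-refl
      binom₁ : b 1 ≡ N
      binom₁ = trans (sym (+-identityʳ _)) (trans (b-step 0 N refl) (trans (cong (N *_) (b-0)) (*-identityʳ N)))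
      T₁-bound : 2 * (suc M) * T₁ ≤ N * h 0
      T₁-bound = begin
        2 * (suc M) * (h 1 * b 1) ≡⟨ cong (λ z → 2 * (suc M) * (h 1 * z)) binom₁ ⟩
        2 * (suc M) * (h 1 * N) ≡⟨ sym (*-assoc (2 * (suc M)) (h 1) N) ⟩
        2 * (suc M) * h 1 * N ≤⟨ *-monoˡ-≤ N (ratio 0 (suc M) (+-comm (suc M) 1)) ⟩
        h 0 * N ≡⟨ *-comm (h 0) N ⟩
        N * h 0 ∎
      T₂-bound : 4 * M * T₂ ≤ (suc M) * T₁
      T₂-bound = begin
        4 * M * (h 2 * b 2) ≡⟨ tail-identity4 M (h 2) (b 2) ⟩
        2 * M * h 2 * (2 * b 2) ≡⟨ cong (2 * M * h 2 *_) (b-step 1 (suc M) refl) ⟩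
        2 * M * h 2 * ((suc M) * b 1) ≤⟨ *-monoˡ-≤ _ (ratio 1 M (+-comm M 2)) ⟩
        h 1 * ((suc M) * b 1) ≡⟨ tail-identity5 (h 1) (suc M) (b 1) ⟩
        (suc M) * T₁ ∎
      main : 16 * suc M * M * W ≤ (11 * M + 3) * (N * h 0)
      main = begin
        16 * suc M * M * (T₁ + rest) ≡⟨ tail-identity6 (suc M) M T₁ rest ⟩
        2 * (suc M) * (8 * M * T₁ + 4 * M * (2 * rest))
          ≤⟨ *-monoʳ-≤ (2 * (suc M)) (+-monoʳ-≤ (8 * M * T₁) (*-monoʳ-≤ (4 * M) restT₂)) ⟩
        2 * (suc M) * (8 * M * T₁ + 4 * M * (3 * T₂)) ≡⟨ cong (λ z → 2 * (suc M) * (8 * M * T₁ + z)) (tail-identity7 M T₂) ⟩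
        2 * (suc M) * (8 * M * T₁ + 3 * (4 * M * T₂))
          ≤⟨ *-monoʳ-≤ (2 * (suc M)) (+-monoʳ-≤ (8 * M * T₁) (*-monoʳ-≤ 3 T₂-bound)) ⟩
        2 * (suc M) * (8 * M * T₁ + 3 * ((suc M) * T₁)) ≡⟨ tail-identity8 M T₁ ⟩
        (11 * M + 3) * (2 * (suc M) * T₁) ≤⟨ *-monoʳ-≤ (11 * M + 3) T₁-bound ⟩
        (11 * M + 3) * (N * h 0) ∎
      contra : 3 * h 0 ≤ 4 * W → ⊥
      contra bad = <-irrefl refl (begin-strict
        (11 * M + 3) * (N * h 0) ≡⟨ sym (*-assoc (11 * M + 3) N (h 0)) ⟩
        (11 * M + 3) * N * h 0 <⟨ *-monoˡ-< (h 0) ⦃ >-nonZero h0 ⦄ (quadratic M 14≤M) ⟩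
        12 * suc M * M * h 0 ≡⟨ tail-identity9 (suc M) M (h 0) ⟩
        4 * suc M * M * (3 * h 0) ≤⟨ *-monoʳ-≤ (4 * suc M * M) bad ⟩
        4 * suc M * M * (4 * W) ≡⟨ tail-identity10 (suc M) M W ⟩
        16 * suc M * M * W ≤⟨ main ⟩
        (11 * M + 3) * (N * h 0) ∎)

-- Counting by the 2-sets of an intersecting family

at : Fin n → List (Subset n) → List (Subset n)
at v = filterᵇ (λ X → lookup X v)

off : Fin n → List (Subset n) → List (Subset n)
off v = filterᵇ (λ X → not (lookup X v))

deg : List (Subset n) → Fin n → ℕ
deg G v = ∑ G λ X → 𝟙 (lookup X v)

deg-at : ∀ (G : List (Subset n)) v → length (at v G) ≡ deg G v
deg-at G v = length-filter-∑ (λ X → lookup X v) G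

deg-off : ∀ (G : List (Subset n)) v → deg G v + length (off v G) ≡ length G
deg-off G v = trans (cong (_+ length (off v G)) (sym (deg-at G v)))
  (sym (trans (↭-length (filterᵇ-split (λ X → lookup X v) G)) (length-++ (at v G))))

deg-≡-length : ∀ (P : List (Subset n)) v → (∀ {X} → X ∈ P → X ∋ v) → deg P v ≡ length P
deg-≡-length P v h = trans (∑-cong P λ X X∈ → cong 𝟙 (h X∈)) (sym (length-∑ P))

deg-≡-0 : ∀ (P : List (Subset n)) v → (∀ {X} → X ∈ P → lookup X v ≡ false) → deg P v ≡ 0
deg-≡-0 P v h = ∑-zero P λ X X∈ → cong 𝟙 (h X∈)

star? : Fin n → List (Subset n) → Bool
star? v H = all (λ X → lookup X v) H

anyFin : (Fin n → Bool) → Bool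
anyFin p = not (all (not ∘ p) (allFin _))

anyFin⁺ : ∀ (p : Fin n → Bool) {v} → p v ≡ true → anyFin p ≡ true
anyFin⁺ p {v} pv with all (not ∘ p) (allFin _) in eq
... | false = refl
... | true = ⊥-elim (true≢false pv (not-true⁻ (all-true⁻ (not ∘ p) (allFin _) eq (∈-Fin v))))

-- For a graph this recognises exactly the triangles, since an intersecting family of 2-sets is a
-- star or a triangle.
triangle? : List (Subset n) → Bool
triangle? H = inter? H ∧ not (anyFin λ v → star? v H)

sub-≡ : ∀ {xs H K : List (Subset n)} → Unique xs → H ∈ sublists xs → K ∈ sublists xs →
  (∀ {X} → X ∈ H → X ∈ K) → (∀ {X} → X ∈ K → X ∈ H) → H ≡ K
sub-≡ {xs = xs} u h k p q = trans (sym (filterᵇ-mem u h)) (trans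
  (filterᵇ-cong xs λ X _ → bool-ext (λ r → mem⁺ (p (mem⁻ r))) (λ r → mem⁺ (q (mem⁻ r)))) (filterᵇ-mem u k))

triangle-no-centre : ∀ {a b c : Fin n} → a ≢ b → a ≢ c → b ≢ c → ∀ {v} → (∀ {X} → X ∈ triangle a b c → X ∋ v) → ⊥
triangle-no-centre {a = a} {b} {c} p q r {v} h with ⟦⟧-∋⁻ {us = a ∷ b ∷ []} (h (here refl))
  | ⟦⟧-∋⁻ {us = a ∷ c ∷ []} (h (there (here refl))) | ⟦⟧-∋⁻ {us = b ∷ c ∷ []} (h (there (there (here refl))))
... | here refl | _ | here e = p e
... | here refl | _ | there (here e) = q e
... | there (here refl) | here e | _ = p (sym e)
... | there (here refl) | there (here e) | _ = r e

deg-↭ : ∀ {H K : List (Subset n)} → H ↭ K → ∀ v → deg H v ≡ deg K v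
deg-↭ p v = ∑-↭ _ p

triangle-deg : ∀ {a b c : Fin n} → a ≢ b → a ≢ c → b ≢ c →
  ∑ (allFin n) (λ v → 𝟙 (deg (triangle a b c) v ≡ᵇ 2)) ≡ 3
triangle-deg {n} {a} {b} {c} p q r = trans (∑-cong (allFin n) λ v _ → lemma v)
  (trans (sym (card-∑ ⟦ a ∷ b ∷ c ∷ [] ⟧)) (card-⟦⟧ {us = a ∷ b ∷ c ∷ []} (Unique-3 p q r)))
  where
  yes-in : ∀ {us : List (Fin n)} {v} → v ∈ us → lookup ⟦ us ⟧ v ≡ true
  yes-in = ⟦⟧-∋
  out₂ : ∀ {x y v : Fin n} → v ≢ x → v ≢ y → lookup ⟦ x ∷ y ∷ [] ⟧ v ≡ false
  out₂ {x} {y} s t = ⟦⟧-∌ {us = x ∷ y ∷ []} λ { (here e) → s e ; (there (here e)) → t e }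
  lemma : ∀ v → 𝟙 (deg (triangle a b c) v ≡ᵇ 2) ≡ 𝟙 (lookup ⟦ a ∷ b ∷ c ∷ [] ⟧ v)
  lemma v with v ≟F a | v ≟F b | v ≟F c
  ... | yes refl | _ | _ rewrite yes-in {v ∷ b ∷ []} {v} (here refl) | yes-in {v ∷ c ∷ []} {v} (here refl)
        | out₂ {b} {c} p q | yes-in {v ∷ b ∷ c ∷ []} {v} (here refl) = refl
  ... | no s | yes refl | _ rewrite yes-in {a ∷ v ∷ []} {v} (there (here refl)) | out₂ {a} {c} s r
        | yes-in {v ∷ c ∷ []} {v} (here refl) | yes-in {a ∷ v ∷ c ∷ []} {v} (there (here refl)) = refl
  ... | no s | no t | yes refl rewrite out₂ {a} {b} s t | yes-in {a ∷ v ∷ []} {v} (there (here refl))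
        | yes-in {b ∷ v ∷ []} {v} (there (here refl)) | yes-in {a ∷ b ∷ v ∷ []} {v} (there (there (here refl))) = refl
  ... | no s | no t | no u rewrite out₂ {a} {b} s t | out₂ {a} {c} s u | out₂ {b} {c} t u
        | ⟦⟧-∌ {us = a ∷ b ∷ c ∷ []} {v} (λ { (here e) → s e ; (there (here e)) → t e ; (there (there (here e))) → u e }) = refl

record Graph (E : List (Subset n)) : Set where
  field
    unique : Unique E
    edge : ∀ {X} → X ∈ E → ∣ X ∣ ≡ 2

Edges-Graph : ∀ (A : Family n) → Graph (Edges A)
Edges-Graph A = record { unique = Edges-Unique A ; edge = λ p → proj₁ (∈-Edges⁻ {A = A} p) }

sub-Graph : ∀ {E H : List (Subset n)} → Graph E → H ∈ sublists E → Graph H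
sub-Graph g p = record { unique = sub-Unique (Graph.unique g) p ; edge = λ q → Graph.edge g (sub-∈ p q) }

at-star : ∀ {E : List (Subset n)} {v H} → Graph E → H ∈ sublists (at v E) → Star v H
at-star {E = E} {v} g p = record
  { unique = sub-Unique (filterᵇ-unique _ (Graph.unique g)) p
  ; edge = λ q → Graph.edge g (proj₁ (∈-filterᵇ⁻ (λ X → lookup X v) E (sub-∈ p q)))
  ; centre = λ q → proj₂ (∈-filterᵇ⁻ (λ X → lookup X v) E (sub-∈ p q)) }

triangle-true : ∀ (c : Fin n) {H} → Graph H → triangle? H ≡ true → Triangle H
triangle-true c {H} g t with classify c H (Graph.unique g) (Graph.edge g) (proj₁ (∧-true t))
... | inj₂ tri = tri
... | inj₁ (v , st) = ⊥-elim (true≢false (anyFin⁺ (λ v → star? v H) (all-true (λ X → lookup X v) H λ X p → Star.centre st p))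
      (not-true⁻ (proj₂ (∧-true {inter? H} t))))

Triangle-length : ∀ {H : List (Subset n)} → Triangle H → length H ≡ 3
Triangle-length (_ , _ , _ , _ , _ , _ , p) = ↭-length p

centre-unique : ∀ {u v : Fin n} {H} → Graph H → 2 ≤ length H → star? u H ≡ true → star? v H ≡ true → u ≡ v
centre-unique {u = u} {v} {[]} g () p q
centre-unique {u = u} {v} {X ∷ []} g (s≤s ()) p q
centre-unique {u = u} {v} {H@(X ∷ Y ∷ _)} g _ p q with u ≟F v
... | yes e = e
... | no u≢v = ⊥-elim (Unique-head (Graph.unique g) (here (trans (eq (here refl)) (sym (eq (there (here refl)))))))
  where
  eq : ∀ {Z} → Z ∈ H → Z ≡ ⟦ u ∷ v ∷ [] ⟧
  eq {Z} r = pair-≡ Z (Graph.edge g r) (all-true⁻ (λ X → lookup X u) H p r) (all-true⁻ (λ X → lookup X v) H q r) u≢v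

module Formula {n : ℕ} (c : Fin n) (s : ℕ) where

  g : ℕ → ℕ
  g = starExt c s

  -- A star with at least two edges has a unique centre and can be counted there. A single edge has
  -- two centres and the empty star n of them, so these are counted globally.
  g≤1 g≥2 : ℕ → ℕ
  g≤1 k = 𝟙 (k ≤ᵇ 1) * g k
  g≥2 k = 𝟙 (2 ≤ᵇ k) * g k

  module _ (1≤n : 1 ≤ n) where

    κ : ℕ
    κ = completions s 3 (2 ^ (n ∸ 1) ∸ 3)

    triangle-κ : ∀ {H} → Triangle H → extensions s H ≡ κ
    triangle-κ t with Triangle-extensions s 1≤n t
    ... | m , e , eq = trans eq (cong (completions s 3) (trans (sym (m+n∸m≡n 3 m)) (cong (_∸ 3) e)))

    -- Everything is tripled so that a triangle can be counted at each of its three corners, its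
    -- vertices of degree 2. All but the first term thus become sums over vertices, to be bounded
    -- through degrees.
    pointwise : ∀ {H} → Graph H → 3 * extensions s H ≡
      3 * (𝟙 (length H ≤ᵇ 1) * extensions s H) +
      3 * ∑ (allFin n) (λ v → 𝟙 (star? v H) * (𝟙 (2 ≤ᵇ length H) * extensions s H)) +
      κ * ∑ (allFin n) (λ v → 𝟙 (triangle? H) * 𝟙 (deg H v ≡ᵇ 2))
    pointwise {H} gr with inter? H in int
    ... | false rewrite extensions-0 s int = sym (trans (cong₂ (λ a b → 3 * a + 3 * b + κ * ∑ (allFin n) (λ _ → 0)) (*-zeroʳ (𝟙 (length H ≤ᵇ 1)))
          (∑-zero (allFin n) λ v _ → trans (cong (𝟙 (star? v H) *_) (*-zeroʳ (𝟙 (2 ≤ᵇ length H)))) (*-zeroʳ (𝟙 (star? v H)))))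
          (trans (cong (κ *_) (∑-zero (allFin n) λ v _ → refl)) (*-zeroʳ κ)))
    ... | true with classify c H (Graph.unique gr) (Graph.edge gr) int
    ...   | inj₁ (u , st) = starCase
      where
      su : star? u H ≡ true
      su = all-true (λ X → lookup X u) H λ X p → Star.centre st p
      noTri : ∑ (allFin n) (λ v → 𝟙 (not (anyFin λ v → star? v H)) * 𝟙 (deg H v ≡ᵇ 2)) ≡ 0
      noTri rewrite anyFin⁺ (λ v → star? v H) su = ∑-zero (allFin n) λ _ _ → refl
      f = extensions s H
      starCase : 3 * f ≡ 3 * (𝟙 (length H ≤ᵇ 1) * f) +
        3 * ∑ (allFin n) (λ v → 𝟙 (star? v H) * (𝟙 (2 ≤ᵇ length H) * f)) +
        κ * ∑ (allFin n) (λ v → 𝟙 (not (anyFin λ v → star? v H)) * 𝟙 (deg H v ≡ᵇ 2))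
      starCase rewrite noTri | *-zeroʳ κ with 2 ≤? length H
      ... | yes p rewrite ≤ᵇ-true p | not-true {length H ≤ᵇ 1} (λ q → <-irrefl refl (≤-trans p (≤ᵇ-true⁻ q))) =
            sym (trans (+-identityʳ _) (cong (3 *_) (trans (trans (∑-cong (allFin n) λ v _ → *-comm (𝟙 (star? v H)) _)
              (∑-* (allFin n) (1 * f) (λ v → 𝟙 (star? v H))))
              (trans (cong (1 * f *_) (∑-𝟙≡1 (allFin-Unique n) (λ v → star? v H) (λ _ _ → centre-unique gr p) (∈-Fin u) su))
                (trans (*-identityʳ _) (*-identityˡ f))))))
      ... | no p rewrite not-true {2 ≤ᵇ length H} (λ q → p (≤ᵇ-true⁻ q)) | ≤ᵇ-true (≤-pred (≰⇒> p))
            | ∑-zero (allFin n) {λ v → 𝟙 (star? v H) * 0} (λ v _ → *-zeroʳ (𝟙 (star? v H))) =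
            sym (trans (+-identityʳ _) (trans (+-identityʳ _) (cong (3 *_) (*-identityˡ f))))
    ...   | inj₂ t@(a , b , d , a≢b , a≢d , b≢d , perm) = triCase
      where
      f = extensions s H
      noStar : ∀ v → star? v H ≡ false
      noStar v = not-true λ sv → triangle-no-centre a≢b a≢d b≢d {v} λ X∈ → all-true⁻ (λ X → lookup X v) H sv (∈-resp-↭ (↭-sym perm) X∈)
      noAny : anyFin (λ v → star? v H) ≡ false
      noAny with all (λ v → not (star? v H)) (allFin n) | all-true (λ v → not (star? v H)) (allFin n) (λ v _ → cong not (noStar v))
      ... | true | _ = refl
      triCase : 3 * f ≡ 3 * (𝟙 (length H ≤ᵇ 1) * f) +
        3 * ∑ (allFin n) (λ v → 𝟙 (star? v H) * (𝟙 (2 ≤ᵇ length H) * f)) +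
        κ * ∑ (allFin n) (λ v → 𝟙 (not (anyFin λ v → star? v H)) * 𝟙 (deg H v ≡ᵇ 2))
      triCase rewrite noAny | Triangle-length t | triangle-κ t
        | ∑-zero (allFin n) {λ v → 𝟙 (star? v H) * (κ + 0)} (λ v _ → cong (λ z → 𝟙 z * (κ + 0)) (noStar v))
        | trans (∑-cong (allFin n) λ v _ → trans (+-identityʳ _) (cong (λ z → 𝟙 (z ≡ᵇ 2)) (deg-↭ perm v))) (triangle-deg a≢b a≢d b≢d)
        = *-comm 3 κ

    -- The number of triangles in E with a corner at v.
    τ : List (Subset n) → Fin n → ℕ
    τ E v = SS E λ H → 𝟙 (triangle? H) * 𝟙 (deg H v ≡ᵇ 2)

    formula : ∀ {E} → Graph E → 3 * SS E (extensions s) ≡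
      3 * S (length E) g≤1 + 3 * ∑ (allFin n) (λ v → S (deg E v) g≥2) + κ * ∑ (allFin n) (τ E)
    formula {E} gr = trans (sym (∑-* (sublists E) 3 (extensions s)))
      (trans (∑-cong (sublists E) λ H H∈ → pointwise (sub-Graph gr H∈))
      (trans (∑-+ (sublists E) _ _) (cong₂ _+_
        (trans (∑-+ (sublists E) _ _) (cong₂ _+_
          (trans (∑-* (sublists E) 3 _) (cong (3 *_) part₁))
          (trans (∑-* (sublists E) 3 _) (cong (3 *_) part₂))))
        (trans (∑-* (sublists E) κ _) (cong (κ *_) (∑-swap (sublists E) (allFin n) _))))))
      where
      part₁ : SS E (λ H → 𝟙 (length H ≤ᵇ 1) * extensions s H) ≡ S (length E) g≤1
      part₁ = trans (∑-cong (sublists E) λ H H∈ → pt H (sub-Graph gr H∈)) (SS-length E g≤1)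
        where
        short : ∀ H → Graph H → (length H ≤ᵇ 1) ≡ true → ∃[ v ] Star v H
        short [] gr _ = c , record { unique = [] ; edge = λ () ; centre = λ () }
        short (X ∷ []) gr _ with card-2 X (Graph.edge gr (here refl))
        ... | a , b , _ , refl = a , record { unique = Graph.unique gr ; edge = Graph.edge gr ; centre = λ { (here refl) → ⟦⟧-∋ (here refl) } }
        pt : ∀ H → Graph H → 𝟙 (length H ≤ᵇ 1) * extensions s H ≡ g≤1 (length H)
        pt H gr with length H ≤ᵇ 1 in eq
        ... | false = refl
        ... | true = cong (1 *_) (extensions-starExt s c (proj₂ (short H gr eq)))
      part₂ : SS E (λ H → ∑ (allFin n) (λ v → 𝟙 (star? v H) * (𝟙 (2 ≤ᵇ length H) * extensions s H))) ≡
        ∑ (allFin n) (λ v → S (deg E v) g≥2)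
      part₂ = trans (∑-swap (sublists E) (allFin n) _) (∑-cong (allFin n) λ v _ →
        trans (SS-filter (λ X → lookup X v) E (λ H → 𝟙 (2 ≤ᵇ length H) * extensions s H))
        (trans (∑-cong (sublists (at v E)) λ H H∈ → cong (𝟙 (2 ≤ᵇ length H) *_) (extensions-starExt s c (at-star gr H∈)))
        (trans (SS-length (at v E) g≥2) (cong (λ z → S z g≥2) (deg-at E v)))))

extensions-≤-star : ∀ s (c : Fin n) → 5 ≤ n → ∀ {H} → Graph H → suc (length H) ≤ n → extensions s H ≤ starExt c s (length H)
extensions-≤-star {n} s c 5≤n {H} gr lt with inter? H in int
... | false rewrite extensions-0 s int = z≤n
... | true with classify c H (Graph.unique gr) (Graph.edge gr) int
...   | inj₁ (v , st) = ≤-reflexive (extensions-starExt s c st)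
...   | inj₂ t = Triangle-≤-Star s 5≤n t (Star-take (length H) (spokes-Star c))
        (trans (length-take-spokes c lt) (Triangle-length t))

-- Triangles through a vertex

star?-↭ : ∀ (v : Fin n) {H K} → H ↭ K → star? v H ≡ star? v K
star?-↭ v p = bool-ext (f p) (f (↭-sym p))
  where
  f : ∀ {H K} → H ↭ K → star? v H ≡ true → star? v K ≡ true
  f {H} {K} p h = all-true (λ X → lookup X v) K λ X X∈ → all-true⁻ (λ X → lookup X v) H h (∈-resp-↭ (↭-sym p) X∈)

anyFin-cong : ∀ {p q : Fin n → Bool} → (∀ v → p v ≡ q v) → anyFin p ≡ anyFin q
anyFin-cong {p = p} {q} h = cong not (bool-ext
  (λ r → all-true (not ∘ q) (allFin _) λ v v∈ → trans (cong not (sym (h v))) (all-true⁻ (not ∘ p) (allFin _) r v∈))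
  (λ r → all-true (not ∘ p) (allFin _) λ v v∈ → trans (cong not (h v)) (all-true⁻ (not ∘ q) (allFin _) r v∈)))

triangle?-↭ : ∀ {H K : List (Subset n)} → H ↭ K → triangle? H ≡ triangle? K
triangle?-↭ p = cong₂ _∧_
  (bool-ext (inter-⊆ (∈-resp-↭ (↭-sym p))) (inter-⊆ (∈-resp-↭ p)))
  (cong not (anyFin-cong λ v → star?-↭ v p))

triangle?-triangle : ∀ {a b c : Fin n} → a ≢ b → a ≢ c → b ≢ c → triangle? (triangle a b c) ≡ true
triangle?-triangle {a = a} {b} {c} p q r = ∧-intro
  (inter⁺ λ X Y X∈ Y∈ → majority-int a b c X Y (maj X∈) (maj Y∈))
  (cong not (cong not (all-true _ (allFin _) λ v _ → cong not (not-true λ sv →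
    triangle-no-centre p q r {v} λ X∈ → all-true⁻ (λ X → lookup X v) (triangle a b c) sv X∈))))
  where
  maj : ∀ {X} → X ∈ triangle a b c → majority a b c X ≡ true
  maj (here refl) rewrite ⟦⟧-∋ {us = a ∷ b ∷ []} {a} (here refl) | ⟦⟧-∋ {us = a ∷ b ∷ []} {b} (there (here refl)) = refl
  maj (there (here refl)) rewrite ⟦⟧-∋ {us = a ∷ c ∷ []} {a} (here refl) | ⟦⟧-∋ {us = a ∷ c ∷ []} {c} (there (here refl))
    with lookup ⟦ a ∷ c ∷ [] ⟧ b
  ... | true = refl
  ... | false = refl
  maj (there (there (here refl))) rewrite ⟦⟧-∋ {us = b ∷ c ∷ []} {b} (here refl) | ⟦⟧-∋ {us = b ∷ c ∷ []} {c} (there (here refl))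
    with lookup ⟦ b ∷ c ∷ [] ⟧ a
  ... | true = refl
  ... | false = refl

Unique-⊆-length : ∀ {xs ys : List A} → Unique xs → (∀ {x} → x ∈ xs → x ∈ ys) → length ys ≤ length xs →
  ∀ {x} → x ∈ ys → x ∈ xs
Unique-⊆-length {xs = xs} u s le x∈ with Unique-extract u s
... | [] , p = subst (_ ∈_) (++-identityʳ xs) (∈-resp-↭ p x∈)
... | z ∷ zs , p = ⊥-elim (<-irrefl refl (≤-trans (s≤s (m≤m+n (length xs) (length zs)))
      (≤-trans (≤-reflexive (sym (trans (↭-length p) (trans (length-++ xs) (+-suc _ _))))) le)))

singleton-∈-sublists : ∀ {xs : List A} {z} → z ∈ xs → z ∷ [] ∈ sublists xs
singleton-∈-sublists {xs = x ∷ xs} (here refl) = ∈-++⁺ʳ (sublists xs) (∈-map⁺ (x ∷_) (empty xs))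
  where
  empty : ∀ (xs : List _) → [] ∈ sublists xs
  empty [] = here refl
  empty (x ∷ xs) = ∈-++⁺ˡ (empty xs)
singleton-∈-sublists {xs = x ∷ xs} (there p) = ∈-++⁺ˡ (singleton-∈-sublists p)

binom-1 : ∀ q → binom q 1 ≡ q
binom-1 q = trans (sym (trans (+-identityʳ (1 * binom q 1)) (*-identityˡ (binom q 1)))) (trans (binom-absorb q 0) (trans (cong (q *_) (binom-0 q)) (*-identityʳ q)))

binom-2 : ∀ q → 2 * binom q 2 + q ≡ q * q
binom-2 q = trans (cong (2 * binom q 2 +_) (sym (trans (*-identityˡ (binom q 1)) (binom-1 q))))
  (trans (binom-absorb q 1) (cong (q *_) (binom-1 q)))

length-1 : ∀ (xs : List A) → length xs ≡ 1 → ∃[ z ] xs ≡ z ∷ []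
length-1 (z ∷ []) _ = z , refl

module Corners {n : ℕ} (c : Fin n) (s : ℕ) (1≤n : 1 ≤ n) {E : List (Subset n)} (gr : Graph E) (v : Fin n) where
  open Formula c s
  open Graph gr

  F : List (Subset n) → ℕ
  F H = 𝟙 (triangle? H) * 𝟙 (deg H v ≡ᵇ 2)

  at-∋ : ∀ {P} → P ∈ sublists (at v E) → ∀ {X} → X ∈ P → X ∋ v
  at-∋ p q = proj₂ (∈-filterᵇ⁻ (λ X → lookup X v) E (sub-∈ p q))

  off-∌ : ∀ {Q} → Q ∈ sublists (off v E) → ∀ {X} → X ∈ Q → lookup X v ≡ false
  off-∌ p q = not-true⁻ (proj₂ (∈-filterᵇ⁻ (λ X → not (lookup X v)) E (sub-∈ p q)))

  at-E : ∀ {P} → P ∈ sublists (at v E) → ∀ {X} → X ∈ P → X ∈ E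
  at-E p q = proj₁ (∈-filterᵇ⁻ (λ X → lookup X v) E (sub-∈ p q))

  off-E : ∀ {Q} → Q ∈ sublists (off v E) → ∀ {X} → X ∈ Q → X ∈ E
  off-E p q = proj₁ (∈-filterᵇ⁻ (λ X → not (lookup X v)) E (sub-∈ p q))

  F-split : ∀ {P Q} → P ∈ sublists (at v E) → Q ∈ sublists (off v E) → F (P ++ Q) ≡ 𝟙 (length P ≡ᵇ 2) * 𝟙 (triangle? (P ++ Q))
  F-split {P} {Q} p q = trans (cong (λ z → 𝟙 (triangle? (P ++ Q)) * 𝟙 (z ≡ᵇ 2)) (trans (∑-++ P Q _)
    (trans (cong₂ _+_ (deg-≡-length P v (at-∋ p)) (deg-≡-0 Q v (off-∌ q))) (+-identityʳ _)))) (*-comm (𝟙 (triangle? (P ++ Q))) _)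

  τ-split : τ 1≤n E v ≡ SS (at v E) (λ P → 𝟙 (length P ≡ᵇ 2) * SS (off v E) (λ Q → 𝟙 (triangle? (P ++ Q))))
  τ-split = trans (SS-↭ F (λ p → cong₂ (λ a b → 𝟙 a * 𝟙 (b ≡ᵇ 2)) (triangle?-↭ p) (deg-↭ p v)) (filterᵇ-split (λ X → lookup X v) E))
    (trans (SS-++ (at v E) (off v E) F) (∑-cong (sublists (at v E)) λ P p →
      trans (∑-cong (sublists (off v E)) λ Q q → F-split p q) (∑-* (sublists (off v E)) (𝟙 (length P ≡ᵇ 2)) _)))

  off-Unique : Unique (off v E)
  off-Unique = filterᵇ-unique _ unique

  at-Unique : Unique (at v E)
  at-Unique = filterᵇ-unique _ unique

  joint : ∀ {P Q} → P ∈ sublists (at v E) → Q ∈ sublists (off v E) → Graph (P ++ Q)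
  joint {P} {Q} p q = record
    { unique = Uniq.++⁺ (sub-Unique at-Unique p) (sub-Unique off-Unique q) λ (a , b) → true≢false (at-∋ p a) (off-∌ q b)
    ; edge = λ r → f (∈-++⁻ P r) }
    where
    f : ∀ {X} → X ∈ P ⊎ X ∈ Q → ∣ X ∣ ≡ 2
    f (inj₁ r) = edge (at-E p r)
    f (inj₂ r) = edge (off-E q r)

  tri-length : ∀ {P Q} → P ∈ sublists (at v E) → Q ∈ sublists (off v E) → triangle? (P ++ Q) ≡ true → length P + length Q ≡ 3
  tri-length {P} p q t = trans (sym (length-++ P)) (Triangle-length (triangle-true c (joint p q) t))

  third : ∀ {P} → P ∈ sublists (at v E) → length P ≡ 2 →
    ∃[ x ] ∃[ y ] x ≢ y × P ≡ ⟦ v ∷ x ∷ [] ⟧ ∷ ⟦ v ∷ y ∷ [] ⟧ ∷ [] × x ≢ v × y ≢ v ×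
      (∀ {Q} → Q ∈ sublists (off v E) → triangle? (P ++ Q) ≡ true → Q ≡ ⟦ x ∷ y ∷ [] ⟧ ∷ [])
  third {p₁ ∷ p₂ ∷ []} p refl with card-2-at p₁ (edge (at-E p (here refl))) (at-∋ p (here refl))
     | card-2-at p₂ (edge (at-E p (there (here refl)))) (at-∋ p (there (here refl)))
  ... | x , x≢v , refl | y , y≢v , refl = x , y , x≢y , refl , x≢v , y≢v , λ {Q} q t → f Q q t
    where
    x≢y : x ≢ y
    x≢y refl = Unique-head (sub-Unique at-Unique p) (here refl)
    f : ∀ Q → Q ∈ sublists (off v E) → triangle? (⟦ v ∷ x ∷ [] ⟧ ∷ ⟦ v ∷ y ∷ [] ⟧ ∷ Q) ≡ true → Q ≡ ⟦ x ∷ y ∷ [] ⟧ ∷ []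
    f [] q t with tri-length p q t
    ... | ()
    f (_ ∷ _ ∷ _) q t with tri-length p q t
    ... | ()
    f (z ∷ []) q t = cong (_∷ []) (pair-≡ z (edge (off-E q (here refl)))
          (meet x (here refl)) (meet y (there (here refl))) x≢y)
      where
      int = proj₁ (∧-true t)
      meet : ∀ w → ⟦ v ∷ w ∷ [] ⟧ ∈ ⟦ v ∷ x ∷ [] ⟧ ∷ ⟦ v ∷ y ∷ [] ⟧ ∷ z ∷ [] → z ∋ w
      meet w r with meets-pair z v w (inter⁻ int (there (there (here refl))) r)
      ... | inj₁ e = ⊥-elim (true≢false e (off-∌ q (here refl)))
      ... | inj₂ e = e

  -- The two edges at v determine the third side.
  τ≤binom : τ 1≤n E v ≤ binom (deg E v) 2
  τ≤binom = ≤-trans (≤-reflexive τ-split) (≤-trans (∑-mono (sublists (at v E)) le)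
    (≤-reflexive (trans (SS-length (at v E) (δ 2)) (cong (λ z → binom z 2) (deg-at E v)))))
    where
    le : ∀ P → P ∈ sublists (at v E) → 𝟙 (length P ≡ᵇ 2) * SS (off v E) (λ Q → 𝟙 (triangle? (P ++ Q))) ≤ 𝟙 (length P ≡ᵇ 2)
    le P p with length P ≡ᵇ 2 in len
    ... | false = z≤n
    ... | true with third p (≡ᵇ-true⁻ len)
    ...   | x , y , _ , _ , _ , _ , H = ≤-trans (≤-reflexive (+-identityʳ _)) (∑-𝟙≤1 (sublists-Unique off-Unique) (λ Q → triangle? (P ++ Q))
            λ q q' t t' → trans (H q t) (sym (H q' t')))

  -- The side opposite v determines the two edges at v. At a vertex of full degree in part (b) this
  -- is a better bound than the number of pairs of edges at v.
  τ≤off : τ 1≤n E v ≤ length (off v E)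
  τ≤off = ≤-trans (≤-reflexive (trans (SS-↭ F (λ p → cong₂ (λ a b → 𝟙 a * 𝟙 (b ≡ᵇ 2)) (triangle?-↭ p) (deg-↭ p v)) (filterᵇ-split (λ X → lookup X v) E))
      (trans (SS-++ (at v E) (off v E) F) (trans (∑-cong (sublists (at v E)) λ P p → ∑-cong (sublists (off v E)) λ Q q → F-split p q)
        (∑-swap (sublists (at v E)) (sublists (off v E)) _)))))
    (≤-trans (∑-mono (sublists (off v E)) le) (≤-reflexive (trans (SS-length (off v E) (δ 1)) (binom-1 _))))
    where
    le : ∀ Q → Q ∈ sublists (off v E) → SS (at v E) (λ P → 𝟙 (length P ≡ᵇ 2) * 𝟙 (triangle? (P ++ Q))) ≤ 𝟙 (length Q ≡ᵇ 1)
    le Q q with length Q ≡ᵇ 1 in len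
    ... | false = ≤-reflexive (∑-zero (sublists (at v E)) λ P p → zero-term P p)
      where
      zero-term : ∀ P → P ∈ sublists (at v E) → 𝟙 (length P ≡ᵇ 2) * 𝟙 (triangle? (P ++ Q)) ≡ 0
      zero-term P p with length P ≡ᵇ 2 in lp | triangle? (P ++ Q) in t
      ... | false | _ = refl
      ... | true | false = refl
      ... | true | true = ⊥-elim (true≢false (≡ᵇ-true (+-cancelˡ-≡ 2 (length Q) 1
            (trans (cong (_+ length Q) (sym (≡ᵇ-true⁻ {length P} lp))) (tri-length p q t)))) len)
    ... | true = ≤-trans (≤-reflexive (∑-cong (sublists (at v E)) λ P _ → sym (𝟙-∧ (length P ≡ᵇ 2) (triangle? (P ++ Q)))))
          (∑-𝟙≤1 (sublists-Unique at-Unique) (λ P → (length P ≡ᵇ 2) ∧ triangle? (P ++ Q)) λ {P} {P'} p p' t t' →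
            sub-≡ at-Unique p p'
              (λ X∈ → back p' t' (forth p t X∈)) (λ X∈ → back p t (forth p' t' X∈)))
      where
      z∃ : ∃[ z ] Q ≡ z ∷ []
      z∃ = length-1 Q (≡ᵇ-true⁻ {length Q} len)
      z = proj₁ z∃
      z∈Q : z ∈ Q
      z∈Q = subst (z ∈_) (sym (proj₂ z∃)) (here refl)
      pq = card-2 z (edge (off-E q z∈Q))
      x = proj₁ pq
      y = proj₁ (proj₂ pq)
      z≡ : z ≡ ⟦ x ∷ y ∷ [] ⟧
      z≡ = proj₂ (proj₂ (proj₂ pq))
      ends = ⟦ v ∷ x ∷ [] ⟧ ∷ ⟦ v ∷ y ∷ [] ⟧ ∷ []
      v≢ : ∀ {w} → z ∋ w → v ≢ w
      v≢ p refl = true≢false p (off-∌ q z∈Q)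
      zx : z ∋ x
      zx = subst (_∋ x) (sym z≡) (⟦⟧-∋ (here refl))
      zy : z ∋ y
      zy = subst (_∋ y) (sym z≡) (⟦⟧-∋ (there (here refl)))
      forth : ∀ {P} → P ∈ sublists (at v E) → (length P ≡ᵇ 2) ∧ triangle? (P ++ Q) ≡ true → ∀ {X} → X ∈ P → X ∈ ends
      forth {P} p t {X} X∈ with meets-pair X x y (subst (λ Z → meets X Z ≡ true) z≡
          (inter⁻ (proj₁ (∧-true (proj₂ (∧-true {length P ≡ᵇ 2} t)))) (∈-++⁺ˡ X∈) (∈-++⁺ʳ P z∈Q)))
      ... | inj₁ e = here (pair-≡ X (edge (at-E p X∈)) (at-∋ p X∈) e (v≢ zx))
      ... | inj₂ e = there (here (pair-≡ X (edge (at-E p X∈)) (at-∋ p X∈) e (v≢ zy)))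
      back : ∀ {P} → P ∈ sublists (at v E) → (length P ≡ᵇ 2) ∧ triangle? (P ++ Q) ≡ true → ∀ {X} → X ∈ ends → X ∈ P
      back {P} p t = Unique-⊆-length (sub-Unique at-Unique p) (forth p t)
        (≤-reflexive (sym (≡ᵇ-true⁻ (proj₁ (∧-true t)))))

  τ≥binom : (∀ {x y} → x ≢ y → x ≢ v → y ≢ v → ⟦ v ∷ x ∷ [] ⟧ ∈ E → ⟦ v ∷ y ∷ [] ⟧ ∈ E → ⟦ x ∷ y ∷ [] ⟧ ∈ E) →
    binom (deg E v) 2 ≤ τ 1≤n E v
  τ≥binom closed = ≤-trans (≤-reflexive (sym (trans (SS-length (at v E) (δ 2)) (cong (λ z → binom z 2) (deg-at E v)))))
    (≤-trans (∑-mono (sublists (at v E)) le) (≤-reflexive (sym τ-split)))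
    where
    le : ∀ P → P ∈ sublists (at v E) → 𝟙 (length P ≡ᵇ 2) ≤ 𝟙 (length P ≡ᵇ 2) * SS (off v E) (λ Q → 𝟙 (triangle? (P ++ Q)))
    le P p with length P ≡ᵇ 2 in len
    ... | false = z≤n
    ... | true with third p (≡ᵇ-true⁻ len)
    ...   | x , y , x≢y , refl , x≢v , y≢v , _ = ≤-trans (≤-trans (≤-reflexive (cong 𝟙 (sym (triangle?-triangle (x≢v ∘ sym) (y≢v ∘ sym) x≢y))))
            (∑-∈ (sublists (off v E)) (λ Q → 𝟙 (triangle? (P ++ Q))) (singleton-∈-sublists
              (∈-filterᵇ⁺ (λ X → not (lookup X v)) (closed x≢y x≢v y≢v (at-E p (here refl)) (at-E p (there (here refl))))
                (cong not (⟦⟧-∌ {us = x ∷ y ∷ []} λ { (here e) → x≢v (sym e) ; (there (here e)) → y≢v (sym e) }))))))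
          (≤-reflexive (sym (+-identityʳ _)))

-- Degrees

module Degrees {n : ℕ} {G : List (Subset n)} (gr : Graph G) where
  open Graph gr

  m : ℕ
  m = length G

  x : Fin n → ℕ
  x = deg G

  card-edge : ∀ {e} → e ∈ G → ∑ (allFin n) (λ v → 𝟙 (lookup e v)) ≡ 2
  card-edge {e} p = trans (sym (card-∑ e)) (edge p)

  handshake : ∑ (allFin n) x ≡ 2 * m
  handshake = trans (∑-swap (allFin n) G (λ v e → 𝟙 (lookup e v)))
    (trans (∑-cong G λ e p → card-edge p) (trans (∑-const G 2) (*-comm m 2)))

  codegree : Fin n → Fin n → ℕ
  codegree u v = ∑ G λ e → 𝟙 (lookup e u) * 𝟙 (lookup e v)

  codegree≤1 : ∀ u v → u ≢ v → codegree u v ≤ 1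
  codegree≤1 u v u≢v = ≤-trans (≤-reflexive (∑-cong G λ e _ → sym (𝟙-∧ (lookup e u) (lookup e v))))
    (∑-𝟙≤1 unique (λ e → lookup e u ∧ lookup e v) λ {a} {b} a∈ b∈ p q →
      trans (f a a∈ p) (sym (f b b∈ q)))
    where
    f : ∀ a → a ∈ G → lookup a u ∧ lookup a v ≡ true → a ≡ ⟦ u ∷ v ∷ [] ⟧
    f a a∈ p = pair-≡ a (edge a∈) (proj₁ (∧-true p)) (proj₂ (∧-true {lookup a u} p)) u≢v

  codegree≤deg : ∀ u v → codegree u v ≤ x v
  codegree≤deg u v = ∑-mono G λ e _ → ≤-trans (*-monoˡ-≤ (𝟙 (lookup e v)) (𝟙≤1 (lookup e u))) (≤-reflexive (*-identityˡ _))

  codegree-self : ∀ v → codegree v v ≡ x v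
  codegree-self v = ∑-cong G λ e _ → idem (lookup e v)
    where
    idem : ∀ b → 𝟙 b * 𝟙 b ≡ 𝟙 b
    idem true = refl
    idem false = refl

  -- Pairs are ordered, so two disjoint edges contribute 2.
  disjoint : ℕ
  disjoint = ∑ G λ e → ∑ G λ e' → 𝟙 (not (meets e e'))

  intersection : ∀ {e e'} → e ∈ G → e' ∈ G →
    ∑ (allFin n) (λ v → 𝟙 (lookup e v) * 𝟙 (lookup e' v)) + 𝟙 (not (meets e e')) ≡ 1 + 𝟙 (e == e')
  intersection {e} {e'} p q with e ≟S e'
  ... | yes refl = trans (cong₂ _+_ (trans (∑-cong (allFin n) λ v _ → idem (lookup e v)) (card-edge p)) (cong (𝟙 ∘ not) self)) refl
    where
    idem : ∀ b → 𝟙 b * 𝟙 b ≡ 𝟙 b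
    idem true = refl
    idem false = refl
    self : meets e e ≡ true
    self with card-2 e (edge p)
    ... | a , _ , _ , refl = meets⁺ e e {a} (⟦⟧-∋ (here refl)) (⟦⟧-∋ (here refl))
  ... | no e≢e' with meets e e' in meet
  ...   | false = cong (_+ 1) (∑-zero (allFin n) λ v _ → trans (sym (𝟙-∧ (lookup e v) (lookup e' v)))
          (cong 𝟙 (not-true λ r → true≢false (meets⁺ e e' {v} (proj₁ (∧-true r)) (proj₂ (∧-true {lookup e v} r))) meet)))
  ...   | true with meets⁻ e e' meet
  ...     | v , ev , e'v = cong (_+ 0) (trans (∑-cong (allFin n) λ v _ → sym (𝟙-∧ (lookup e v) (lookup e' v)))
            (∑-𝟙≡1 (allFin-Unique n) (λ v → lookup e v ∧ lookup e' v) only (∈-Fin v) (∧-intro ev e'v)))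
    where
    only : ∀ {a b} → a ∈ allFin n → b ∈ allFin n → lookup e a ∧ lookup e' a ≡ true → lookup e b ∧ lookup e' b ≡ true → a ≡ b
    only {a} {b} _ _ r t with a ≟F b
    ... | yes k = k
    ... | no k = ⊥-elim (e≢e' (trans (pair-≡ e (edge p) (proj₁ (∧-true r)) (proj₁ (∧-true t)) k)
          (sym (pair-≡ e' (edge q) (proj₂ (∧-true {lookup e a} r)) (proj₂ (∧-true {lookup e b} t)) k))))

  -- The squares count the triples (e, e', v) with v in both edges. Two edges share 2, 1 or 0 points
  -- according to whether they are equal, meet otherwise, or are disjoint, which is 1 + [equal] -
  -- [disjoint].
  degree-squares : ∑ (allFin n) (λ v → x v * x v) + disjoint ≡ m * m + m
  degree-squares = begin
    ∑ (allFin n) (λ v → x v * x v) + disjoint ≡⟨ cong (_+ disjoint) squares ⟩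
    ∑ G (λ e → ∑ G (λ e' → I e e')) + disjoint ≡⟨ sym (∑-+ G _ _) ⟩
    ∑ G (λ e → ∑ G (λ e' → I e e') + ∑ G (λ e' → 𝟙 (not (meets e e')))) ≡⟨ ∑-cong G (λ e e∈ → trans (sym (∑-+ G _ _)) (row e e∈)) ⟩
    ∑ G (λ e → m + 1) ≡⟨ ∑-const G (m + 1) ⟩
    m * (m + 1) ≡⟨ lemma m ⟩
    m * m + m ∎
    where
    open ≡-Reasoning
    I : Subset n → Subset n → ℕ
    I e e' = ∑ (allFin n) (λ v → 𝟙 (lookup e v) * 𝟙 (lookup e' v))
    lemma : ∀ m → m * (m + 1) ≡ m * m + m
    lemma = solve-∀
    row : ∀ e → e ∈ G → ∑ G (λ e' → I e e' + 𝟙 (not (meets e e'))) ≡ m + 1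
    row e e∈ = trans (∑-cong G λ e' e'∈ → intersection e∈ e'∈) (trans (∑-+ G (λ _ → 1) (λ e' → 𝟙 (e == e')))
      (cong₂ _+_ (sym (length-∑ G)) (∑-𝟙≡1 unique (λ e' → e == e')
        (λ _ _ p q → trans (sym (==-true⁻ p)) (==-true⁻ q)) e∈ (==-true {X = e} refl))))
    squares : ∑ (allFin n) (λ v → x v * x v) ≡ ∑ G (λ e → ∑ G (λ e' → I e e'))
    squares = begin
      ∑ (allFin n) (λ v → x v * x v) ≡⟨ ∑-cong (allFin n) (λ v _ → trans (*-comm (x v) (x v)) (sym (∑-* G (x v) _))) ⟩
      ∑ (allFin n) (λ v → ∑ G (λ e → x v * 𝟙 (lookup e v))) ≡⟨ ∑-swap (allFin n) G _ ⟩
      ∑ G (λ e → ∑ (allFin n) (λ v → x v * 𝟙 (lookup e v))) ≡⟨ ∑-cong G (λ e _ → trans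
        (∑-cong (allFin n) λ v _ → trans (*-comm (x v) _) (sym (∑-* G (𝟙 (lookup e v)) _))) (∑-swap (allFin n) G _)) ⟩
      ∑ G (λ e → ∑ G (λ e' → I e e')) ∎

  -- Each of the m − x v edges missing v meets at most two of the x v edges at v.
  disjoint-at : ∀ v → 2 * (x v * length (off v G)) ≤ disjoint + 4 * length (off v G)
  disjoint-at v = begin
    2 * (x v * y) ≤⟨ *-monoʳ-≤ 2 single ⟩
    2 * (a + 2 * y) ≡⟨ lemma a y ⟩
    (a + a) + 4 * y ≤⟨ +-monoˡ-≤ (4 * y) twice ⟩
    disjoint + 4 * y ∎
    where
    open ≤-Reasoning
    y = length (off v G)
    nm : Subset n → Subset n → ℕ
    nm e e' = 𝟙 (not (meets e e'))
    w : Subset n → Subset n → ℕ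
    w e e' = 𝟙 (not (lookup e v)) * (𝟙 (lookup e' v) * nm e e')
    a = ∑ G λ e → ∑ G λ e' → w e e'
    lemma : ∀ a y → 2 * (a + 2 * y) ≡ (a + a) + 4 * y
    lemma = solve-∀
    y≡ : y ≡ ∑ G (λ e → 𝟙 (not (lookup e v)))
    y≡ = length-filter-∑ (λ X → not (lookup X v)) G
    -- `a` counts disjoint pairs whose second edge alone contains v; with the roles exchanged they
    -- are different ordered pairs.
    twice : a + a ≤ disjoint
    twice = ≤-trans (≤-reflexive (trans (cong (a +_) (∑-swap G G w)) (trans (sym (∑-+ G _ _)) (∑-cong G λ e _ → sym (∑-+ G _ _)))))
      (∑-mono G λ e _ → ∑-mono G λ e' _ → pt e e')
      where
      pt : ∀ e e' → w e e' + w e' e ≤ nm e e'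
      pt e e' rewrite meets-comm e' e with lookup e v | lookup e' v | meets e e'
      ... | true | true | _ = z≤n
      ... | true | false | true = z≤n
      ... | true | false | false = ≤-refl
      ... | false | true | true = z≤n
      ... | false | true | false = ≤-refl
      ... | false | false | _ = z≤n
    meeting : ∀ e → e ∈ G → lookup e v ≡ false → ∑ G (λ e' → 𝟙 (lookup e' v) * 𝟙 (meets e e')) ≤ 2
    meeting e e∈ ev = ≤-trans (∑-mono G λ e' _ → *-monoʳ-≤ (𝟙 (lookup e' v)) (bound e'))
      (≤-trans (≤-reflexive (trans (∑-cong G λ e' _ → sym (∑-* (allFin n) (𝟙 (lookup e' v)) _)) (∑-swap G (allFin n) _)))
      (≤-trans (∑-mono (allFin n) λ u _ → col u) (≤-reflexive (card-edge e∈))))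
      where
      bound : ∀ e' → 𝟙 (meets e e') ≤ ∑ (allFin n) (λ u → 𝟙 (lookup e u) * 𝟙 (lookup e' u))
      bound e' with meets e e' in meet
      ... | false = z≤n
      ... | true with meets⁻ e e' meet
      ...   | u , p , q = ≤-trans (≤-reflexive (sym (cong₂ (λ a b → 𝟙 a * 𝟙 b) p q))) (∑-∈ (allFin n) (λ u → 𝟙 (lookup e u) * 𝟙 (lookup e' u)) (∈-Fin u))
      col : ∀ u → ∑ G (λ e' → 𝟙 (lookup e' v) * (𝟙 (lookup e u) * 𝟙 (lookup e' u))) ≤ 𝟙 (lookup e u)
      col u with lookup e u in eu
      ... | false = ≤-reflexive (∑-zero G λ e' _ → *-zeroʳ (𝟙 (lookup e' v)))
      ... | true = ≤-trans (≤-reflexive (∑-cong G λ e' _ → cong (𝟙 (lookup e' v) *_) (*-identityˡ _)))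
            (codegree≤1 v u λ { refl → true≢false eu ev })
    single : x v * y ≤ a + 2 * y
    single = ≤-trans (≤-reflexive (trans (cong (x v *_) y≡) (sym (∑-* G (x v) _))))
      (≤-trans (∑-mono G pt) (≤-reflexive (trans (∑-+ G _ _) (cong (a +_) (trans (∑-* G 2 _) (cong (2 *_) (sym y≡)))))))
      where
      pt : ∀ e → e ∈ G → x v * 𝟙 (not (lookup e v)) ≤ ∑ G (w e) + 2 * 𝟙 (not (lookup e v))
      pt e e∈ with lookup e v in ev
      ... | true = ≤-trans (≤-reflexive (*-zeroʳ (x v))) z≤n
      ... | false = ≤-trans (≤-reflexive (trans (*-identityʳ (x v)) (trans (∑-cong G λ e' _ → cut (lookup e' v) (meets e e')) (∑-+ G _ _))))
            (+-mono-≤ (≤-reflexive (∑-cong G λ e' _ → sym (*-identityˡ _))) (meeting e e∈ ev))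
        where
        cut : ∀ b c → 𝟙 b ≡ 𝟙 b * 𝟙 (not c) + 𝟙 b * 𝟙 c
        cut true true = refl
        cut true false = refl
        cut false _ = refl

  isolated : ℕ
  isolated = ∑ (allFin n) λ v → 𝟙 (x v ≡ᵇ 0)

  -- v, its neighbours and the isolated vertices are all different. The codegrees with v mark each
  -- neighbour once and v itself x(v) times, which is why x(v) is added on both sides.
  isolated-bound : ∀ v → 1 ≤ x v → suc (x v + isolated) ≤ n
  isolated-bound v pos = +-cancelˡ-≤ (x v) _ _ (begin
    x v + suc (x v + isolated) ≡⟨ lemma (x v) isolated ⟩
    2 * x v + isolated + 1 ≡⟨ cong₂ (λ a b → a + isolated + b) (sym cosum) (sym (∑-== v)) ⟩
    ∑ (allFin n) (codegree v) + isolated + ∑ (allFin n) (λ u → 𝟙 (does (u ≟F v)))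
      ≡⟨ trans (cong (_+ ∑ (allFin n) (λ u → 𝟙 (does (u ≟F v)))) (sym (∑-+ (allFin n) _ _))) (sym (∑-+ (allFin n) _ _)) ⟩
    ∑ (allFin n) (λ u → codegree v u + 𝟙 (x u ≡ᵇ 0) + 𝟙 (does (u ≟F v))) ≤⟨ ∑-mono (allFin n) (λ u _ → pt u) ⟩
    ∑ (allFin n) (λ u → x v * 𝟙 (does (u ≟F v)) + 1) ≡⟨ ∑-+ (allFin n) _ _ ⟩
    ∑ (allFin n) (λ u → x v * 𝟙 (does (u ≟F v))) + ∑ (allFin n) (λ _ → 1)
      ≡⟨ cong₂ _+_ (trans (∑-* (allFin n) (x v) _) (trans (cong (x v *_) (∑-== v)) (*-identityʳ (x v))))
        (trans (sym (length-∑ (allFin n))) (length-allFin n)) ⟩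
    x v + n ∎)
    where
    open ≤-Reasoning
    lemma : ∀ a b → a + suc (a + b) ≡ 2 * a + b + 1
    lemma = solve-∀
    cosum : ∑ (allFin n) (codegree v) ≡ 2 * x v
    cosum = trans (∑-swap (allFin n) G _) (trans (∑-cong G λ e e∈ → trans (∑-* (allFin n) (𝟙 (lookup e v)) _)
      (trans (cong (𝟙 (lookup e v) *_) (card-edge e∈)) (*-comm (𝟙 (lookup e v)) 2))) (∑-* G 2 _))
    pt : ∀ u → codegree v u + 𝟙 (x u ≡ᵇ 0) + 𝟙 (does (u ≟F v)) ≤ x v * 𝟙 (does (u ≟F v)) + 1
    pt u with u ≟F v
    ... | yes refl rewrite codegree-self u | not-true {x u ≡ᵇ 0} (λ z → <-irrefl refl (≤-trans pos (≤-reflexive (≡ᵇ-true⁻ z)))) =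
          ≤-reflexive (cong (_+ 1) (trans (+-identityʳ (x u)) (sym (*-identityʳ (x u)))))
    ... | no u≢v with x u ≡ᵇ 0 in z
    ...   | true = ≤-trans (+-monoˡ-≤ 0 (+-monoˡ-≤ 1 (≤-trans (codegree≤deg v u) (≤-reflexive (≡ᵇ-true⁻ z))))) (m≤n+m 1 (x v * 0))
    ...   | false = ≤-trans (≤-reflexive (trans (+-identityʳ _) (+-identityʳ _))) (≤-trans (codegree≤1 v u (u≢v ∘ sym)) (m≤n+m 1 (x v * 0)))

  maximum : ∀ {k} (f : Fin (suc k) → ℕ) → ∃[ v ] (∀ u → f u ≤ f v)
  maximum {zero} f = zero , λ { zero → ≤-refl }
  maximum {suc k} f with maximum (f ∘ suc)
  ... | v , h with ≤-total (f zero) (f (suc v))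
  ...   | inj₁ p = suc v , λ { zero → p ; (suc u) → h u }
  ...   | inj₂ p = zero , λ { zero → ≤-refl ; (suc u) → ≤-trans (h u) p }

module _ {n : ℕ} {G : List (Subset n)} (gr : Graph G) where
  open Degrees gr

  maximum-degree : 1 ≤ n → ∃[ v ] (∀ u → x u ≤ x v)
  maximum-degree 1≤n = go n refl
    where
    go : ∀ k → k ≡ n → ∃[ v ] (∀ u → x u ≤ x v)
    go zero refl = ⊥-elim (<-irrefl refl 1≤n)
    go (suc k) refl = maximum x

  -- With Δ the maximum degree and y the number of edges off that vertex, there are at most y
  -- isolated vertices. If 4 Δ ≥ m + 8, `disjoint-at` gives m y ≤ 2 D, the 8 cancelling its error
  -- term. Otherwise the squared degrees sum to at most 2 m Δ, so `degree-squares` gives 2 D ≥ m (m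
  -- - 5).
  disjoint-isolated : n ≡ suc m → 20 ≤ m → m * isolated ≤ 2 * disjoint
  disjoint-isolated n≡ 20≤m with maximum-degree (≤-trans (s≤s z≤n) (≤-reflexive (sym n≡)))
  ... | v , max = cases (m + 8 ≤? 4 * Δ)
    where
    open ≤-Reasoning
    Δ = x v
    y = length (off v G)
    D = disjoint
    1≤Δ : 1 ≤ Δ
    1≤Δ = ≰⇒> λ p → <-irrefl refl (begin-strict
      0 <⟨ ≤-trans (s≤s z≤n) 20≤m ⟩
      m ≤⟨ m≤m+n m (m + 0) ⟩
      2 * m ≡⟨ sym handshake ⟩
      ∑ (allFin n) x ≡⟨ ∑-zero (allFin n) (λ u _ → n≤0⇒n≡0 (≤-trans (max u) p)) ⟩
      0 ∎)
    Δ+a≤m : Δ + isolated ≤ m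
    Δ+a≤m = ≤-pred (≤-trans (isolated-bound v 1≤Δ) (≤-reflexive n≡))
    a≤y : isolated ≤ y
    a≤y = +-cancelˡ-≤ Δ _ _ (≤-trans Δ+a≤m (≤-reflexive (sym (deg-off G v))))
    squares≤ : ∑ (allFin n) (λ u → x u * x u) ≤ Δ * (2 * m)
    squares≤ = ≤-trans (∑-mono (allFin n) λ u _ → *-monoˡ-≤ (x u) (max u))
      (≤-reflexive (trans (∑-* (allFin n) Δ x) (cong (Δ *_) handshake)))
    -- Only the n - `isolated` other vertices share the degree sum 2 m, each with at most Δ.
    spread : 2 * m + Δ * isolated ≤ n * Δ
    spread = begin
      2 * m + Δ * isolated ≡⟨ cong₂ _+_ (sym handshake) (sym (∑-* (allFin n) Δ _)) ⟩
      ∑ (allFin n) x + ∑ (allFin n) (λ u → Δ * 𝟙 (x u ≡ᵇ 0)) ≡⟨ sym (∑-+ (allFin n) _ _) ⟩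
      ∑ (allFin n) (λ u → x u + Δ * 𝟙 (x u ≡ᵇ 0)) ≤⟨ ∑-mono (allFin n) (λ u _ → pt u) ⟩
      ∑ (allFin n) (λ u → Δ) ≡⟨ trans (∑-const (allFin n) Δ) (cong (_* Δ) (length-allFin n)) ⟩
      n * Δ ∎
      where
      pt : ∀ u → x u + Δ * 𝟙 (x u ≡ᵇ 0) ≤ Δ
      pt u with x u ≡ᵇ 0 in z
      ... | true rewrite ≡ᵇ-true⁻ {x u} z = ≤-reflexive (*-identityʳ Δ)
      ... | false rewrite *-zeroʳ Δ | +-identityʳ (x u) = max u
    -- Otherwise at most five vertices are not isolated and Δ ≤ 4, so the degree sum 2 m ≥ 40 would
    -- be at most 20.
    few-isolated : 4 * Δ ≤ m + 7 → isolated + 5 ≤ m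
    few-isolated q with isolated + 5 ≤? m
    ... | yes p = p
    ... | no p = ⊥-elim (<-irrefl refl (begin-strict
      20 <⟨ s≤s (s≤s (s≤s (s≤s (s≤s (s≤s (s≤s (s≤s (s≤s (s≤s (s≤s (s≤s (s≤s (s≤s (s≤s (s≤s (s≤s (s≤s (s≤s (s≤s (s≤s z≤n)))))))))))))))))))) ⟩
      2 * 20 ≤⟨ *-monoʳ-≤ 2 20≤m ⟩
      2 * m ≤⟨ 2m≤5Δ ⟩
      5 * Δ ≤⟨ *-monoʳ-≤ 5 Δ≤4 ⟩
      20 ∎))
      where
      m≤a+4 : m ≤ isolated + 4
      m≤a+4 = ≤-pred (≤-trans (≰⇒> p) (≤-reflexive (+-suc isolated 4)))
      Δ≤4 : Δ ≤ 4
      Δ≤4 = +-cancelʳ-≤ isolated Δ 4 (≤-trans Δ+a≤m (≤-trans m≤a+4 (≤-reflexive (+-comm isolated 4))))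
      lemma : ∀ a b → suc (a + 4) * b ≡ 5 * b + b * a
      lemma = solve-∀
      2m≤5Δ : 2 * m ≤ 5 * Δ
      2m≤5Δ = +-cancelʳ-≤ (Δ * isolated) _ _ (begin
        2 * m + Δ * isolated ≤⟨ spread ⟩
        n * Δ ≡⟨ cong (_* Δ) n≡ ⟩
        suc m * Δ ≤⟨ *-monoˡ-≤ Δ (s≤s m≤a+4) ⟩
        suc (isolated + 4) * Δ ≡⟨ lemma isolated Δ ⟩
        5 * Δ + Δ * isolated ∎)
    cases : Dec (m + 8 ≤ 4 * Δ) → m * isolated ≤ 2 * D
    cases (yes p) = ≤-trans (*-monoʳ-≤ m a≤y) (+-cancelʳ-≤ (8 * y) _ _ (begin
      m * y + 8 * y ≡⟨ sym (*-distribʳ-+ y m 8) ⟩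
      (m + 8) * y ≤⟨ *-monoˡ-≤ y p ⟩
      4 * Δ * y ≡⟨ lemma₁ Δ y ⟩
      2 * (2 * (Δ * y)) ≤⟨ *-monoʳ-≤ 2 (disjoint-at v) ⟩
      2 * (D + 4 * y) ≡⟨ lemma₂ D y ⟩
      2 * D + 8 * y ∎))
      where
      lemma₁ : ∀ a b → 4 * a * b ≡ 2 * (2 * (a * b))
      lemma₁ = solve-∀
      lemma₂ : ∀ a b → 2 * (a + 4 * b) ≡ 2 * a + 8 * b
      lemma₂ = solve-∀
    cases (no p) = +-cancelʳ-≤ (m * 5) _ _ (begin
      m * isolated + m * 5 ≡⟨ sym (*-distribˡ-+ m isolated 5) ⟩
      m * (isolated + 5) ≤⟨ *-monoʳ-≤ m (few-isolated q) ⟩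
      m * m ≤⟨ +-cancelʳ-≤ (m * (m + 2)) (m * m) (2 * D + m * 5) (begin
        m * m + m * (m + 2) ≡⟨ lemma₃ m ⟩
        2 * (m * m + m) ≡⟨ cong (2 *_) (sym degree-squares) ⟩
        2 * (∑ (allFin n) (λ u → x u * x u) + D) ≤⟨ *-monoʳ-≤ 2 (+-monoˡ-≤ D squares≤) ⟩
        2 * (Δ * (2 * m) + D) ≡⟨ lemma₄ Δ m D ⟩
        m * (4 * Δ) + 2 * D ≤⟨ +-monoˡ-≤ (2 * D) (*-monoʳ-≤ m q) ⟩
        m * (m + 7) + 2 * D ≡⟨ lemma₅ m D ⟩
        (2 * D + m * 5) + m * (m + 2) ∎) ⟩
      2 * D + m * 5 ∎)
      where
      q : 4 * Δ ≤ m + 7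
      q = ≤-pred (≤-trans (≰⇒> p) (≤-reflexive (+-suc m 7)))
      lemma₃ : ∀ m → m * m + m * (m + 2) ≡ 2 * (m * m + m)
      lemma₃ = solve-∀
      lemma₄ : ∀ a m d → 2 * (a * (2 * m) + d) ≡ m * (4 * a) + 2 * d
      lemma₄ = solve-∀
      lemma₅ : ∀ m d → m * (m + 7) + 2 * d ≡ (2 * d + m * 5) + m * (m + 2)
      lemma₅ = solve-∀

-- Eliminates the degree sums between the split into 2-edge and larger stars, the chord bound, and
-- the identities for ∑ d and ∑ d². What survives is the loss 3 g₂ D from disjoint pairs in the
-- complement and the gain 2 a (L + 1) W from its a isolated vertices.
stars-compare : ∀ L D a W g₂ b₂ s₃ Σd Σd² ΣS₃ P → 1 ≤ L →
  2 * P + g₂ * Σd ≡ g₂ * Σd² + 2 * ΣS₃ →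
  3 * L * ΣS₃ ≤ 3 * (Σd * s₃) + a * (L * suc L * W) →
  Σd ≡ suc L * L → Σd² + D ≡ suc L * (L * L) → 2 * b₂ + L ≡ L * L →
  6 * P + 3 * g₂ * D ≤ 6 * (suc L * (g₂ * b₂ + s₃)) + 2 * a * (suc L * W)
stars-compare (suc l) D a W g₂ b₂ s₃ Σd Σd² ΣS₃ P _ h₁ h₂ h₃ h₄ h₅ = *-cancelˡ-≤ L (+-cancelʳ-≤ (3 * L * (g₂ * Σd)) _ _ (begin
  L * (6 * P + 3 * g₂ * D) + 3 * L * (g₂ * Σd) ≡⟨ i₁ L P g₂ D Σd ⟩
  3 * L * (2 * P + g₂ * Σd) + 3 * L * (g₂ * D) ≡⟨ cong (λ z → 3 * L * z + 3 * L * (g₂ * D)) h₁ ⟩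
  3 * L * (g₂ * Σd² + 2 * ΣS₃) + 3 * L * (g₂ * D) ≡⟨ i₂ L g₂ Σd² ΣS₃ D ⟩
  3 * L * g₂ * (Σd² + D) + 2 * (3 * L * ΣS₃) ≤⟨ +-monoʳ-≤ (3 * L * g₂ * (Σd² + D)) (*-monoʳ-≤ 2 h₂) ⟩
  3 * L * g₂ * (Σd² + D) + 2 * (3 * (Σd * s₃) + a * (L * suc L * W))
    ≡⟨ cong₂ (λ y z → 3 * L * g₂ * y + 2 * (3 * (z * s₃) + a * (L * suc L * W))) h₄ h₃ ⟩
  3 * L * g₂ * (suc L * (L * L)) + 2 * (3 * (suc L * L * s₃) + a * (L * suc L * W))
    ≡⟨ cong (λ y → 3 * L * g₂ * (suc L * y) + 2 * (3 * (suc L * L * s₃) + a * (L * suc L * W))) (sym h₅) ⟩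
  3 * L * g₂ * (suc L * (2 * b₂ + L)) + 2 * (3 * (suc L * L * s₃) + a * (L * suc L * W)) ≡⟨ i₃ L g₂ b₂ s₃ a W (suc L) ⟩
  L * (6 * (suc L * (g₂ * b₂ + s₃)) + 2 * a * (suc L * W)) + 3 * L * (g₂ * (suc L * L))
    ≡⟨ cong (λ z → L * (6 * (suc L * (g₂ * b₂ + s₃)) + 2 * a * (suc L * W)) + 3 * L * (g₂ * z)) (sym h₃) ⟩
  L * (6 * (suc L * (g₂ * b₂ + s₃)) + 2 * a * (suc L * W)) + 3 * L * (g₂ * Σd) ∎))
  where
  open ≤-Reasoning
  L : ℕ
  L = suc l
  i₁ : ∀ L P g D s → L * (6 * P + 3 * g * D) + 3 * L * (g * s) ≡ 3 * L * (2 * P + g * s) + 3 * L * (g * D)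
  i₁ = solve-∀
  i₂ : ∀ L g s t D → 3 * L * (g * s + 2 * t) + 3 * L * (g * D) ≡ 3 * L * g * (s + D) + 2 * (3 * L * t)
  i₂ = solve-∀
  i₃ : ∀ L g b s a W k → 3 * L * g * (k * (2 * b + L)) + 2 * (3 * (k * L * s) + a * (L * k * W)) ≡
    L * (6 * (k * (g * b + s)) + 2 * a * (k * W)) + 3 * L * (g * (k * L))
  i₃ = solve-∀

-- The loss outweighs the gain: 2 a (L + 1) W ≤ 4 D W ≤ 3 g₂ D.
stars-conclude : ∀ L D a W g₂ P Q → suc L * a ≤ 2 * D → 4 * W < 3 * g₂ → 0 < g₂ →
  6 * P + 3 * g₂ * D ≤ 6 * Q + 2 * a * (suc L * W) → P ≤ Q × (0 < D → P < Q)
stars-conclude L D a W g₂ P Q h₁ h₂ pos h = le , lt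
  where
  open ≤-Reasoning
  i₁ : ∀ a k W → 4 * (2 * a * (k * W)) ≡ 2 * (k * a) * (4 * W)
  i₁ = solve-∀
  i₂ : ∀ g D → 2 * (2 * D) * (3 * g) ≡ 4 * (3 * g * D)
  i₂ = solve-∀
  bound : 2 * a * (suc L * W) ≤ 3 * g₂ * D
  bound = *-cancelˡ-≤ 4 (begin
    4 * (2 * a * (suc L * W)) ≡⟨ i₁ a (suc L) W ⟩
    2 * (suc L * a) * (4 * W) ≤⟨ *-mono-≤ (*-monoʳ-≤ 2 h₁) (<⇒≤ h₂) ⟩
    2 * (2 * D) * (3 * g₂) ≡⟨ i₂ g₂ D ⟩
    4 * (3 * g₂ * D) ∎)
  le : P ≤ Q
  le = *-cancelˡ-≤ 6 (+-cancelʳ-≤ (3 * g₂ * D) _ _ (≤-trans h (+-monoʳ-≤ (6 * Q) bound)))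
  gain : ∀ a D → suc L * a ≤ 2 * D → 0 < D → 2 * a * (suc L * W) < 3 * g₂ * D
  -- Without isolated vertices the gain is 0, and strictness comes from g₂ > 0 instead of the bound
  -- on W.
  gain zero (suc D) _ _ = *-mono-≤ {1} {3 * g₂} {1} {suc D} (≤-trans pos (m≤m+n g₂ _)) (s≤s z≤n)
  gain (suc a) D h₁ _ = *-cancelˡ-< 4 _ _ (begin-strict
    4 * (2 * suc a * (suc L * W)) ≡⟨ i₁ (suc a) (suc L) W ⟩
    2 * (suc L * suc a) * (4 * W) <⟨ *-monoʳ-< (2 * (suc L * suc a)) h₂ ⟩
    2 * (suc L * suc a) * (3 * g₂) ≤⟨ *-monoˡ-≤ (3 * g₂) (*-monoʳ-≤ 2 h₁) ⟩
    2 * (2 * D) * (3 * g₂) ≡⟨ i₂ g₂ D ⟩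
    4 * (3 * g₂ * D) ∎)
  lt : 0 < D → P < Q
  lt d = *-cancelˡ-< 6 _ _ (+-cancelʳ-< (3 * g₂ * D) _ _ (≤-<-trans h (+-monoʳ-< (6 * Q) (gain a D h₁ d))))

module LargeStars {n : ℕ} (c : Fin n) (s : ℕ) (M : ℕ) (14≤M : 14 ≤ M) (n≡ : n ≡ 5 + M) (2≤s : 2 ≤ s) (s≤ : s ≤ 2 ^ (n ∸ 1)) where
  open Formula c s

  g≥3 : ℕ → ℕ
  g≥3 k = 𝟙 (3 ≤ᵇ k) * g k

  g≥2-split : ∀ d → S d g≥2 ≡ g 2 * binom d 2 + S d g≥3
  g≥2-split d = trans (S-cong d λ k _ → pt k) (trans (S-+ d (λ k → g 2 * δ 2 k) g≥3) (cong (_+ S d g≥3) (S-* d (g 2) (δ 2))))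
    where
    pt : ∀ k → g≥2 k ≡ g 2 * δ 2 k + g≥3 k
    pt zero rewrite *-zeroʳ (g 2) = refl
    pt (suc zero) rewrite *-zeroʳ (g 2) = refl
    pt (suc (suc zero)) rewrite *-identityʳ (g 2) = refl
    pt (suc (suc (suc k))) rewrite *-zeroʳ (g 2) = refl

  -- L = n - 2 is the nonzero degree in the complement of a star, L + 1 is full degree, and N = L -
  -- 1.
  N L : ℕ
  N = suc (suc M)
  L = suc N

  n≡L : n ≡ suc (suc L)
  n≡L = n≡

  7≤n : 7 ≤ n
  7≤n = ≤-trans (+-monoʳ-≤ 5 (≤-trans (s≤s (s≤s z≤n)) 14≤M)) (≤-reflexive (sym n≡))

  -- For f(d) = `S d g≥3` this is the second difference f(L + 1) - 2 f(L) + f(L - 1), which controls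
  -- how far full degree can exceed the chord.
  W : ℕ
  W = S N λ k → g≥3 (suc (suc k))

  step : ∀ j q → q + suc j ≡ N → 2 * q * g (3 + j) ≤ g (2 + j) × g (3 + j) ≤ g (2 + j)
  step j q e = starExt-step c 7≤n (2 + j) q (trans (lemma q j) (trans (cong (3 +_) e) (sym n≡)))
    where
    lemma : ∀ q j → q + suc (suc (2 + j)) ≡ 3 + (q + suc j)
    lemma = solve-∀

  g2-pos : 0 < g 2
  g2-pos = starExt-pos c (≤-trans (s≤s (s≤s (s≤s (s≤s (s≤s z≤n))))) 7≤n) (≤-trans (s≤s (s≤s (s≤s z≤n))) 7≤n) 2≤s s≤

  4W<3g2 : 4 * W < 3 * g 2
  4W<3g2 = subst (λ z → 4 * z < 3 * g 2) (sym W≡)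
    (Tail.W-bound M 14≤M (binom N) (λ j → g (2 + j)) (binom-0 N) (λ j d → binom-step j d)
      (λ j q e → proj₁ (step j q e)) (λ j p → proj₂ (step j (N ∸ suc j) (m∸n+n≡m p))) g2-pos)
    where
    range-pos : ∀ m i {j} → j ∈ range (suc i) m → ∃[ k ] j ≡ suc k
    range-pos (suc m) i (here p) = i , p
    range-pos (suc m) i (there p) = range-pos m (suc i) p
    W≡ : W ≡ ∑ (range 1 N) (λ j → g (2 + j) * binom N j)
    W≡ = trans (S-binom N (λ k → g≥3 (suc (suc k)))) (∑-cong (range 1 N) pt)
      where
      pt : ∀ j → j ∈ range 1 N → g≥3 (suc (suc j)) * binom N j ≡ g (2 + j) * binom N j
      pt j p with range-pos N 0 p
      ... | k , refl = cong (_* binom N (suc k)) (*-identityˡ (g (3 + k)))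

  -- x is the degree in the complement. Degrees up to L are covered by the chord through 0 and L;
  -- for x = 0 the degree is L + 1 and `S-excess` adds the term with W.
  star-sum-≤ : ∀ d x → d + x ≡ suc L →
    3 * L * S d g≥3 ≤ 3 * (d * S L g≥3) + 𝟙 (x ≡ᵇ 0) * (L * suc L * W)
  star-sum-≤ d (suc x) e = begin
    3 * L * S d g≥3 ≡⟨ *-assoc 3 L (S d g≥3) ⟩
    3 * (L * S d g≥3) ≤⟨ *-monoʳ-≤ 3 (S-chord g≥3 refl (≤⇒≤′ d≤L)) ⟩
    3 * (d * S L g≥3) ≤⟨ m≤m+n _ 0 ⟩
    3 * (d * S L g≥3) + 0 ∎
    where
    open ≤-Reasoning
    d≤L : d ≤ L
    d≤L = ≤-pred (≤-trans (s≤s (m≤m+n d x)) (≤-reflexive (trans (sym (+-suc d x)) e)))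
  star-sum-≤ d zero e rewrite trans (sym (+-identityʳ d)) e = begin
    3 * L * (S L g≥3 + S L (g≥3 ∘ suc)) ≡⟨ lemma₁ L (S L g≥3) (S L (g≥3 ∘ suc)) ⟩
    3 * (L * S L g≥3) + 3 * (L * S L (g≥3 ∘ suc)) ≤⟨ +-monoʳ-≤ (3 * (L * S L g≥3)) (S-excess N g≥3 refl refl refl) ⟩
    3 * (L * S L g≥3) + (3 * S L g≥3 + L * suc L * W) ≡⟨ lemma₂ L (S L g≥3) (L * suc L * W) ⟩
    3 * (suc L * S L g≥3) + 1 * (L * suc L * W) ∎
    where
    open ≤-Reasoning
    lemma₁ : ∀ L a b → 3 * L * (a + b) ≡ 3 * (L * a) + 3 * (L * b)
    lemma₁ = solve-∀
    lemma₂ : ∀ L a b → 3 * (L * a) + (3 * a + b) ≡ 3 * (suc L * a) + 1 * b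
    lemma₂ = solve-∀

-- Sizes

count-card : ∀ n k → ∑ (allSubsets n) (λ X → 𝟙 (∣ X ∣ ≡ᵇ k)) ≡ n C k
count-card zero zero = refl
count-card zero (suc k) = refl
count-card (suc n) k = trans (∑-++ (map (false ∷_) (allSubsets n)) _ _)
  (trans (cong₂ _+_ (∑-map (false ∷_) (allSubsets n) _) (∑-map (true ∷_) (allSubsets n) _)) (pascal k))
  where
  pascal : ∀ k → ∑ (allSubsets n) (λ X → 𝟙 (∣ X ∣ ≡ᵇ k)) + ∑ (allSubsets n) (λ X → 𝟙 (suc ∣ X ∣ ≡ᵇ k)) ≡ suc n C k
  pascal zero = trans (cong₂ _+_ (trans (count-card n 0) (nC0≡1 n)) (∑-zero (allSubsets n) λ _ _ → refl)) (sym (nC0≡1 (suc n)))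
    where
    nC0≡1 : ∀ n → n C 0 ≡ 1
    nC0≡1 n = trans (nCk≡nC[n∸k] {0} {n} z≤n) (nCn≡1 n)
  pascal (suc k) = trans (cong₂ _+_ (count-card n (suc k)) (count-card n k))
    (trans (+-comm (n C suc k) (n C k)) (nCk+nC[k+1]≡[n+1]C[k+1] n k))

length-Pairs : ∀ n → length (Pairs n) ≡ n C 2
length-Pairs n = trans (length-filter-∑ (λ X → ∣ X ∣ ≡ᵇ 2) (allSubsets n)) (count-card n 2)

sum-applyUpTo : ∀ (f h : ℕ → ℕ) i m → (∀ j → h j ≡ i + j) → sum (map f (applyUpTo h m)) ≡ ∑ (range i m) f
sum-applyUpTo f h i zero e = refl
sum-applyUpTo f h i (suc m) e = cong₂ _+_ (cong f (trans (e 0) (+-identityʳ i)))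
  (sum-applyUpTo f (h ∘ suc) (suc i) m λ j → trans (e (suc j)) (+-suc i j))

length-Big : ∀ k → length (Big (2 + k)) ≡ sumChoose≥3 (2 + k)
length-Big k = trans (length-filter-∑ (λ X → 3 ≤ᵇ ∣ X ∣) (allSubsets (2 + k))) (trans
  (∑-cong (allSubsets (2 + k)) λ X _ → pt X) (trans (∑-swap (allSubsets (2 + k)) (range 3 k) (λ X j → 1 * 𝟙 (∣ X ∣ ≡ᵇ j)))
  (trans (∑-cong (range 3 k) λ j _ → trans (∑-cong (allSubsets (2 + k)) λ X _ → *-identityˡ (𝟙 (∣ X ∣ ≡ᵇ j))) (count-card (2 + k) j))
    (sym (sum-applyUpTo (λ j → (2 + k) C j) _ 3 k λ _ → refl)))))
  where
  pt : ∀ (X : Subset (2 + k)) → 𝟙 (3 ≤ᵇ ∣ X ∣) ≡ ∑ (range 3 k) (λ j → 1 * 𝟙 (∣ X ∣ ≡ᵇ j))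
  pt X with 3 ≤ᵇ ∣ X ∣ in eq
  ... | true = sym (∑-range-δ (λ _ → 1) k (≤ᵇ-true⁻ eq) (s≤s (card-≤-n X)))
    where
    card-≤-n : ∀ (X : Subset (2 + k)) → ∣ X ∣ ≤ 2 + k
    card-≤-n X = ≤-trans (m≤n+m ∣ X ∣ (∣ ∁ X ∣)) (≤-reflexive (card-∁ X))
  ... | false = sym (∑-range-below (λ _ → 1) k {3} {∣ X ∣} (≰⇒> λ p → true≢false (≤ᵇ-true p) eq))

-- The two extremal families

-- With `id` the 2-sets form the full star at v, as in part (a); with `not` they form its
-- complement, as in part (b).
around : (Bool → Bool) → Fin n → Family n
around ψ v X = (3 ≤ᵇ ∣ X ∣) ∨ ((∣ X ∣ ≡ᵇ 2) ∧ ψ (lookup X v))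

around-Layered : ∀ ψ (v : Fin n) → Layered (around ψ v)
around-Layered ψ v = record
  { big = λ X p → cong (_∨ ((∣ X ∣ ≡ᵇ 2) ∧ ψ (lookup X v))) (≤ᵇ-true p)
  ; small = λ X p → f X (∨-true {3 ≤ᵇ ∣ X ∣} p) }
  where
  f : ∀ X → (3 ≤ᵇ ∣ X ∣) ≡ true ⊎ (∣ X ∣ ≡ᵇ 2) ∧ ψ (lookup X v) ≡ true → 2 ≤ ∣ X ∣
  f X (inj₁ p) = ≤-trans (n≤1+n 2) (≤ᵇ-true⁻ p)
  f X (inj₂ p) = ≤-reflexive (sym (≡ᵇ-true⁻ (proj₁ (∧-true p))))

around-2 : ∀ ψ (v : Fin n) X → ∣ X ∣ ≡ 2 → around ψ v X ≡ ψ (lookup X v)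
around-2 ψ v X c rewrite c = refl

layered-≗ : ∀ {A B : Family n} → Layered A → Layered B → (∀ X → ∣ X ∣ ≡ 2 → A X ≡ B X) → ∀ X → A X ≡ B X
layered-≗ {A = A} {B} a b h X with 3 ≤? ∣ X ∣
... | yes p = trans (Layered.big a X p) (sym (Layered.big b X p))
... | no p with ∣ X ∣ ≟ 2
...   | yes c = h X c
...   | no c = trans (absent a) (sym (absent b))
  where
  absent : ∀ {F : Family _} → Layered F → F X ≡ false
  absent lay = not-true λ fx → c (≤-antisym (≤-pred (≰⇒> p)) (Layered.small lay X fx))

around-Isomorphic : ∀ ψ {A : Family n} {v} → Layered A → (∀ X → ∣ X ∣ ≡ 2 → A X ≡ ψ (lookup X v)) →
  ∀ u {B} → (∀ X → B X ≡ around ψ u X) → Isomorphic A B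
around-Isomorphic ψ {A} {v} lay h u {B} e = σ , λ X →
  trans (layered-≗ lay (around-Layered ψ v) (λ Y c → trans (h Y c) (sym (around-2 ψ v Y c))) X)
    (trans (sym (moved X)) (sym (e (permute σ X))))
  where
  τ = transposition u v
  σ = mk↔ₛ′ (swapF u v) (swapF u v) (swapF-inv u v) (swapF-inv u v)
  moved : ∀ X → around ψ u (act τ X) ≡ around ψ v X
  moved X rewrite card-act τ X | act-∋ τ X u | swapF-left u v = refl

familyA-around : ∀ k (X : Subset (suc k)) → familyA (suc k) X ≡ around id zero X
familyA-around k (b ∷ X) = refl

last : ∀ k → Fin (suc k)
last = fromℕ

lastIn-lookup : ∀ k (X : Subset (suc k)) → lastIn X ≡ lookup X (last k)
lastIn-lookup zero (b ∷ []) = refl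
lastIn-lookup (suc k) (_ ∷ c ∷ X) = lastIn-lookup k (c ∷ X)

familyB-around : ∀ k (X : Subset (suc k)) → familyB (suc k) X ≡ around not (last k) X
familyB-around k X = cong (λ b → (3 ≤ᵇ ∣ X ∣) ∨ ((∣ X ∣ ≡ᵇ 2) ∧ not b)) (lastIn-lookup k X)

numIntersecting-cong : ∀ s {A B : Family n} → (∀ X → A X ≡ B X) → numIntersecting s A ≡ numIntersecting s B
numIntersecting-cong s {A} {B} e = trans (numIntersecting-SS s A)
  (trans (cong (λ l → SS l (λ L → 𝟙 (good s L))) (members-cong e)) (sym (numIntersecting-SS s B)))

-- From layered families to all families

module Conclude {n s : ℕ} (7≤n : 7 ≤ n) (2≤s : 2 ≤ s) (s≤ : s ≤ 2 ^ (n ∸ 1)) (m : ℕ) (1≤m : 1 ≤ m) (m≤ : m ≤ length (Pairs n)) where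
  open Reduction {n} {s} 7≤n 2≤s s≤

  σ : ℕ
  σ = length (Big n) + m

  reduced : (A : Family n) → size A ≡ σ → ∃[ B ] Layered B × size B ≡ size A ×
    numIntersecting s A ≤ numIntersecting s B × (Layered A ⊎ numIntersecting s A < numIntersecting s B)
  reduced A e = reduce _ A
    (≤-trans (≤-trans (≤-reflexive (+-comm 1 _)) (+-monoʳ-≤ (length (Big n)) 1≤m)) (≤-reflexive (sym e)))
    (≤-trans (≤-reflexive e) (+-monoʳ-≤ (length (Big n)) m≤)) (m≤n+m _ (weight A))

  edges-length : ∀ {A : Family n} → Layered A → size A ≡ σ → length (Edges A) ≡ m
  edges-length lay e = +-cancelʳ-≡ (length (Big n)) _ _ (trans (sym (layered-size lay)) (trans e (+-comm (length (Big n)) m)))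

  -- A maximiser that is not layered would be strictly beaten by the layered family from `reduced`.
  -- So bound and uniqueness are only required of layered families with m edges.
  conclude : (F : Family n) → size F ≡ σ →
    (∀ B → Layered B → length (Edges B) ≡ m → numIntersecting s B ≤ numIntersecting s F) →
    (∀ B → Layered B → length (Edges B) ≡ m → numIntersecting s F ≤ numIntersecting s B → Isomorphic B F) →
    Maximiser σ s F × ((A : Family n) → Maximiser σ s A → Isomorphic A F)
  conclude F sF upper unique = (sF , bound) , only
    where
    bound : ∀ B → size B ≡ σ → numIntersecting s B ≤ numIntersecting s F
    bound B e with reduced B e
    ... | B' , lay , e' , le , _ = ≤-trans le (upper B' lay (edges-length lay (trans e' e)))
    only : ∀ A → Maximiser σ s A → Isomorphic A F
    only A (e , max) with reduced A e
    ... | B' , lay , e' , le , inj₂ lt = ⊥-elim (<-irrefl refl (≤-trans lt (max B' (trans e' e))))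
    ... | B' , lay , e' , le , inj₁ layA = unique A layA (edges-length layA e) (max F sF)

not-inter : ∀ {L : List (Subset n)} → inter? L ≡ false → ∃[ X ] ∃[ Y ] X ∈ L × Y ∈ L × meets X Y ≡ false
not-inter {L = L} p with all (λ X → all (meets X) L) L in eq
... | true = ⊥-elim (true≢false (inter⁺ λ X Y X∈ Y∈ → all-true⁻ (meets X) L (all-true⁻ (λ X → all (meets X) L) L eq X∈) Y∈) p)
... | false with all-false (λ X → all (meets X) L) L eq
...   | X , X∈ , q with all-false (meets X) L q
...     | Y , Y∈ , r = X , Y , X∈ , Y∈ , r

spokes-determine : ∀ {A : Family n} {v} → (∀ {X} → X ∈ spokes v → X ∈ Edges A) → (∀ {X} → X ∈ Edges A → X ∋ v) →
  ∀ X → ∣ X ∣ ≡ 2 → A X ≡ lookup X v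
spokes-determine {A = A} p q X c = bool-ext (λ ax → q (∈-Edges c ax)) (λ xv → proj₂ (∈-Edges⁻ {A = A} (p (∈-spokes c xv))))

-- A triangle has too few edges, as n - 1 ≥ 4, and a star with n - 1 edges uses every spoke. In part
-- (b) this is applied to the complementary graph.
intersecting-star : ∀ (c : Fin n) {A : Family n} → 5 ≤ n → suc (length (Edges A)) ≡ n → inter? (Edges A) ≡ true →
  ∃[ v ] (∀ X → ∣ X ∣ ≡ 2 → A X ≡ lookup X v)
intersecting-star c {A} 5≤n len int with classify c (Edges A) (Edges-Unique A) (λ p → proj₁ (∈-Edges⁻ {A = A} p)) int
... | inj₂ t = ⊥-elim (<-irrefl (trans (cong suc (sym (Triangle-length t))) len) 5≤n)
... | inj₁ (v , st) = v , spokes-determine {A = A}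
      (Unique-⊆-length (Star.unique st) (λ p → ∈-spokes (Star.edge st p) (Star.centre st p))
        (≤-reflexive (suc-injective (trans (length-spokes v) (sym len))))) (Star.centre st)

around-id-edges : ∀ (v : Fin n) → Edges (around id v) ↭ spokes v
around-id-edges v = Unique-⊆⊇ (Edges-Unique (around id v)) (Star.unique (spokes-Star v))
  (λ {X} p → let a , b = ∈-Edges⁻ {A = around id v} p in ∈-spokes a (trans (sym (around-2 id v X a)) b))
  (λ {X} p → ∈-Edges (Star.edge (spokes-Star v) p) (trans (around-2 id v X (Star.edge (spokes-Star v) p)) (Star.centre (spokes-Star v) p)))

-- Part (a): the full star

module PartA {n : ℕ} (c : Fin n) (s : ℕ) (5≤n : 5 ≤ n) (2≤s : 2 ≤ s) (s≤ : s ≤ 2 ^ (n ∸ 1)) where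

  star-value : ∀ v → numIntersecting s (around id v) ≡ S (length (spokes v)) (starExt c s)
  star-value v = trans (layered-count s (around-Layered id v)) (trans (SS-↭ (extensions s) (extensions-↭ {s = s}) (around-id-edges v))
    (trans (∑-cong (sublists (spokes v)) λ H H∈ → extensions-starExt s c (record
      { unique = sub-Unique (Star.unique (spokes-Star v)) H∈
      ; edge = λ p → Star.edge (spokes-Star v) (sub-∈ H∈ p)
      ; centre = λ p → Star.centre (spokes-Star v) (sub-∈ H∈ p) })) (SS-length (spokes v) (starExt c s))))

  sub-length : ∀ {xs H : List A} → H ∈ sublists xs → length H ≤ length xs
  sub-length {xs = []} (here refl) = z≤n
  sub-length {xs = x ∷ xs} p with ∈-++⁻ (sublists xs) p
  ... | inj₁ q = m≤n⇒m≤1+n (sub-length {xs = xs} q)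
  ... | inj₂ q with ∈-map⁻ (x ∷_) q
  ...   | H' , H'∈ , refl = s≤s (sub-length {xs = xs} H'∈)

  module _ {E : List (Subset n)} (gr : Graph E) (len : suc (length E) ≡ n) where

    count-≤ : SS E (extensions s) ≤ S (length E) (starExt c s)
    count-≤ = ≤-trans (∑-mono (sublists E) λ H H∈ → extensions-≤-star s c 5≤n (sub-Graph gr H∈)
      (≤-trans (s≤s (sub-length {xs = E} H∈)) (≤-reflexive len))) (≤-reflexive (SS-length E (starExt c s)))

    -- Two disjoint edges have no extension, while a 2-edge star has g(2) > 0. Reordering the edges
    -- so that these two come first makes the pair literally one of the sublists.
    count-< : inter? E ≡ false → SS E (extensions s) < S (length E) (starExt c s)
    count-< ni with not-inter ni
    ... | X , Y , X∈ , Y∈ , m with ∈-extract X∈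
    ... | r₁ , p₁ with ∈-extract {x = Y} (∈-∷-≢ (∈-resp-↭ p₁ Y∈) (Y≢X X∈ m))
      where
      Y≢X : ∀ {X Y} → X ∈ E → meets X Y ≡ false → Y ≢ X
      Y≢X {X} X∈ m refl with card-2 X (Graph.edge gr X∈)
      ... | a , _ , _ , refl = true≢false (meets⁺ X X {a} (⟦⟧-∋ (here refl)) (⟦⟧-∋ (here refl))) m
    ... | r₂ , p₂ = begin-strict
      SS E (extensions s) ≡⟨ SS-↭ (extensions s) (extensions-↭ {s = s}) perm ⟩
      SS K (extensions s) <⟨ ∑-mono-< (sublists K) (λ H H∈ → extensions-≤-star s c 5≤n (sub-Graph grK H∈)
          (≤-trans (s≤s (sub-length {xs = K} H∈)) (≤-reflexive (trans (cong suc (sym (↭-length perm))) len)))) two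
          (≤-trans (≤-reflexive (cong suc (extensions-0 s {X ∷ Y ∷ []} (not-true λ i → true≢false (inter⁻ {L = X ∷ Y ∷ []} i (here refl) (there (here refl))) m))))
            (starExt-pos c 5≤n (≤-trans (s≤s (s≤s (s≤s z≤n))) 5≤n) 2≤s s≤)) ⟩
      SS K (starExt c s ∘ length) ≡⟨ SS-length K (starExt c s) ⟩
      S (length K) (starExt c s) ≡⟨ cong (λ z → S z (starExt c s)) (sym (↭-length perm)) ⟩
      S (length E) (starExt c s) ∎
      where
      open ≤-Reasoning
      K = X ∷ Y ∷ r₂
      perm : E ↭ K
      perm = ptrans p₁ (prep X p₂)
      grK : Graph K
      grK = record { unique = Unique-↭ perm (Graph.unique gr) ; edge = λ p → Graph.edge gr (∈-resp-↭ (↭-sym perm) p) }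
      two : X ∷ Y ∷ [] ∈ sublists K
      two = ∈-++⁺ʳ (sublists (Y ∷ r₂)) (∈-map⁺ (X ∷_) (singleton-∈-sublists {xs = Y ∷ r₂} (here refl)))

-- Part (b): the complement of a star

module PartB {n : ℕ} (c : Fin n) (s M : ℕ) (16≤M : 16 ≤ M) (n≡ : n ≡ 5 + M) (2≤s : 2 ≤ s) (s≤ : s ≤ 2 ^ (n ∸ 1)) where
  open Formula c s
  open LargeStars c s M (≤-trans (+-monoʳ-≤ 14 z≤n) 16≤M) n≡ 2≤s s≤

  1≤n : 1 ≤ n
  1≤n = ≤-trans (s≤s z≤n) 7≤n

  co : Family n → Family n
  co A X = not (A X)

  Pairs-split : ∀ A → Pairs n ↭ Edges A ++ Edges (co A)
  Pairs-split A = filterᵇ-split A (Pairs n)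

  deg-sum : ∀ A v → deg (Edges A) v + deg (Edges (co A)) v ≡ suc L
  deg-sum A v = trans (sym (∑-++ (Edges A) (Edges (co A)) _)) (trans (sym (∑-↭ _ (Pairs-split A))) (suc-injective
    (trans (cong suc (trans (sym (deg-at (Pairs n) v)) (↭-length at-spokes))) (trans (length-spokes v) n≡L))))
    where
    at-spokes : at v (Pairs n) ↭ spokes v
    at-spokes = Unique-⊆⊇ (filterᵇ-unique _ (Pairs-Unique n)) (Star.unique (spokes-Star v))
      (λ p → let a , b = ∈-filterᵇ⁻ (λ X → lookup X v) (Pairs n) p in ∈-spokes (∈-Pairs⁻ a) b)
      (λ p → ∈-filterᵇ⁺ (λ X → lookup X v) (∈-Pairs (Star.edge (spokes-Star v) p)) (Star.centre (spokes-Star v) p))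

  co-length : ∀ A → length (Edges A) ≡ suc L C 2 → length (Edges (co A)) ≡ suc L
  co-length A e = +-cancelˡ-≡ (length (Edges A)) _ _ (begin
    length (Edges A) + length (Edges (co A)) ≡⟨ sym (trans (↭-length (Pairs-split A)) (length-++ (Edges A))) ⟩
    length (Pairs n) ≡⟨ length-Pairs n ⟩
    n C 2 ≡⟨ cong (_C 2) n≡L ⟩
    suc (suc L) C 2 ≡⟨ sym (nCk+nC[k+1]≡[n+1]C[k+1] (suc L) 1) ⟩
    suc L C 1 + suc L C 2 ≡⟨ cong₂ _+_ (nC1≡n (suc L)) (sym e) ⟩
    suc L + length (Edges A) ≡⟨ +-comm (suc L) (length (Edges A)) ⟩
    length (Edges A) + suc L ∎)
    where open ≡-Reasoning

  starSum : Family n → ℕ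
  starSum A = ∑ (allFin n) λ v → S (deg (Edges A) v) g≥2

  cornerSum : Family n → ℕ
  cornerSum A = ∑ (allFin n) (τ 1≤n (Edges A))

  degSum : Family n → ℕ
  degSum A = ∑ (allFin n) (deg (Edges A))

  -- The value of `starSum` for the complement of a star, which has n - 1 = L + 1 vertices of degree
  -- L and one of degree 0.
  starMax : ℕ
  starMax = suc L * (g 2 * binom L 2 + S L g≥3)

  module _ (A : Family n) (len : length (Edges (co A)) ≡ suc L) where
    open Degrees (Edges-Graph (co A)) using (x; disjoint; isolated; handshake; degree-squares)
    private
      d : Fin n → ℕ
      d = deg (Edges A)

    co-degSum : ∑ (allFin n) x ≡ 2 * suc L
    co-degSum = trans handshake (cong (2 *_) len)

    ∑-n : ∀ k → ∑ (allFin n) (λ _ → k) ≡ suc (suc L) * k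
    ∑-n k = trans (∑-const (allFin n) k) (cong (_* k) (trans (length-allFin n) n≡L))

    degSum-≡ : degSum A ≡ suc L * L
    degSum-≡ = +-cancelʳ-≡ (2 * suc L) _ _ (begin
      degSum A + 2 * suc L ≡⟨ cong (degSum A +_) (sym co-degSum) ⟩
      degSum A + ∑ (allFin n) x ≡⟨ sym (∑-+ (allFin n) d x) ⟩
      ∑ (allFin n) (λ v → d v + x v) ≡⟨ ∑-cong (allFin n) (λ v _ → deg-sum A v) ⟩
      ∑ (allFin n) (λ _ → suc L) ≡⟨ ∑-n (suc L) ⟩
      suc (suc L) * suc L ≡⟨ lemma L ⟩
      suc L * L + 2 * suc L ∎)
      where
      open ≡-Reasoning
      lemma : ∀ l → suc (suc l) * suc l ≡ suc l * l + 2 * suc l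
      lemma = solve-∀

    -- Substitute d = k - x with k = L + 1 and use `degree-squares` for the complement. The cross
    -- term 2 k ∑ x = 2 k · 2 k is added to both sides to avoid subtraction.
    squareSum : ∑ (allFin n) (λ v → d v * d v) + disjoint ≡ suc L * (L * L)
    squareSum = +-cancelʳ-≡ (2 * k * (2 * k)) _ _ (begin
      ∑ (allFin n) (λ v → d v * d v) + disjoint + 2 * k * (2 * k) ≡⟨ lemma₁ (∑ (allFin n) (λ v → d v * d v)) disjoint (2 * k * (2 * k)) ⟩
      ∑ (allFin n) (λ v → d v * d v) + 2 * k * (2 * k) + disjoint ≡⟨ cong (λ z → ∑ (allFin n) (λ v → d v * d v) + z + disjoint)
        (trans (cong (2 * k *_) (sym co-degSum)) (sym (∑-* (allFin n) (2 * k) x))) ⟩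
      ∑ (allFin n) (λ v → d v * d v) + ∑ (allFin n) (λ v → 2 * k * x v) + disjoint
        ≡⟨ cong (_+ disjoint) (trans (sym (∑-+ (allFin n) _ _)) (trans (∑-cong (allFin n) λ v _ → pt v) (∑-+ (allFin n) _ _))) ⟩
      ∑ (allFin n) (λ _ → k * k) + ∑ (allFin n) (λ v → x v * x v) + disjoint ≡⟨ +-assoc (∑ (allFin n) (λ _ → k * k)) _ _ ⟩
      ∑ (allFin n) (λ _ → k * k) + (∑ (allFin n) (λ v → x v * x v) + disjoint)
        ≡⟨ cong₂ _+_ (∑-n (k * k)) (trans degree-squares (cong (λ z → z * z + z) len)) ⟩
      suc k * (k * k) + (k * k + k) ≡⟨ lemma₃ L ⟩
      k * (L * L) + 2 * k * (2 * k) ∎)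
      where
      open ≡-Reasoning
      k : ℕ
      k = suc L
      lemma₁ : ∀ a b c → a + b + c ≡ a + c + b
      lemma₁ = solve-∀
      lemma₂ : ∀ d x → d * d + 2 * (d + x) * x ≡ (d + x) * (d + x) + x * x
      lemma₂ = solve-∀
      lemma₃ : ∀ l → suc (suc l) * (suc l * suc l) + (suc l * suc l + suc l) ≡ suc l * (l * l) + 2 * suc l * (2 * suc l)
      lemma₃ = solve-∀
      pt : ∀ v → d v * d v + 2 * k * x v ≡ k * k + x v * x v
      pt v = subst (λ z → d v * d v + 2 * z * x v ≡ z * z + x v * x v) (deg-sum A v) (lemma₂ (d v) (x v))

    star-split : 2 * starSum A + g 2 * degSum A ≡
      g 2 * ∑ (allFin n) (λ v → d v * d v) + 2 * ∑ (allFin n) (λ v → S (d v) g≥3)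
    star-split = begin
      2 * starSum A + g 2 * degSum A ≡⟨ cong₂ _+_ (sym (∑-* (allFin n) 2 _)) (sym (∑-* (allFin n) (g 2) d)) ⟩
      ∑ (allFin n) (λ v → 2 * S (d v) g≥2) + ∑ (allFin n) (λ v → g 2 * d v) ≡⟨ sym (∑-+ (allFin n) _ _) ⟩
      ∑ (allFin n) (λ v → 2 * S (d v) g≥2 + g 2 * d v) ≡⟨ ∑-cong (allFin n) (λ v _ → pt (d v)) ⟩
      ∑ (allFin n) (λ v → g 2 * (d v * d v) + 2 * S (d v) g≥3) ≡⟨ ∑-+ (allFin n) _ _ ⟩
      ∑ (allFin n) (λ v → g 2 * (d v * d v)) + ∑ (allFin n) (λ v → 2 * S (d v) g≥3) ≡⟨ cong₂ _+_ (∑-* (allFin n) (g 2) _) (∑-* (allFin n) 2 _) ⟩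
      g 2 * ∑ (allFin n) (λ v → d v * d v) + 2 * ∑ (allFin n) (λ v → S (d v) g≥3) ∎
      where
      open ≡-Reasoning
      lemma : ∀ g b s d → 2 * (g * b + s) + g * d ≡ g * (2 * b + d) + 2 * s
      lemma = solve-∀
      pt : ∀ d → 2 * S d g≥2 + g 2 * d ≡ g 2 * (d * d) + 2 * S d g≥3
      pt d = trans (cong (λ z → 2 * z + g 2 * d) (g≥2-split d)) (trans (lemma (g 2) (binom d 2) (S d g≥3) d)
        (cong (λ z → g 2 * z + 2 * S d g≥3) (binom-2 d)))

    large-stars : 3 * L * ∑ (allFin n) (λ v → S (d v) g≥3) ≤ 3 * (degSum A * S L g≥3) + isolated * (L * suc L * W)
    large-stars = begin
      3 * L * ∑ (allFin n) (λ v → S (d v) g≥3) ≡⟨ sym (∑-* (allFin n) (3 * L) _) ⟩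
      ∑ (allFin n) (λ v → 3 * L * S (d v) g≥3) ≤⟨ ∑-mono (allFin n) (λ v _ → star-sum-≤ (d v) (x v) (deg-sum A v)) ⟩
      ∑ (allFin n) (λ v → 3 * (d v * S L g≥3) + 𝟙 (x v ≡ᵇ 0) * (L * suc L * W)) ≡⟨ ∑-+ (allFin n) _ _ ⟩
      ∑ (allFin n) (λ v → 3 * (d v * S L g≥3)) + ∑ (allFin n) (λ v → 𝟙 (x v ≡ᵇ 0) * (L * suc L * W))
        ≡⟨ cong₂ _+_ (trans (∑-* (allFin n) 3 _) (cong (3 *_) (∑-*ʳ d (S L g≥3)))) (∑-*ʳ (λ v → 𝟙 (x v ≡ᵇ 0)) (L * suc L * W)) ⟩
      3 * (degSum A * S L g≥3) + isolated * (L * suc L * W) ∎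
      where
      open ≤-Reasoning
      ∑-*ʳ : ∀ (f : Fin n → ℕ) k → ∑ (allFin n) (λ v → f v * k) ≡ ∑ (allFin n) f * k
      ∑-*ʳ f k = trans (∑-cong (allFin n) λ v _ → *-comm (f v) k) (trans (∑-* (allFin n) k f) (*-comm k _))

    20≤co : 20 ≤ length (Edges (co A))
    20≤co = ≤-trans (+-monoʳ-≤ 4 16≤M) (≤-reflexive (sym len))

    starSum-≤ : starSum A ≤ starMax × (0 < disjoint → starSum A < starMax)
    starSum-≤ = stars-conclude L disjoint isolated W (g 2) (starSum A) starMax
      (subst (λ z → z * isolated ≤ 2 * disjoint) len
        (disjoint-isolated (Edges-Graph (co A)) (trans n≡L (cong suc (sym len))) 20≤co))
      4W<3g2 g2-pos
      (stars-compare L disjoint isolated W (g 2) (binom L 2) (S L g≥3) (degSum A) (∑ (allFin n) (λ v → d v * d v)) (∑ (allFin n) (λ v → S (d v) g≥3)) (starSum A)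
        (s≤s z≤n) star-split large-stars degSum-≡ squareSum (binom-2 L))

    -- Bounded vertex by vertex. For d ≤ L, counting pairs of edges at v gives 2 τ + d ≤ d² ≤ d L.
    -- For d = L + 1 that is too weak, and counting opposite sides gives 2 τ + 2 d ≤ 2 |E| = (L + 1)
    -- L = d L.
    cornerSum-≤ : 2 * cornerSum A + degSum A ≤ degSum A * L
    cornerSum-≤ = begin
      2 * cornerSum A + degSum A ≡⟨ cong (_+ degSum A) (sym (∑-* (allFin n) 2 _)) ⟩
      ∑ (allFin n) (λ v → 2 * τ 1≤n E v) + degSum A ≡⟨ sym (∑-+ (allFin n) _ _) ⟩
      ∑ (allFin n) (λ v → 2 * τ 1≤n E v + d v) ≤⟨ ∑-mono (allFin n) (λ v _ → pt v (x v) (deg-sum A v)) ⟩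
      ∑ (allFin n) (λ v → d v * L) ≡⟨ trans (∑-cong (allFin n) λ v _ → *-comm (d v) L) (trans (∑-* (allFin n) L d) (*-comm L (degSum A))) ⟩
      degSum A * L ∎
      where
      open ≤-Reasoning
      E = Edges A
      pt : ∀ v y → d v + y ≡ suc L → 2 * τ 1≤n E v + d v ≤ d v * L
      pt v (suc y) e = begin
        2 * τ 1≤n E v + d v ≤⟨ +-monoˡ-≤ (d v) (*-monoʳ-≤ 2 (Corners.τ≤binom c s 1≤n (Edges-Graph A) v)) ⟩
        2 * binom (d v) 2 + d v ≡⟨ binom-2 (d v) ⟩
        d v * d v ≤⟨ *-monoʳ-≤ (d v) (≤-pred (≤-trans (s≤s (m≤m+n (d v) y)) (≤-reflexive (trans (sym (+-suc (d v) y)) e)))) ⟩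
        d v * L ∎
      pt v zero e = +-cancelʳ-≤ (d v) _ _ (begin
        2 * τ 1≤n E v + d v + d v ≤⟨ +-monoˡ-≤ (d v) (+-monoˡ-≤ (d v) (*-monoʳ-≤ 2 (Corners.τ≤off c s 1≤n (Edges-Graph A) v))) ⟩
        2 * length (off v E) + d v + d v ≡⟨ lemma₁ (length (off v E)) (d v) ⟩
        2 * (d v + length (off v E)) ≡⟨ cong (2 *_) (deg-off E v) ⟩
        2 * length E ≡⟨ sym (Degrees.handshake (Edges-Graph A)) ⟩
        degSum A ≡⟨ degSum-≡ ⟩
        suc L * L ≡⟨ cong (_* L) (trans (sym e) (+-identityʳ (d v))) ⟩
        d v * L ≤⟨ m≤m+n (d v * L) (d v) ⟩
        d v * L + d v ∎)
        where
        lemma₁ : ∀ a b → 2 * a + b + b ≡ 2 * (b + a)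
        lemma₁ = solve-∀

  module _ (u : Fin n) where
    K : Family n
    K = around not u

    co-K : Edges (co K) ↭ spokes u
    co-K = Unique-⊆⊇ (Edges-Unique (co K)) (Star.unique (spokes-Star u))
      (λ {X} p → let a , b = ∈-Edges⁻ {A = co K} p in
        ∈-spokes a (trans (sym (not-involutive (lookup X u))) (trans (cong not (sym (around-2 not u X a))) b)))
      (λ {X} p → ∈-Edges (Star.edge (spokes-Star u) p)
        (trans (cong not (around-2 not u X (Star.edge (spokes-Star u) p))) (trans (not-involutive (lookup X u)) (Star.centre (spokes-Star u) p))))

    co-K-length : length (Edges (co K)) ≡ suc L
    co-K-length = suc-injective (trans (cong suc (↭-length co-K)) (trans (length-spokes u) n≡L))

    K-edge : ∀ {X} → X ∈ Edges K → lookup X u ≡ false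
    K-edge {X} p = let a , b = ∈-Edges⁻ {A = K} p in not-true⁻ (trans (sym (around-2 not u X a)) b)

    K-deg : ∀ v → deg (Edges K) v ≡ 0 ⊎ deg (Edges K) v ≡ L
    K-deg v with v ≟F u
    ... | yes refl = inj₁ (deg-≡-0 (Edges K) u K-edge)
    ... | no v≢u = inj₂ (suc-injective (trans (+-comm 1 _) (trans (cong (deg (Edges K) v +_) (sym one)) (deg-sum K v))))
      where
      one : deg (Edges (co K)) v ≡ 1
      one = trans (deg-↭ co-K v) (∑-𝟙≡1 (Star.unique (spokes-Star u)) (λ X → lookup X v)
        (λ p q r t → trans (f p r) (sym (f q t))) (∈-map⁺ _ (∈-others v≢u)) (⟦⟧-∋ {us = u ∷ v ∷ []} (there (here refl))))
        where
        f : ∀ {X} → X ∈ spokes u → X ∋ v → X ≡ ⟦ u ∷ v ∷ [] ⟧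
        f {X} p r = pair-≡ X (Star.edge (spokes-Star u) p) (Star.centre (spokes-Star u) p) r (v≢u ∘ sym)

    -- All degrees are 0 or L, so after multiplication by L each summand is proportional to the
    -- degree and only the degree sum is needed.
    K-starSum : starSum K ≡ starMax
    K-starSum = *-cancelˡ-≡ _ _ L (begin
      L * starSum K ≡⟨ sym (∑-* (allFin n) L _) ⟩
      ∑ (allFin n) (λ v → L * S (deg (Edges K) v) g≥2) ≡⟨ ∑-cong (allFin n) (λ v _ → pt (K-deg v)) ⟩
      ∑ (allFin n) (λ v → S L g≥2 * deg (Edges K) v) ≡⟨ ∑-* (allFin n) (S L g≥2) _ ⟩
      S L g≥2 * degSum K ≡⟨ cong₂ _*_ (g≥2-split L) (degSum-≡ K co-K-length) ⟩
      (g 2 * binom L 2 + S L g≥3) * (suc L * L) ≡⟨ lemma (g 2 * binom L 2 + S L g≥3) (suc L) L ⟩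
      L * starMax ∎)
      where
      open ≡-Reasoning
      lemma : ∀ a b c → a * (b * c) ≡ c * (b * a)
      lemma = solve-∀
      pt : ∀ {d} → d ≡ 0 ⊎ d ≡ L → L * S d g≥2 ≡ S L g≥2 * d
      pt (inj₁ refl) = trans (*-zeroʳ L) (sym (*-zeroʳ (S L g≥2)))
      pt (inj₂ refl) = *-comm L (S L g≥2)

    -- Away from u all pairs are edges, so any two edges at a vertex close up to a triangle and the
    -- bound of `cornerSum-≤` is attained.
    K-cornerSum : degSum K * L ≤ 2 * cornerSum K + degSum K
    K-cornerSum = begin
      degSum K * L ≡⟨ trans (*-comm (degSum K) L) (sym (∑-* (allFin n) L _)) ⟩
      ∑ (allFin n) (λ v → L * deg (Edges K) v) ≤⟨ ∑-mono (allFin n) (λ v _ → pt v (K-deg v)) ⟩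
      ∑ (allFin n) (λ v → 2 * τ 1≤n (Edges K) v + deg (Edges K) v) ≡⟨ ∑-+ (allFin n) _ _ ⟩
      ∑ (allFin n) (λ v → 2 * τ 1≤n (Edges K) v) + degSum K ≡⟨ cong (_+ degSum K) (∑-* (allFin n) 2 _) ⟩
      2 * cornerSum K + degSum K ∎
      where
      open ≤-Reasoning
      closed : ∀ v {a b} → a ≢ b → a ≢ v → b ≢ v → ⟦ v ∷ a ∷ [] ⟧ ∈ Edges K → ⟦ v ∷ b ∷ [] ⟧ ∈ Edges K → ⟦ a ∷ b ∷ [] ⟧ ∈ Edges K
      closed v {a} {b} a≢b _ _ p q = ∈-Edges {A = K} {X = ⟦ a ∷ b ∷ [] ⟧} c2 (trans (around-2 not u ⟦ a ∷ b ∷ [] ⟧ c2) (cong not (⟦⟧-∌ {us = a ∷ b ∷ []} λ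
          { (here refl) → true≢false (⟦⟧-∋ {us = v ∷ a ∷ []} (there (here refl))) (K-edge p)
          ; (there (here refl)) → true≢false (⟦⟧-∋ {us = v ∷ b ∷ []} (there (here refl))) (K-edge q) })))
        where
        c2 : ∣ ⟦ a ∷ b ∷ [] ⟧ ∣ ≡ 2
        c2 = card-⟦⟧ {us = a ∷ b ∷ []} (Unique-2 a≢b)
      pt : ∀ v → deg (Edges K) v ≡ 0 ⊎ deg (Edges K) v ≡ L → L * deg (Edges K) v ≤ 2 * τ 1≤n (Edges K) v + deg (Edges K) v
      pt v (inj₁ e) = ≤-trans (≤-reflexive (trans (cong (L *_) e) (*-zeroʳ L))) z≤n
      pt v (inj₂ e) = begin
        L * deg (Edges K) v ≡⟨ cong (_* deg (Edges K) v) (sym e) ⟩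
        deg (Edges K) v * deg (Edges K) v ≡⟨ sym (binom-2 (deg (Edges K) v)) ⟩
        2 * binom (deg (Edges K) v) 2 + deg (Edges K) v
          ≤⟨ +-monoˡ-≤ _ (*-monoʳ-≤ 2 (Corners.τ≥binom c s 1≤n (Edges-Graph K) v (closed v))) ⟩
        2 * τ 1≤n (Edges K) v + deg (Edges K) v ∎

    module _ (A : Family n) (layA : Layered A) (len : length (Edges (co A)) ≡ suc L) where

      edges-≡ : length (Edges A) ≡ length (Edges K)
      edges-≡ = *-cancelˡ-≡ _ _ 2 (trans (sym (Degrees.handshake (Edges-Graph A))) (trans (degSum-≡ A len)
        (trans (sym (degSum-≡ K co-K-length)) (Degrees.handshake (Edges-Graph K)))))

      corners-≤ : cornerSum A ≤ cornerSum K
      corners-≤ = *-cancelˡ-≤ 2 (+-cancelʳ-≤ (degSum A) _ _ (≤-trans (cornerSum-≤ A len)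
        (subst (λ z → z * L ≤ 2 * cornerSum K + z) (trans (degSum-≡ K co-K-length) (sym (degSum-≡ A len))) K-cornerSum)))

      value : ∀ {B} → Layered B → 3 * numIntersecting s B ≡
        3 * S (length (Edges B)) g≤1 + 3 * starSum B + κ 1≤n * cornerSum B
      value {B} lay = trans (cong (3 *_) (layered-count s lay)) (formula 1≤n (Edges-Graph B))

      layK : Layered K
      layK = around-Layered not u

      count-≤ : numIntersecting s A ≤ numIntersecting s K
      count-≤ = *-cancelˡ-≤ 3 (begin
        3 * numIntersecting s A ≡⟨ value layA ⟩
        3 * S (length (Edges A)) g≤1 + 3 * starSum A + κ 1≤n * cornerSum A
          ≤⟨ +-mono-≤ (+-mono-≤ (≤-reflexive (cong (λ z → 3 * S z g≤1) edges-≡))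
              (*-monoʳ-≤ 3 (≤-trans (proj₁ (starSum-≤ A len)) (≤-reflexive (sym K-starSum))))) (*-monoʳ-≤ (κ 1≤n) corners-≤) ⟩
        3 * S (length (Edges K)) g≤1 + 3 * starSum K + κ 1≤n * cornerSum K ≡⟨ sym (value layK) ⟩
        3 * numIntersecting s K ∎)
        where open ≤-Reasoning

      count-< : inter? (Edges (co A)) ≡ false → numIntersecting s A < numIntersecting s K
      count-< ni = *-cancelˡ-< 3 _ _ (begin-strict
        3 * numIntersecting s A ≡⟨ value layA ⟩
        3 * S (length (Edges A)) g≤1 + 3 * starSum A + κ 1≤n * cornerSum A
          <⟨ +-mono-<-≤ (+-mono-≤-< (≤-reflexive (cong (λ z → 3 * S z g≤1) edges-≡))
              (*-monoʳ-< 3 (≤-trans (proj₂ (starSum-≤ A len) (disjoint-pos (not-inter ni))) (≤-reflexive (sym K-starSum))))) (*-monoʳ-≤ (κ 1≤n) corners-≤) ⟩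
        3 * S (length (Edges K)) g≤1 + 3 * starSum K + κ 1≤n * cornerSum K ≡⟨ sym (value layK) ⟩
        3 * numIntersecting s K ∎)
        where
        open ≤-Reasoning
        E' = Edges (co A)
        disjoint-pos : ∃[ X ] ∃[ Y ] X ∈ E' × Y ∈ E' × meets X Y ≡ false → 0 < Degrees.disjoint (Edges-Graph (co A))
        disjoint-pos (X , Y , X∈ , Y∈ , m) = ≤-trans (≤-reflexive (cong (𝟙 ∘ not) (sym m)))
          (≤-trans (∑-∈ E' (λ e' → 𝟙 (not (meets X e'))) Y∈) (∑-∈ E' (λ e → ∑ E' (λ e' → 𝟙 (not (meets e e')))) X∈))

      optimal⇒star : numIntersecting s K ≤ numIntersecting s A → ∃[ v ] (∀ X → ∣ X ∣ ≡ 2 → A X ≡ not (lookup X v))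
      optimal⇒star le with inter? (Edges (co A)) in int
      ... | false = ⊥-elim (<-irrefl refl (≤-trans (count-< int) le))
      ... | true with intersecting-star c {co A} (≤-trans (s≤s (s≤s (s≤s (s≤s (s≤s z≤n))))) 7≤n) (trans (cong suc len) (sym n≡L)) int
      ...   | v , h = v , λ X c2 → trans (sym (not-involutive (A X))) (cong not (h X c2))

theorem1 : (n s : ℕ) → 21 ≤ n → 2 ≤ s → s ≤ 2 ^ (n ∸ 1) →
    (Maximiser (sumChoose≥3 n + (n ∸ 1)) s (familyA n)
    × ((A : Family n) → Maximiser (sumChoose≥3 n + (n ∸ 1)) s A → Isomorphic A (familyA n)))
    × (Maximiser (sumChoose≥3 n + ((n ∸ 1) C 2)) s (familyB n)
    × ((A : Family n) → Maximiser (sumChoose≥3 n + ((n ∸ 1) C 2)) s A → Isomorphic A (familyB n)))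
theorem1 (suc (suc (suc (suc (suc M))))) s (s≤s (s≤s (s≤s (s≤s (s≤s 16≤M))))) 2≤s s≤ =
  subst (λ z → Claim (z + (4 + M)) (familyA n₀)) (length-Big (3 + M)) partA ,
  subst (λ z → Claim (z + ((4 + M) C 2)) (familyB n₀)) (length-Big (3 + M)) partB
  where
  n₀ : ℕ
  n₀ = 5 + M
  Claim : ℕ → Family n₀ → Set
  Claim σ F = Maximiser σ s F × ((A : Family n₀) → Maximiser σ s A → Isomorphic A F)
  7≤n₀ : 7 ≤ n₀
  7≤n₀ = +-monoʳ-≤ 5 (≤-trans (s≤s (s≤s z≤n)) 16≤M)
  5≤n₀ : 5 ≤ n₀
  5≤n₀ = m≤m+n 5 M
  u : Fin n₀
  u = last (4 + M)
  edges-≤ : ∀ (A : Family n₀) → length (Edges A) ≤ length (Pairs n₀)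
  edges-≤ A = Unique-length (Edges-Unique A) λ p → proj₁ (∈-filterᵇ⁻ A (Pairs n₀) p)
  size-of : ∀ (F : Family n₀) ψ v → (∀ X → F X ≡ around ψ v X) → size F ≡ length (Big n₀) + length (Edges (around ψ v))
  size-of F ψ v e = trans (cong length (members-cong e)) (trans (layered-size (around-Layered ψ v)) (+-comm _ (length (Big n₀))))
  lenA : length (Edges (around {n₀} id zero)) ≡ 4 + M
  lenA = trans (↭-length (around-id-edges {n₀} zero)) (suc-injective (length-spokes {n₀} zero))
  open PartA {n₀} zero s 5≤n₀ 2≤s s≤ renaming (count-≤ to countA-≤; count-< to countA-<)
  open PartB {n₀} zero s M 16≤M refl 2≤s s≤ using (co; co-length; Pairs-split; co-K-length; optimal⇒star) renaming (count-≤ to countB-≤)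
  partA : Claim (length (Big n₀) + (4 + M)) (familyA n₀)
  partA = Conclude.conclude 7≤n₀ 2≤s s≤ (4 + M) (s≤s z≤n) (subst (_≤ length (Pairs n₀)) lenA (edges-≤ _)) (familyA n₀)
    (trans (size-of (familyA n₀) id zero (familyA-around (4 + M))) (cong (length (Big n₀) +_) lenA))
    (λ B lay e → ≤-trans (≤-reflexive (layered-count s lay)) (≤-trans (countA-≤ (Edges-Graph B) (cong suc e))
      (≤-reflexive (trans (cong (λ z → S z (starExt {n₀} zero s)) e) (sym valueA)))))
    unique
    where
    valueA : numIntersecting s (familyA n₀) ≡ S (4 + M) (starExt {n₀} zero s)
    valueA = trans (numIntersecting-cong s (familyA-around (4 + M))) (trans (star-value zero)
      (cong (λ z → S z (starExt {n₀} zero s)) (suc-injective (length-spokes {n₀} zero))))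
    unique : ∀ B → Layered B → length (Edges B) ≡ 4 + M → numIntersecting s (familyA n₀) ≤ numIntersecting s B → Isomorphic B (familyA n₀)
    unique B lay e le with inter? (Edges B) in int
    ... | true with intersecting-star zero {B} 5≤n₀ (cong suc e) int
    ...   | v , h = around-Isomorphic id {v = v} lay h zero (familyA-around (4 + M))
    unique B lay e le | false = ⊥-elim (<-irrefl refl (begin-strict
      numIntersecting s (familyA n₀) ≤⟨ le ⟩
      numIntersecting s B ≡⟨ layered-count s lay ⟩
      SS (Edges B) (extensions s) <⟨ countA-< (Edges-Graph B) (cong suc e) int ⟩
      S (length (Edges B)) (starExt {n₀} zero s) ≡⟨ cong (λ z → S z (starExt {n₀} zero s)) e ⟩
      S (4 + M) (starExt {n₀} zero s) ≡⟨ sym valueA ⟩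
      numIntersecting s (familyA n₀) ∎))
      where open ≤-Reasoning
  lenB : length (Edges (around not u)) ≡ (4 + M) C 2
  lenB = +-cancelʳ-≡ (4 + M) _ _ (begin
    length (Edges (around not u)) + (4 + M) ≡⟨ cong (length (Edges (around not u)) +_) (sym (co-K-length u)) ⟩
    length (Edges (around not u)) + length (Edges (co (around not u)))
      ≡⟨ sym (trans (↭-length (Pairs-split (around not u))) (length-++ (Edges (around not u)))) ⟩
    length (Pairs n₀) ≡⟨ length-Pairs n₀ ⟩
    n₀ C 2 ≡⟨ sym (nCk+nC[k+1]≡[n+1]C[k+1] (4 + M) 1) ⟩
    (4 + M) C 1 + (4 + M) C 2 ≡⟨ cong (_+ (4 + M) C 2) (nC1≡n (4 + M)) ⟩
    (4 + M) + (4 + M) C 2 ≡⟨ +-comm (4 + M) ((4 + M) C 2) ⟩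
    (4 + M) C 2 + (4 + M) ∎)
    where open ≡-Reasoning
  partB : Claim (length (Big n₀) + ((4 + M) C 2)) (familyB n₀)
  partB = Conclude.conclude 7≤n₀ 2≤s s≤ ((4 + M) C 2) 1≤C (subst (_≤ length (Pairs n₀)) lenB (edges-≤ _)) (familyB n₀)
    (trans (size-of (familyB n₀) not u (familyB-around (4 + M))) (cong (length (Big n₀) +_) lenB))
    (λ B lay e → ≤-trans (countB-≤ u B lay (co-length B e)) (≤-reflexive (sym valueB)))
    (λ B lay e le → let v , h = optimal⇒star u B lay (co-length B e) (≤-trans (≤-reflexive (sym valueB)) le) in
      around-Isomorphic not {v = v} lay h u (familyB-around (4 + M)))
    where
    valueB : numIntersecting s (familyB n₀) ≡ numIntersecting s (around not u)
    valueB = numIntersecting-cong s (familyB-around (4 + M))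
    1≤C : 1 ≤ (4 + M) C 2
    1≤C = ≤-trans (≤-trans (s≤s z≤n) (≤-reflexive (sym (nC1≡n (3 + M)))))
      (≤-trans (m≤m+n ((3 + M) C 1) ((3 + M) C 2)) (≤-reflexive (nCk+nC[k+1]≡[n+1]C[k+1] (3 + M) 1)))
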